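{- Let $\{D_x : x\in M^l\}$ be a definable family of subsets of $M^k$. Then for any $d\leq k$, the set of parameters $x\in M^l$ for which $\dim(D_x)=d$ is definable.
   Context: Setting. $T$ is a complete NIP theory in a multi-sorted language $L$ with a distinguished home sort, $\mathcal M$ is an $|L|^+$-saturated model of $T$, and $M$ is the home sort of $\mathcal M$. "Definable" means definable in $\mathcal M$, possibly with parameters. A definable set $A$ has dp-rank greater than $n$ if for $0 \le i \le n$ there are formulas $\phi_i(x,y_i)$ (parameters allowed) and infinite sets $B_i$ of tuples (from the sorts of $y_i$) such that for every $(b_0,\dots,b_n) \in B_0\times\cdots\times B_n$ there is $a \in A$ such that for all $0 \le i \le n$ and $y \in B_i$: $\mathcal M \models \phi_i(a,y)$ if and only if $y=b_i$. A nonempty set has dp-rank at least $0$. $\mathcal M$ is assumed dp-minimal: $M$ has dp-rank $1$. $M$ is equipped with a definable uniform structure $\mathcal B$: a collection of subsets of $M^2$ of the form $\mathcal B=\{\varphi(M^2,\bar c): \bar c \in D\}$ for some formula $\varphi(x,y,\bar z)$ and some definable set $D$, such that (i) $\bigcap \mathcal B$ is the diagonal of $M^2$; (ii) each $U\in\mathcal B$ is symmetric; (iii) for all $U,V \in \mathcal B$ there is $W \in \mathcal B$ with $W \subseteq U\cap V$; (iv) for all $U \in \mathcal B$ there is $V\in\mathcal B$ with $V \circ V \subseteq U$, where $U\circ V=\{(x,z): \exists y\ (x,y)\in U,\ (y,z)\in V\}$. For $x\in M$ put $U[x]=\{y:(x,y)\in U\}$; $M$ has the topology in which a set is open iff it contains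 some $U[x]$ ($U\in\mathcal B$) around each of its points $x$, and $M^k$ has the product topology. It is assumed that $M$ has no isolated points and that every infinite definable subset of $M$ has nonempty interior. Dimension. For a tuple $\bar a \in M^k$ and a small (of cardinality at most $|L|$) parameter set $C$, $\dim(\bar a/C)$ is the minimal $l$ such that some subtuple $\bar a'$ of $\bar a$ of length $l$ satisfies $\bar a \in \mathrm{acl}(C\bar a')$. For a $C$-definable set $A\subseteq M^k$, $\dim(A)=\max\{\dim(\bar a/C):\bar a\in A\}$; it does not depend on the choice of small $C$ over which $A$ is definable. $\dim(\emptyset)=-\infty$. -}

module Defs where

open import Level using (Level; Lift) renaming (suc to lsuc)
open import Data.Empty.Polymorphic using (⊥)
open import Data.Fin using (Fin; zero; suc)
open import Data.Fin.Subset using (Subset; ∣_∣) renaming (_∈_ to _∈ₛ_)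
open import Data.List using (List; []; _∷_; [_]; _++_; replicate)
open import Data.List.Membership.Propositional using (_∈_)
open import Data.List.Relation.Unary.All using (All; []; _∷_; head; lookup)
open import Data.List.Relation.Unary.All.Properties using (++⁺)
open import Data.Nat using (ℕ; suc; _≤_; _<_)
open import Data.Product using (Σ; ∃; ∃-syntax; _×_; _,_)
open import Data.Sum using (_⊎_)
open import Function.Bundles using (_⇔_)
open import Relation.Binary.PropositionalEquality using (_≡_)
open import Relation.Nullary using (¬_)
open import Relation.Nullary.Construct.Add.Infimum using (_₋; ⊥₋) renaming ([_] to fin)
open import Relation.Unary using (Pred; Empty; Satisfiable; _⊆_; _∪_)

open import Relation.Unary.Polymorphic using (U)

open import Relation.Binary.Construct.Add.Infimum.NonStrict _≤_ public using (_≤₋_)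

variable
  ℓ p : Level

Finite Infinite : {A : Set ℓ} → Pred A p → Set _
Finite   P = ∃[ xs ] ∀ {x} → P x → x ∈ xs
Infinite P = ¬ Finite P

record Language (ℓ : Level) : Set (lsuc ℓ) where
  field
    Sort : Set ℓ
    home : Sort
    Fun  : List Sort → Sort → Set ℓ
    Rel  : List Sort → Set ℓ

module Syntax (L : Language ℓ) where
  open Language L public

  -- A context lists the sorts of the free variables; variables are de Bruijn.
  Context : Set ℓ
  Context = List Sort

  data Term (Γ : Context) : Sort → Set ℓ where
    var : ∀ {s} → s ∈ Γ → Term Γ s
    app : ∀ {ss s} → Fun ss s → All (Term Γ) ss → Term Γ s

  infix  6 _≐_
  infixr 5 _∧′_
  infixr 4 _∨′_
  infixr 3 _⇒′_

  data Formula (Γ : Context) : Set ℓ where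
    ⊥′             : Formula Γ
    _≐_            : ∀ {s} → Term Γ s → Term Γ s → Formula Γ
    rel            : ∀ {ss} → Rel ss → All (Term Γ) ss → Formula Γ
    _∧′_ _∨′_ _⇒′_ : Formula Γ → Formula Γ → Formula Γ
    ∀′ ∃′          : ∀ s → Formula (s ∷ Γ) → Formula Γ

  Sentence : Set ℓ
  Sentence = Formula []

  Theory : Set (lsuc ℓ)
  Theory = Pred Sentence ℓ

  -- |L| is the cardinality of this type (so it is always infinite).
  LFormula : Set ℓ
  LFormula = ∃ Formula

  record Structure : Set (lsuc ℓ) where
    field
      Carrier : Sort → Set ℓ
      funᴵ    : ∀ {ss s} → Fun ss s → All Carrier ss → Carrier s
      relᴵ    : ∀ {ss} → Rel ss → Pred (All Carrier ss) ℓ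

    Tuple : Context → Set ℓ
    Tuple = All Carrier

    eval  : ∀ {Γ s} → Term Γ s → Tuple Γ → Carrier s
    evals : ∀ {Γ ss} → All (Term Γ) ss → Tuple Γ → Tuple ss
    eval (var i)    a = lookup a i
    eval (app f ts) a = funᴵ f (evals ts a)
    evals []       a = []
    evals (t ∷ ts) a = eval t a ∷ evals ts a

    ⟦_⟧ : ∀ {Γ} → Formula Γ → Pred (Tuple Γ) ℓ
    ⟦ ⊥′ ⟧       a = ⊥
    ⟦ t ≐ u ⟧    a = eval t a ≡ eval u a
    ⟦ rel R ts ⟧ a = relᴵ R (evals ts a)
    ⟦ φ ∧′ ψ ⟧   a = ⟦ φ ⟧ a × ⟦ ψ ⟧ a
    ⟦ φ ∨′ ψ ⟧   a = ⟦ φ ⟧ a ⊎ ⟦ ψ ⟧ a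
    ⟦ φ ⇒′ ψ ⟧   a = ⟦ φ ⟧ a → ⟦ ψ ⟧ a
    ⟦ ∀′ s φ ⟧   a = ∀ x → ⟦ φ ⟧ (x ∷ a)
    ⟦ ∃′ s φ ⟧   a = ∃[ x ] ⟦ φ ⟧ (x ∷ a)

  _⊨_ : Structure → Sentence → Set ℓ
  𝓝 ⊨ φ = Structure.⟦_⟧ 𝓝 φ []

  _⊨ᵀ_ : Structure → Theory → Set ℓ
  𝓝 ⊨ᵀ T = ∀ φ → T φ → 𝓝 ⊨ φ

  Complete : Theory → Set (lsuc ℓ)
  Complete T = ∀ φ → (∀ 𝓝 → 𝓝 ⊨ᵀ T → 𝓝 ⊨ φ) ⊎ (∀ 𝓝 → 𝓝 ⊨ᵀ T → ¬ (𝓝 ⊨ φ))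

  module _ (𝓝 : Structure) where
    open Structure 𝓝

    -- Some n tuples are shattered by φ(x;y).
    Shatters : ∀ {Γ Δ} → Formula (Γ ++ Δ) → ℕ → Set ℓ
    Shatters {Γ} {Δ} φ n =
      Σ (Fin n → Tuple Γ) λ a → Σ (Subset n → Tuple Δ) λ b →
        ∀ i I → ⟦ φ ⟧ (++⁺ (a i) (b I)) ⇔ i ∈ₛ I

  -- No formula has the independence property in a model of T.
  NIP : Theory → Set (lsuc ℓ)
  NIP T = ∀ Γ Δ (φ : Formula (Γ ++ Δ)) 𝓝 → 𝓝 ⊨ᵀ T →
    ¬ (∀ n → Shatters 𝓝 {Γ} {Δ} φ n)

module Semantics {L : Language ℓ} (𝓜 : Syntax.Structure L) where
  open Syntax L
  open Structure 𝓜

  M : Set ℓ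
  M = Carrier home

  infix 8 M^_
  M^_ : ℕ → Set ℓ
  M^ k = Tuple (replicate k home)

  _!_ : ∀ {k} → M^ k → Fin k → M
  _!_ {suc k} (x ∷ a) zero    = x
  _!_ {suc k} (x ∷ a) (suc i) = a ! i

  -- Elements of all sorts can serve as parameters.
  Element : Set ℓ
  Element = ∃ Carrier

  Params : Set (lsuc ℓ)
  Params = Pred Element ℓ

  -- Cardinality at most |L|: an injection of C into the L-formulas, given as
  -- a function on all elements whose values outside C are irrelevant.
  Small : Params → Set ℓ
  Small C = Σ (Element → LFormula) λ f →
    ∀ {x y} → C x → C y → f x ≡ f y → x ≡ y

  record FormulaOver (C : Params) (Γ : Context) : Set ℓ where
    field
      {Δ}     : Context
      formula : Formula (Γ ++ Δ)
      params  : Tuple Δ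
      over    : ∀ {s} (i : s ∈ Δ) → C (s , lookup params i)

    solutions : Pred (Tuple Γ) ℓ
    solutions a = ⟦ formula ⟧ (++⁺ a params)

  open FormulaOver public using (solutions)

  DefinableOver : Params → ∀ {Γ} → Pred (Tuple Γ) p → Set _
  DefinableOver C {Γ} A = Σ (FormulaOver C Γ) λ ψ → ∀ a → A a ⇔ solutions ψ a

  Definable : ∀ {Γ} → Pred (Tuple Γ) p → Set _
  Definable = DefinableOver U

  -- The family {D x : x ∈ M^l}: the set {(x , y) : y ∈ D x} is definable.
  DefinableFamily : ∀ l k → (M^ l → Pred (M^ k) ℓ) → Set ℓ
  DefinableFamily l k D =
    Σ (FormulaOver U (replicate l home ++ replicate k home)) λ ψ →
      ∀ x y → D x y ⇔ solutions ψ (++⁺ x y)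

  -- |L|⁺-saturation, for types in finitely many variables.
  Saturated : Set (lsuc ℓ)
  Saturated = ∀ C → Small C → ∀ Γ (q : Pred (FormulaOver C Γ) ℓ) →
    (∀ ψs → All q ψs → ∃[ a ] All (λ ψ → solutions ψ a) ψs) →
    ∃[ a ] ∀ ψ → q ψ → solutions ψ a

  dpRank>_ : ℕ → ∀ {Γ} → Pred (Tuple Γ) p → Set _
  dpRank>_ n {Γ} A =
    Σ (Fin (suc n) → Context) λ Δ →
    Σ (∀ i → FormulaOver U (Γ ++ Δ i)) λ φ →
    Σ (∀ i → Pred (Tuple (Δ i)) ℓ) λ B →
      (∀ i → Infinite (B i)) ×
      (∀ (b : ∀ i → Tuple (Δ i)) → (∀ i → B i (b i)) →
        ∃[ a ] A a × ∀ i y → B i y → solutions (φ i) (++⁺ a y) ⇔ y ≡ b i)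

  HasDpRank : ∀ {Γ} → Pred (Tuple Γ) p → ℕ → Set _
  HasDpRank A n = Satisfiable A × (∀ m → m < n → (dpRank> m) A) × ¬ (dpRank> n) A

  DpMinimal : Set (lsuc ℓ)
  DpMinimal = HasDpRank {p = ℓ} {Γ = [ home ]} U 1

  record DefinableUniformity : Set (lsuc ℓ) where
    field
      {Δ}         : Context
      φ           : Formula (home ∷ home ∷ Δ)
      D           : Pred (Tuple Δ) ℓ
      D-definable : Definable D

    -- The members of the uniformity are the sets ⟪ c ⟫ with c ∈ D.
    ⟪_⟫ : Tuple Δ → M → M → Set ℓ
    ⟪ c ⟫ x y = ⟦ φ ⟧ (x ∷ y ∷ c)

    field
      diagonal  : ∀ x y → (∀ c → D c → ⟪ c ⟫ x y) ⇔ x ≡ y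
      symmetric : ∀ c → D c → ∀ {x y} → ⟪ c ⟫ x y → ⟪ c ⟫ y x
      directed  : ∀ c d → D c → D d →
        ∃[ e ] D e × ∀ {x y} → ⟪ e ⟫ x y → ⟪ c ⟫ x y × ⟪ d ⟫ x y
      halving   : ∀ c → D c →
        ∃[ e ] D e × ∀ {x y z} → ⟪ e ⟫ x y → ⟪ e ⟫ y z → ⟪ c ⟫ x z

    Open : Pred M ℓ → Set ℓ
    Open O = ∀ {x} → O x → ∃[ c ] D c × ⟪ c ⟫ x ⊆ O

    HasInterior : Pred M ℓ → Set (lsuc ℓ)
    HasInterior A = Σ (Pred M ℓ) λ O → Open O × Satisfiable O × O ⊆ A

    NoIsolatedPoints : Set ℓ
    NoIsolatedPoints = ∀ x → ¬ Open (x ≡_)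

    InfiniteDefinableHasInterior : Set (lsuc ℓ)
    InfiniteDefinableHasInterior = ∀ (A : Pred M ℓ) →
      Definable {Γ = [ home ]} (λ a → A (head a)) → Infinite A → HasInterior A

  acl : Params → Params
  acl C (s , x) = Σ (FormulaOver C [ s ]) λ ψ →
    solutions ψ (x ∷ []) × Finite (solutions ψ)

  -- A subtuple is given by its set of coordinates.
  entries : ∀ {k} → M^ k → Subset k → Params
  entries a S x = ∃[ j ] j ∈ₛ S × x ≡ (home , a ! j)

  GeneratedBy : ∀ {k} → Params → M^ k → ℕ → Set ℓ
  GeneratedBy {k} C a l = Σ (Subset k) λ S → ∣ S ∣ ≡ l ×
    ∀ i → acl (C ∪ entries {k} a S) (home , a ! i)

  -- dim(a/C) = l
  TupleDim : ∀ k → Params → M^ k → ℕ → Set ℓ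
  TupleDim k C a l =
    GeneratedBy {k} C a l × (∀ m → GeneratedBy {k} C a m → l ≤ m)

  -- dim(A) = d, with ⊥₋ for −∞; the maximum is computed over some small C
  -- over which A is definable.
  Dim : ∀ k → Pred (M^ k) ℓ → ℕ ₋ → Set (lsuc ℓ)
  Dim k A ⊥₋      = Lift (lsuc ℓ) (Empty A)
  Dim k A (fin d) = Σ Params λ C → Small C × DefinableOver C A ×
    (∃[ a ] A a × TupleDim k C a d) ×
    (∀ a → A a → ∀ e → TupleDim k C a e → e ≤ d)

-- A definable A ⊆ M^k has dimension at least d if and only if one of its images
-- under coordinate projections to M^e, e ≥ d, contains a box; the latter is a
-- definable condition on the parameters of A.
--
-- If the image X has no interior, then it is covered by definable sets Z i whose
-- fibres in direction i are finite: either the first coordinate y of a point of X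
-- is not interior to its fibre, or the remaining coordinates lie in
-- { v : y is interior to the fibre of X over v }.  The latter has no interior: it is
-- an increasing union, over the neighbourhoods V of y, of definable sets one of which
-- would have interior, and then so would X.  Hence coordinates can be discarded until
-- the image under the remaining ones has interior.
-- Dimension is computed over sets C that need not contain the parameters c₀ of
-- the uniformity, so "interior" has to be replaced here by a parameter-free notion.
-- Any two uniformities 𝒟 c and 𝒟 d sharing finitely many first-order properties
-- with 𝒟 c₀ have the same germ at all but boundedly many points, and the germ
-- preferred by a finite list of uniformities with as many disagreements as possible
-- is independent of the list.
--
-- Conversely, a box in M^(n+1) is not covered by a definable family of finite sets
-- indexed by M^n.  Fixing the first index, the sets obtained have by induction no
-- projection to M^n with interior, so two coordinates are algebraic over the others;
-- fixing those, a one-dimensional family of finite sets covers a box in M^2.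
-- Shrinking the box so that it separates the points of each finite set gives two
-- independent families of sets, contradicting dp-minimality.

module Submission where

open import Defs
open import Level using (Level; lift; Lift) renaming (suc to lsuc)
open import Axiom.ExcludedMiddle using (ExcludedMiddle)
open import Data.Empty using (⊥-elim)
import Data.Empty.Polymorphic as Empty
open import Data.Fin as Fin using (Fin; zero; suc)
import Data.Fin.Properties as Finₚ
open import Data.Fin.Subset using (Subset; inside; outside; ∣_∣; _-_) renaming (_∈_ to _∈ₛ_; ⊤ to full)
open import Data.Fin.Subset.Properties using (_∈?_; x∈p⇒∣p-x∣<∣p∣; x∈p∧x≢y⇒x∈p-y; ∈⊤)
open import Data.List as List using (List; []; _∷_; [_]; _++_; replicate; length)
open import Data.List.Membership.Propositional using (_∈_; _∉_)
open import Data.List.Membership.Propositional.Properties as ∈ₚ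
  using (∈-++⁺ˡ; ∈-++⁺ʳ; ∈-++⁻; ∈-∃++; ∈-map⁺; ∈-concat⁺′; ∈-lookup)
open import Data.List.Properties using (length-++; length-replicate; length-tabulate)
open import Data.List.Relation.Binary.Permutation.Propositional using (_↭_)
open import Data.List.Relation.Binary.Permutation.Propositional.Properties using (map⁺; shift; ↭-length; ∈-resp-↭)
open import Data.List.Relation.Unary.All as All using (All; []; _∷_; lookup)
import Data.List.Relation.Unary.All.Properties as Allₚ
open Allₚ using (++⁺; ++⁻ˡ; ++⁻ʳ)
open import Data.List.Relation.Unary.AllPairs using ([]; _∷_)
open import Data.List.Relation.Unary.Any as Any using (here; there)
open import Data.List.Relation.Unary.Any.Properties using (lookup-index)
open import Data.List.Relation.Unary.Unique.Propositional using (Unique)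
import Data.List.Relation.Unary.Unique.Propositional.Properties as Uniqueₚ
open import Data.Maybe using (Maybe; just; nothing)
open import Data.Nat as Nat using (ℕ; zero; suc; _+_; _*_; _^_; _≤_; _<_; z≤n; s≤s; _⊔_; NonZero)
open import Data.Nat.ListAction using (sum)
open import Data.Nat.ListAction.Properties using (sum-↭)
open import Data.Nat.Properties
  hiding (_≟_; _≤?_)
open import Data.Nat.Tactic.RingSolver using (solve-∀)
open import Data.Product as Prod using (Σ; ∃; ∃-syntax; _×_; _,_; proj₁; proj₂)
open import Data.Sum as Sum using (_⊎_; inj₁; inj₂; [_,_]′)
open import Data.Unit.Polymorphic using (⊤; tt)
open import Data.Vec using ([]; _∷_; here; there)
open import Function using (_∘_; id)
open import Function.Bundles using (_⇔_; mk⇔; Equivalence)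
open import Relation.Binary.PropositionalEquality
  using (_≡_; _≢_; refl; sym; trans; cong; cong₂; subst; module ≡-Reasoning)
open import Relation.Nullary using (¬_; Dec; yes; no)
open import Relation.Nullary.Construct.Add.Infimum as Infimum using (_₋; ⊥₋)
open import Relation.Unary using (Pred; _∪_) renaming (_⊆_ to _⊆ₚ_)
open import Relation.Unary.Polymorphic using (U)

open Equivalence using (to; from)

-- Renaming of variables in formulas.

module Renaming {ℓ : Level} (L : Language ℓ) where
  open Syntax L

  Ren : Context → Context → Set ℓ
  Ren Γ Γ′ = ∀ {s} → s ∈ Γ → s ∈ Γ′

  liftRen : ∀ {Γ Γ′ s} → Ren Γ Γ′ → Ren (s ∷ Γ) (s ∷ Γ′)
  liftRen ρ (here e)  = here e
  liftRen ρ (there i) = there (ρ i)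

  renTerm  : ∀ {Γ Γ′ s} → Ren Γ Γ′ → Term Γ s → Term Γ′ s
  renTerms : ∀ {Γ Γ′ ss} → Ren Γ Γ′ → All (Term Γ) ss → All (Term Γ′) ss
  renTerm ρ (var i)    = var (ρ i)
  renTerm ρ (app f ts) = app f (renTerms ρ ts)
  renTerms ρ []       = []
  renTerms ρ (t ∷ ts) = renTerm ρ t ∷ renTerms ρ ts

  ren : ∀ {Γ Γ′} → Ren Γ Γ′ → Formula Γ → Formula Γ′
  ren ρ ⊥′         = ⊥′
  ren ρ (t ≐ u)    = renTerm ρ t ≐ renTerm ρ u
  ren ρ (rel R ts) = rel R (renTerms ρ ts)
  ren ρ (φ ∧′ ψ)   = ren ρ φ ∧′ ren ρ ψ
  ren ρ (φ ∨′ ψ)   = ren ρ φ ∨′ ren ρ ψ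
  ren ρ (φ ⇒′ ψ)   = ren ρ φ ⇒′ ren ρ ψ
  ren ρ (∀′ s φ)   = ∀′ s (ren (liftRen ρ) φ)
  ren ρ (∃′ s φ)   = ∃′ s (ren (liftRen ρ) φ)

  module _ (𝓜 : Structure) where
    open Structure 𝓜

    Agree : ∀ {Γ Γ′} → Ren Γ Γ′ → Tuple Γ → Tuple Γ′ → Set ℓ
    Agree {Γ} ρ t t′ = ∀ {s} (i : s ∈ Γ) → lookup t i ≡ lookup t′ (ρ i)

    liftAgree : ∀ {Γ Γ′ s} {ρ : Ren Γ Γ′} {t t′} (x : Carrier s) →
      Agree ρ t t′ → Agree (liftRen ρ) (x ∷ t) (x ∷ t′)
    liftAgree x h (here refl) = refl
    liftAgree x h (there i)   = h i

    eval-ren  : ∀ {Γ Γ′ s} {ρ : Ren Γ Γ′} {t t′} → Agree ρ t t′ →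
      (u : Term Γ s) → eval u t ≡ eval (renTerm ρ u) t′
    evals-ren : ∀ {Γ Γ′ ss} {ρ : Ren Γ Γ′} {t t′} → Agree ρ t t′ →
      (us : All (Term Γ) ss) → evals us t ≡ evals (renTerms ρ us) t′
    eval-ren h (var i)    = h i
    eval-ren h (app f us) = cong (funᴵ f) (evals-ren h us)
    evals-ren h []       = refl
    evals-ren h (u ∷ us) = cong₂ _∷_ (eval-ren h u) (evals-ren h us)

    ⟦ren⟧ : ∀ {Γ Γ′} {ρ : Ren Γ Γ′} {t t′} → Agree ρ t t′ →
      (φ : Formula Γ) → ⟦ φ ⟧ t ⇔ ⟦ ren ρ φ ⟧ t′
    ⟦ren⟧ h ⊥′         = mk⇔ id id
    ⟦ren⟧ h (u ≐ v)    =
      mk⇔ (λ e → trans (sym (eval-ren h u)) (trans e (eval-ren h v)))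
          (λ e → trans (eval-ren h u) (trans e (sym (eval-ren h v))))
    ⟦ren⟧ h (rel R us) =
      mk⇔ (subst (relᴵ R) (evals-ren h us)) (subst (relᴵ R) (sym (evals-ren h us)))
    ⟦ren⟧ h (φ ∧′ ψ)   =
      mk⇔ (Prod.map (to (⟦ren⟧ h φ)) (to (⟦ren⟧ h ψ)))
          (Prod.map (from (⟦ren⟧ h φ)) (from (⟦ren⟧ h ψ)))
    ⟦ren⟧ h (φ ∨′ ψ)   =
      mk⇔ (Sum.map (to (⟦ren⟧ h φ)) (to (⟦ren⟧ h ψ)))
          (Sum.map (from (⟦ren⟧ h φ)) (from (⟦ren⟧ h ψ)))
    ⟦ren⟧ h (φ ⇒′ ψ)   =
      mk⇔ (λ f → to (⟦ren⟧ h ψ) ∘ f ∘ from (⟦ren⟧ h φ))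
          (λ f → from (⟦ren⟧ h ψ) ∘ f ∘ to (⟦ren⟧ h φ))
    ⟦ren⟧ h (∀′ s φ)   =
      mk⇔ (λ f x → to (⟦ren⟧ (liftAgree x h) φ) (f x))
          (λ f x → from (⟦ren⟧ (liftAgree x h) φ) (f x))
    ⟦ren⟧ h (∃′ s φ)   =
      mk⇔ (Prod.map₂ λ {x} → to (⟦ren⟧ (liftAgree x h) φ))
          (Prod.map₂ λ {x} → from (⟦ren⟧ (liftAgree x h) φ))

-- Closure properties of definable sets.

module Definability {ℓ : Level} {L : Language ℓ} (𝓜 : Syntax.Structure L) where
  open Syntax L
  open Structure 𝓜
  open Semantics 𝓜
  open Renaming L

  hd : ∀ {s Γ} → Tuple (s ∷ Γ) → Carrier s
  hd (x ∷ _) = x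

  tl : ∀ {s Γ} → Tuple (s ∷ Γ) → Tuple Γ
  tl (_ ∷ t) = t

  -- Each constant carries a proof that it lies in `C`, so substitution never leaves the formulas
  -- over `C`.
  data PtOver (C : Params) (Γ : Context) (s : Sort) : Set ℓ where
    at  : s ∈ Γ → PtOver C Γ s
    cst : (x : Carrier s) → C (s , x) → PtOver C Γ s

  Sub : Params → Context → Context → Set ℓ
  Sub C Γ = All (PtOver C Γ)

  value : ∀ {C Γ s} → PtOver C Γ s → Tuple Γ → Carrier s
  value (at i)    t = lookup t i
  value (cst x _) t = x

  values : ∀ {C Γ Θ} → Sub C Γ Θ → Tuple Γ → Tuple Θ
  values []      t = []
  values (p ∷ σ) t = value p t ∷ values σ t

  lookup-values : ∀ {C Γ Θ} (σ : Sub C Γ Θ) t {s} (i : s ∈ Θ) →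
    lookup (values σ t) i ≡ value (lookup σ i) t
  lookup-values (p ∷ σ) t (here refl) = refl
  lookup-values (p ∷ σ) t (there i)   = lookup-values σ t i

  lookup-++⁺ˡ : ∀ {Γ Δ} (t : Tuple Γ) {u : Tuple Δ} {s} (i : s ∈ Γ) →
    lookup (++⁺ t u) (∈-++⁺ˡ i) ≡ lookup t i
  lookup-++⁺ˡ (x ∷ t) (here refl) = refl
  lookup-++⁺ˡ (x ∷ t) (there i)   = lookup-++⁺ˡ t i

  lookup-++⁺ʳ : ∀ {Γ Δ} (t : Tuple Γ) {u : Tuple Δ} {s} (i : s ∈ Δ) →
    lookup (++⁺ t u) (∈-++⁺ʳ Γ i) ≡ lookup u i
  lookup-++⁺ʳ []      i = refl
  lookup-++⁺ʳ (x ∷ t) i = lookup-++⁺ʳ t i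

  wkSub : ∀ {C Γ Θ s} → Sub C Γ Θ → Sub C (s ∷ Γ) Θ
  wkSub = All.map λ { (at i) → at (there i) ; (cst x c) → cst x c }

  values-wk : ∀ {C Γ Θ s} (σ : Sub C Γ Θ) {x : Carrier s} {t} →
    values (wkSub σ) (x ∷ t) ≡ values σ t
  values-wk []              = refl
  values-wk (at i ∷ σ)      = cong (_ ∷_) (values-wk σ)
  values-wk (cst x _ ∷ σ)   = cong (_ ∷_) (values-wk σ)

  idSub : ∀ {C} Γ → Sub C Γ Γ
  idSub []      = []
  idSub (s ∷ Γ) = at (here refl) ∷ wkSub (idSub Γ)

  values-id : ∀ {C Γ} (t : Tuple Γ) → values (idSub {C} Γ) t ≡ t
  values-id []      = refl
  values-id (x ∷ t) = cong (x ∷_) (trans (values-wk (idSub _)) (values-id t))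

  constSub : ∀ {C Γ Δ} (t : Tuple Δ) → (∀ {s} (i : s ∈ Δ) → C (s , lookup t i)) → Sub C Γ Δ
  constSub []      c = []
  constSub (x ∷ t) c = cst x (c (here refl)) ∷ constSub t (c ∘ there)

  values-const : ∀ {C Γ Δ} (t : Tuple Δ) {c : ∀ {s} (i : s ∈ Δ) → C (s , lookup t i)} {a : Tuple Γ} →
    values {C} (constSub t c) a ≡ t
  values-const []      = refl
  values-const (x ∷ t) = cong (x ∷_) (values-const t)

  values-++ : ∀ {C Γ Θ Θ′} (σ : Sub C Γ Θ) (τ : Sub C Γ Θ′) t →
    values (++⁺ σ τ) t ≡ ++⁺ (values σ t) (values τ t)
  values-++ []      τ t = refl
  values-++ (p ∷ σ) τ t = cong (_ ∷_) (values-++ σ τ t)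

  _∘ˢ_ : ∀ {C Γ Δ Θ} → Sub C Δ Θ → Sub C Γ Δ → Sub C Γ Θ
  σ ∘ˢ τ = All.map (λ { (at i) → lookup τ i ; (cst x c) → cst x c }) σ

  values-∘ : ∀ {C Γ Δ Θ} (σ : Sub C Δ Θ) (τ : Sub C Γ Δ) t →
    values (σ ∘ˢ τ) t ≡ values σ (values τ t)
  values-∘ []            τ t = refl
  values-∘ (at i ∷ σ)    τ t = cong₂ _∷_ (sym (lookup-values τ t i)) (values-∘ σ τ t)
  values-∘ (cst x _ ∷ σ) τ t = cong (x ∷_) (values-∘ σ τ t)

  -- A `FormulaOver` keeps its parameters in one tuple, so the constants scattered through `σ` are
  -- collected; `place` tells where each variable is then read.
  record Constants {C Γ Θ} (σ : Sub C Γ Θ) : Set ℓ where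
    field
      {Δ}     : Context
      params  : Tuple Δ
      over    : ∀ {s} (i : s ∈ Δ) → C (s , lookup params i)
      place   : ∀ {s} → s ∈ Θ → s ∈ Γ ⊎ s ∈ Δ
      correct : ∀ {s} (i : s ∈ Θ) t →
        lookup (values σ t) i ≡ [ lookup t , lookup params ]′ (place i)

  constants : ∀ {C Γ Θ} (σ : Sub C Γ Θ) → Constants σ
  constants [] = record { params = [] ; over = λ () ; place = λ () ; correct = λ () }
  constants (at i ∷ σ) = record
    { params  = params
    ; over    = over
    ; place   = λ { (here refl) → inj₁ i ; (there j) → place j }
    ; correct = λ { (here refl) t → refl ; (there j) t → correct j t } }
    where open Constants (constants σ)
  constants (cst x c ∷ σ) = record
    { params  = x ∷ params
    ; over    = λ { (here refl) → c ; (there i) → over i }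
    ; place   = λ { (here refl) → inj₂ (here refl) ; (there j) → Sum.map₂ there (place j) }
    ; correct = λ { (here refl) t → refl ; (there j) t → trans (correct j t) (lemma t (place j)) } }
    where
    open Constants (constants σ)
    lemma : ∀ t {s} (p : s ∈ _ ⊎ s ∈ Δ) →
      [ lookup t , lookup params ]′ p ≡ [ lookup t , lookup (x ∷ params) ]′ (Sum.map₂ there p)
    lemma t (inj₁ _) = refl
    lemma t (inj₂ _) = refl

  -- Once its constants are moved to the parameter tuple, `σ` is a mere renaming and `⟦ren⟧`
  -- applies.
  def-formula : ∀ {C Γ Θ} (φ : Formula Θ) (σ : Sub C Γ Θ) →
    DefinableOver C {Γ} (λ t → ⟦ φ ⟧ (values σ t))
  def-formula {Γ = Γ} φ σ =
    record { formula = ren ρ φ ; params = params ; over = over } ,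
    λ t → ⟦ren⟧ 𝓜 (agree t) φ
    where
    open Constants (constants σ)
    ρ : Ren _ (Γ ++ Δ)
    ρ i = [ ∈-++⁺ˡ , ∈-++⁺ʳ Γ ]′ (place i)
    lemma : ∀ t {s} (p : s ∈ Γ ⊎ s ∈ Δ) →
      [ lookup t , lookup params ]′ p ≡ lookup (++⁺ t params) ([ ∈-++⁺ˡ , ∈-++⁺ʳ Γ ]′ p)
    lemma t (inj₁ i) = sym (lookup-++⁺ˡ t i)
    lemma t (inj₂ i) = sym (lookup-++⁺ʳ t i)
    agree : ∀ t → Agree 𝓜 ρ (values σ t) (++⁺ t params)
    agree t i = trans (correct i t) (lemma t (place i))

  private variable
    C      : Params
    Γ Γ′ Δ Θ : Context
    s      : Sort
    q r    : Level

  ψ-sub : (ψ : FormulaOver C Γ) → Sub C Γ (Γ ++ FormulaOver.Δ ψ)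
  ψ-sub ψ = ++⁺ (idSub _) (constSub (FormulaOver.params ψ) (FormulaOver.over ψ))

  values-ψ : (ψ : FormulaOver C Γ) (t : Tuple Γ) → values (ψ-sub ψ) t ≡ ++⁺ t (FormulaOver.params ψ)
  values-ψ {C} ψ t = trans (values-++ {C} (idSub _) _ t)
    (cong₂ ++⁺ (values-id {C} t) (values-const {C} (FormulaOver.params ψ)))

  def-⇔ : {P : Pred (Tuple Γ) q} {Q : Pred (Tuple Γ) r} → (∀ t → P t ⇔ Q t) →
    DefinableOver C Q → DefinableOver C P
  def-⇔ e (ψ , h) = ψ , λ t → mk⇔ (to (h t) ∘ to (e t)) (from (e t) ∘ from (h t))

  private
    -- The two formulas are first placed in disjoint blocks of variables; `σ` then identifies the
    -- two copies of `Γ` and plugs in both parameter tuples.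
    binary : ∀ {P : Pred (Tuple Γ) q} {Q : Pred (Tuple Γ) r} {p} {X : Pred (Tuple Γ) p}
      (_⊗_ : ∀ {Θ} → Formula Θ → Formula Θ → Formula Θ) →
      (∀ t {Θ} (φ χ : Formula Θ) u → P t ⇔ ⟦ φ ⟧ u → Q t ⇔ ⟦ χ ⟧ u → X t ⇔ ⟦ φ ⊗ χ ⟧ u) →
      DefinableOver C P → DefinableOver C Q → DefinableOver C X
    binary {Γ = Γ} {C = C} _⊗_ sem (ψ , h) (ψ′ , h′) =
      def-⇔ (λ t → sem t _ _ (values σ t)
              (mk⇔ (to (⟦ren⟧ 𝓜 (agˡ t) φ) ∘ to (h t)) (from (h t) ∘ from (⟦ren⟧ 𝓜 (agˡ t) φ)))
              (mk⇔ (to (⟦ren⟧ 𝓜 (agʳ t) φ′) ∘ to (h′ t)) (from (h′ t) ∘ from (⟦ren⟧ 𝓜 (agʳ t) φ′))))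
        (def-formula (ren ∈-++⁺ˡ φ ⊗ ren ι φ′) σ)
      where
      φ  = FormulaOver.formula ψ
      φ′ = FormulaOver.formula ψ′
      σ  = ++⁺ (ψ-sub ψ) (ψ-sub ψ′)
      ι : Ren (Γ ++ FormulaOver.Δ ψ′) ((Γ ++ FormulaOver.Δ ψ) ++ (Γ ++ FormulaOver.Δ ψ′))
      ι = ∈-++⁺ʳ (Γ ++ FormulaOver.Δ ψ)
      eq : ∀ t → values σ t ≡ ++⁺ (++⁺ t (FormulaOver.params ψ)) (++⁺ t (FormulaOver.params ψ′))
      eq t = trans (values-++ {C} (ψ-sub ψ) _ t) (cong₂ ++⁺ (values-ψ ψ t) (values-ψ ψ′ t))
      agˡ : ∀ t → Agree 𝓜 ∈-++⁺ˡ (++⁺ t (FormulaOver.params ψ)) (values σ t)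
      agˡ t i rewrite eq t = sym (lookup-++⁺ˡ (++⁺ t _) i)
      agʳ : ∀ t → Agree 𝓜 ι (++⁺ t (FormulaOver.params ψ′)) (values σ t)
      agʳ t i rewrite eq t = sym (lookup-++⁺ʳ (++⁺ t (FormulaOver.params ψ)) i)

  module _ {P : Pred (Tuple Γ) q} {Q : Pred (Tuple Γ) r} where
    opaque
      def-× : DefinableOver C P → DefinableOver C Q → DefinableOver C (λ t → P t × Q t)
      def-× = binary _∧′_ λ t φ χ u e f →
        mk⇔ (Prod.map (to e) (to f)) (Prod.map (from e) (from f))

      def-⊎ : DefinableOver C P → DefinableOver C Q → DefinableOver C (λ t → P t ⊎ Q t)
      def-⊎ = binary _∨′_ λ t φ χ u e f →
        mk⇔ (Sum.map (to e) (to f)) (Sum.map (from e) (from f))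

      def-→ : DefinableOver C P → DefinableOver C Q → DefinableOver C (λ t → P t → Q t)
      def-→ = binary _⇒′_ λ t φ χ u e f →
        mk⇔ (λ g → to f ∘ g ∘ from e) (λ g → from f ∘ g ∘ to e)

  opaque
    def-⊥ : DefinableOver C {Γ} (λ _ → Empty.⊥ {ℓ})
    def-⊥ = record { formula = ⊥′ ; params = [] ; over = λ () } , λ t → mk⇔ id id

    def-true : {P : Pred (Tuple Γ) q} → (∀ t → P t) → DefinableOver C P
    def-true h = def-⇔ (λ t → mk⇔ (λ _ → id) (λ _ → h t)) (def-→ def-⊥ def-⊥)

    def-false : {P : Pred (Tuple Γ) q} → (∀ t → ¬ P t) → DefinableOver C P
    def-false h = def-⇔ (λ t → mk⇔ (λ p → ⊥-elim (h t p)) λ ()) def-⊥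

    def-¬ : {P : Pred (Tuple Γ) q} → DefinableOver C P → DefinableOver C (λ t → ¬ P t)
    def-¬ d = def-⇔ (λ t → mk⇔ (λ n p → ⊥-elim (n p)) (λ f p → Empty.⊥-elim (f p))) (def-→ d def-⊥)

    def-dec : {P : Set q} → Dec P → DefinableOver C {Γ} (λ _ → P)
    def-dec (yes p) = def-true λ _ → p
    def-dec (no ¬p) = def-false λ _ → ¬p

    def-∃ : {P : Tuple Γ → Carrier s → Set q} →
      DefinableOver C {s ∷ Γ} (λ t → P (tl t) (hd t)) → DefinableOver C (λ t → ∃ (P t))
    def-∃ (ψ , h) = record { formula = ∃′ _ formula ; params = params ; over = over } ,
      λ t → mk⇔ (Prod.map₂ λ {x} → to (h (x ∷ t))) (Prod.map₂ λ {x} → from (h (x ∷ t)))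
      where open FormulaOver ψ

    def-∀ : {P : Tuple Γ → Carrier s → Set q} →
      DefinableOver C {s ∷ Γ} (λ t → P (tl t) (hd t)) → DefinableOver C (λ t → ∀ x → P t x)
    def-∀ (ψ , h) = record { formula = ∀′ _ formula ; params = params ; over = over } ,
      λ t → mk⇔ (λ f x → to (h (x ∷ t)) (f x)) (λ f x → from (h (x ∷ t)) (f x))
      where open FormulaOver ψ

    def-∃* : ∀ Δ {P : Tuple Γ → Tuple Δ → Set q} →
      DefinableOver C {Δ ++ Γ} (λ t → P (++⁻ʳ Δ t) (++⁻ˡ Δ t)) → DefinableOver C (λ t → ∃ (P t))
    def-∃* []      d = def-⇔ (λ t → mk⇔ (λ { ([] , p) → p }) ([] ,_)) d
    def-∃* (s ∷ Δ) {P} d =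
      def-⇔ (λ t → mk⇔ (λ { (x ∷ u , p) → u , x , p }) (λ { (u , x , p) → x ∷ u , p }))
        (def-∃* Δ {λ t u → ∃ λ x → P t (x ∷ u)}
          (def-∃ (def-⇔ (λ { (x ∷ t) → mk⇔ id id }) d)))

    def-∀* : ∀ Δ {P : Tuple Γ → Tuple Δ → Set q} →
      DefinableOver C {Δ ++ Γ} (λ t → P (++⁻ʳ Δ t) (++⁻ˡ Δ t)) → DefinableOver C (λ t → ∀ u → P t u)
    def-∀* []      d = def-⇔ (λ t → mk⇔ (λ f → f []) (λ { p [] → p })) d
    def-∀* (s ∷ Δ) {P} d =
      def-⇔ (λ t → mk⇔ (λ f u x → f (x ∷ u)) (λ { f (x ∷ u) → f u x }))
        (def-∀* Δ {λ t u → ∀ x → P t (x ∷ u)}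
          (def-∀ (def-⇔ (λ { (x ∷ t) → mk⇔ id id }) d)))

    def-∀Fin : ∀ {n} {P : Tuple Γ → Fin n → Set q} →
      (∀ i → DefinableOver C (λ t → P t i)) → DefinableOver C (λ t → ∀ i → P t i)
    def-∀Fin {n = zero}  d = def-true λ t ()
    def-∀Fin {n = suc n} d =
      def-⇔ (λ t → mk⇔ (λ f → f zero , f ∘ suc) (λ { (p , f) zero → p ; (p , f) (suc i) → f i }))
        (def-× (d zero) (def-∀Fin (d ∘ suc)))

    def-∃Fin : ∀ {n} {P : Tuple Γ → Fin n → Set q} →
      (∀ i → DefinableOver C (λ t → P t i)) → DefinableOver C (λ t → ∃ (P t))
    def-∃Fin {n = zero}  d = def-false λ { t (() , _) }
    def-∃Fin {n = suc n} d =
      def-⇔ (λ t → mk⇔ (λ { (zero , p) → inj₁ p ; (suc i , p) → inj₂ (i , p) })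
                       [ (zero ,_) , Prod.map suc id ]′)
        (def-⊎ (d zero) (def-∃Fin (d ∘ suc)))

    def-∃Subset : ∀ {n} {P : Tuple Γ → Subset n → Set q} →
      (∀ S → DefinableOver C (λ t → P t S)) → DefinableOver C (λ t → ∃ (P t))
    def-∃Subset {n = zero}  d = def-⇔ (λ t → mk⇔ (λ { ([] , p) → p }) ([] ,_)) (d [])
    def-∃Subset {n = suc n} d =
      def-⇔ (λ t → mk⇔ (λ { (inside ∷ S , p) → inj₁ (S , p) ; (outside ∷ S , p) → inj₂ (S , p) })
                       [ Prod.map (inside ∷_) id , Prod.map (outside ∷_) id ]′)
        (def-⊎ (def-∃Subset (d ∘ (inside ∷_))) (def-∃Subset (d ∘ (outside ∷_))))

  -- The maps of tuples each of whose components is a variable or a parameter.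
  record IsPt (C : Params) (Γ : Context) (s : Sort) (f : Tuple Γ → Carrier s) : Set ℓ where
    field
      pt     : PtOver C Γ s
      correct : ∀ t → value pt t ≡ f t

  record IsMap (C : Params) (Γ Δ : Context) (f : Tuple Γ → Tuple Δ) : Set ℓ where
    field
      sub    : Sub C Γ Δ
      correct : ∀ t → values sub t ≡ f t

  opaque
    def-pre : {P : Pred (Tuple Δ) q} → DefinableOver C P →
      ∀ {f : Tuple Γ → Tuple Δ} → IsMap C Γ Δ f → DefinableOver C (λ t → P (f t))
    def-pre {P = P} (ψ , h) {f} m = def-⇔ (λ t →
        mk⇔ (subst ⟦ formula ⟧ (sym (eq t)) ∘ to (h (f t))) (from (h (f t)) ∘ subst ⟦ formula ⟧ (eq t)))
      (def-formula formula (ψ-sub ψ ∘ˢ IsMap.sub m))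
      where
      open FormulaOver ψ
      eq : ∀ t → values (ψ-sub ψ ∘ˢ IsMap.sub m) t ≡ ++⁺ (f t) params
      eq t = trans (values-∘ (ψ-sub ψ) (IsMap.sub m) t)
               (trans (values-ψ ψ _) (cong (λ u → ++⁺ u params) (IsMap.correct m t)))

    def-⟦_⟧ : (φ : Formula Δ) {f : Tuple Γ → Tuple Δ} → IsMap C Γ Δ f →
      DefinableOver C (λ t → ⟦ φ ⟧ (f t))
    def-⟦ φ ⟧ m = def-⇔ (λ t → mk⇔ (subst ⟦ φ ⟧ (sym (IsMap.correct m t))) (subst ⟦ φ ⟧ (IsMap.correct m t)))
      (def-formula φ (IsMap.sub m))

    def-≡ : {f g : Tuple Γ → Carrier s} → IsPt C Γ s f → IsPt C Γ s g →
      DefinableOver C (λ t → f t ≡ g t)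
    def-≡ m n = def-⇔ (λ t →
        mk⇔ (λ e → trans (IsPt.correct m t) (trans e (sym (IsPt.correct n t))))
            (λ e → trans (sym (IsPt.correct m t)) (trans e (IsPt.correct n t))))
      (def-formula (var (here refl) ≐ var (there (here refl))) (IsPt.pt m ∷ IsPt.pt n ∷ []))

  infixr 5 _∷ᵐ_ _++ᵐ_

  opaque
    []ᵐ : IsMap C Γ [] (λ _ → [])
    []ᵐ = record { sub = [] ; correct = λ t → refl }

    idᵐ : IsMap C Γ Γ (λ t → t)
    idᵐ {C = C} = record { sub = idSub _ ; correct = values-id {C} }

    _∷ᵐ_ : {f : Tuple Γ → Carrier s} {g : Tuple Γ → Tuple Δ} →
      IsPt C Γ s f → IsMap C Γ Δ g → IsMap C Γ (s ∷ Δ) (λ t → f t ∷ g t)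
    _∷ᵐ_ m n = record
      { sub = IsPt.pt m ∷ IsMap.sub n
      ; correct = λ t → cong₂ _∷_ (IsPt.correct m t) (IsMap.correct n t) }

    _++ᵐ_ : {f : Tuple Γ → Tuple Δ} {g : Tuple Γ → Tuple Θ} →
      IsMap C Γ Δ f → IsMap C Γ Θ g → IsMap C Γ (Δ ++ Θ) (λ t → ++⁺ (f t) (g t))
    _++ᵐ_ m n = record
      { sub = ++⁺ (IsMap.sub m) (IsMap.sub n)
      ; correct = λ t → trans (values-++ (IsMap.sub m) (IsMap.sub n) t)
                             (cong₂ ++⁺ (IsMap.correct m t) (IsMap.correct n t)) }

    tlᵐ : {f : Tuple Γ → Tuple (s ∷ Δ)} → IsMap C Γ (s ∷ Δ) f → IsMap C Γ Δ (λ t → tl (f t))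
    tlᵐ m = record
      { sub = All.tail (IsMap.sub m)
      ; correct = λ t → trans (lemma (IsMap.sub m) t) (cong tl (IsMap.correct m t)) }
      where
      lemma : (σ : Sub C Γ (s ∷ Δ)) → ∀ t → values (All.tail σ) t ≡ tl (values σ t)
      lemma (p ∷ σ) t = refl

    hdᵖ : {f : Tuple Γ → Tuple (s ∷ Δ)} → IsMap C Γ (s ∷ Δ) f → IsPt C Γ s (λ t → hd (f t))
    hdᵖ m = record
      { pt = All.head (IsMap.sub m)
      ; correct = λ t → trans (lemma (IsMap.sub m) t) (cong hd (IsMap.correct m t)) }
      where
      lemma : (σ : Sub C Γ (s ∷ Δ)) → ∀ t → value (All.head σ) t ≡ hd (values σ t)
      lemma (p ∷ σ) t = refl

    takeᵐ : {f : Tuple Γ → Tuple (Δ ++ Θ)} → IsMap C Γ (Δ ++ Θ) f →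
      IsMap C Γ Δ (λ t → ++⁻ˡ Δ (f t))
    takeᵐ {Δ = Δ} m = record
      { sub = ++⁻ˡ Δ (IsMap.sub m)
      ; correct = λ t → trans (lemma Δ (IsMap.sub m) t) (cong (++⁻ˡ Δ) (IsMap.correct m t)) }
      where
      lemma : ∀ Δ (σ : Sub C Γ (Δ ++ Θ)) t → values (++⁻ˡ Δ σ) t ≡ ++⁻ˡ Δ (values σ t)
      lemma []      σ       t = refl
      lemma (s ∷ Δ) (p ∷ σ) t = cong (_ ∷_) (lemma Δ σ t)

    dropᵐ : {f : Tuple Γ → Tuple (Δ ++ Θ)} → IsMap C Γ (Δ ++ Θ) f →
      IsMap C Γ Θ (λ t → ++⁻ʳ Δ (f t))
    dropᵐ {Δ = Δ} m = record
      { sub = ++⁻ʳ Δ (IsMap.sub m)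
      ; correct = λ t → trans (lemma Δ (IsMap.sub m) t) (cong (++⁻ʳ Δ) (IsMap.correct m t)) }
      where
      lemma : ∀ Δ (σ : Sub C Γ (Δ ++ Θ)) t → values (++⁻ʳ Δ σ) t ≡ ++⁻ʳ Δ (values σ t)
      lemma []      σ       t = refl
      lemma (s ∷ Δ) (p ∷ σ) t = lemma Δ σ t

    at! : ∀ {k} {f : Tuple Γ → M^ k} {i : Fin k} → IsMap C Γ (replicate k home) f →
      IsPt C Γ home (λ t → _!_ {k} (f t) i)
    at! {k = k} {f} {i} m = record
      { pt = fst (IsMap.sub m) i
      ; correct = λ t → trans (lemma (IsMap.sub m) i t) (cong (λ u → _!_ {k} u i) (IsMap.correct m t)) }
      where
      fst : ∀ {k} → Sub C Γ (replicate k home) → Fin k → PtOver C Γ home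
      fst (p ∷ σ) zero    = p
      fst (p ∷ σ) (suc i) = fst σ i
      lemma : ∀ {k} (σ : Sub C Γ (replicate k home)) i t → value (fst σ i) t ≡ _!_ {k} (values σ t) i
      lemma {k = suc k} (p ∷ σ) zero    t = refl
      lemma {k = suc k} (p ∷ σ) (suc i) t = lemma σ i t

    paramᵖ : {x : Carrier s} → IsPt U Γ s (λ _ → x)
    paramᵖ {x = x} = record { pt = cst x tt ; correct = λ t → refl }

    paramᵐ : {u : Tuple Δ} → IsMap U Γ Δ (λ _ → u)
    paramᵐ {u = u} = record { sub = constSub u (λ _ → tt) ; correct = λ t → values-const {U} u }

    constᵖ : {x : Carrier s} → C (s , x) → IsPt C Γ s (λ _ → x)
    constᵖ {x = x} c = record { pt = cst x c ; correct = λ t → refl }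

    constᵐ : (u : Tuple Δ) → (∀ {s} (i : s ∈ Δ) → C (s , lookup u i)) → IsMap C Γ Δ (λ _ → u)
    constᵐ {C = C} u c = record { sub = constSub u c ; correct = λ t → values-const {C} u }

    def-mono : ∀ {C′} {P : Pred (Tuple Γ) q} → (∀ {x} → C x → C′ x) → DefinableOver C P → DefinableOver C′ P
    def-mono C⊆C′ (ψ , h) = record { formula = formula ; params = params ; over = C⊆C′ ∘ over } , h
      where open FormulaOver ψ

    wkᵖ : {f : Tuple Γ → Carrier s} → ∀ {s′} → IsPt C Γ s f → IsPt C (s′ ∷ Γ) s (λ t → f (tl t))
    wkᵖ {C = C} m = record { pt = All.head (wkSub (IsPt.pt m ∷ []))
                   ; correct = λ { (x ∷ t) → trans (cong hd (values-wk {C} (IsPt.pt m ∷ []))) (IsPt.correct m t) } }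

    wkᵐ : {f : Tuple Γ → Tuple Δ} → ∀ {s′} → IsMap C Γ Δ f → IsMap C (s′ ∷ Γ) Δ (λ t → f (tl t))
    wkᵐ {C = C} m = record { sub = wkSub (IsMap.sub m)
                   ; correct = λ { (x ∷ t) → trans (values-wk {C} (IsMap.sub m)) (IsMap.correct m t) } }

    wk*ᵖ : {f : Tuple Γ → Carrier s} → ∀ Δ → IsPt C Γ s f → IsPt C (Δ ++ Γ) s (λ t → f (++⁻ʳ Δ t))
    wk*ᵖ []      m = m
    wk*ᵖ (s ∷ Δ) m = record { pt = IsPt.pt (wkᵖ (wk*ᵖ Δ m))
                            ; correct = λ { (x ∷ t) → IsPt.correct (wkᵖ (wk*ᵖ Δ m)) (x ∷ t) } }

    wk*ᵐ : {f : Tuple Γ → Tuple Θ} → ∀ Δ → IsMap C Γ Θ f → IsMap C (Δ ++ Γ) Θ (λ t → f (++⁻ʳ Δ t))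
    wk*ᵐ []      m = m
    wk*ᵐ (s ∷ Δ) m = record { sub = IsMap.sub (wkᵐ (wk*ᵐ Δ m))
                            ; correct = λ { (x ∷ t) → IsMap.correct (wkᵐ (wk*ᵐ Δ m)) (x ∷ t) } }

  -- Quantifying over the argument maps builds closure under substitution into definability, so such
  -- predicates combine in any context without explicit preimages.
  Def₁ : Params → (Tuple Θ → Set q) → Set _
  Def₁ C P = ∀ {Γ f} → IsMap C Γ _ f → DefinableOver C (λ t → P (f t))

  Def₂ : Params → (Tuple Θ → Tuple Δ → Set q) → Set _
  Def₂ C P = ∀ {Γ f g} → IsMap C Γ _ f → IsMap C Γ _ g → DefinableOver C (λ t → P (f t) (g t))

  DefFam : Params → (Tuple Θ → Carrier s → Set q) → Set _
  DefFam C P = ∀ {Γ f g} → IsMap C Γ _ f → IsPt C Γ _ g → DefinableOver C (λ t → P (f t) (g t))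

  opaque
    v₀ : IsPt C (s ∷ Γ) s hd
    v₀ = hdᵖ idᵐ

    fst* : ∀ Δ → IsMap C (Δ ++ Γ) Δ (++⁻ˡ Δ)
    fst* Δ = takeᵐ idᵐ

  ++⁻ˡ∘++⁺ : (t : Tuple Γ) {u : Tuple Δ} → ++⁻ˡ Γ (++⁺ t u) ≡ t
  ++⁻ˡ∘++⁺ []      = refl
  ++⁻ˡ∘++⁺ (x ∷ t) = cong (x ∷_) (++⁻ˡ∘++⁺ t)

  ++⁻ʳ∘++⁺ : (t : Tuple Γ) {u : Tuple Δ} → ++⁻ʳ Γ (++⁺ t u) ≡ u
  ++⁻ʳ∘++⁺ []      = refl
  ++⁻ʳ∘++⁺ (x ∷ t) = ++⁻ʳ∘++⁺ t

  opaque
    Def₂-mono : ∀ {C C′} {P : Tuple Θ → Tuple Δ → Set q} → (∀ {x} → C x → C′ x) → Def₂ C P → Def₂ C′ P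
    Def₂-mono {Θ = Θ} {P = P} C⊆C′ d {f = f} {g} m n =
      def-⇔ (λ t → mk⇔ (subst id (sym (eq t))) (subst id (eq t)))
        (def-pre {P = λ t → P (++⁻ˡ Θ t) (++⁻ʳ Θ t)} (def-mono C⊆C′ (d (takeᵐ idᵐ) (dropᵐ idᵐ))) (m ++ᵐ n))
      where
      eq : ∀ t → P (++⁻ˡ Θ (++⁺ (f t) (g t))) (++⁻ʳ Θ (++⁺ (f t) (g t))) ≡ P (f t) (g t)
      eq t = cong₂ P (++⁻ˡ∘++⁺ (f t)) (++⁻ʳ∘++⁺ (f t))

-- Classical logic and counting.

module Classical {ℓ : Level} (em : ExcludedMiddle ℓ) where

  dne : {P : Set ℓ} → ¬ ¬ P → P
  dne {P} h with em {P}
  ... | yes p = p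
  ... | no ¬p = ⊥-elim (h ¬p)

Finite-map : ∀ {a b p q} {A : Set a} {B : Set b} {P : Pred A p} {Q : Pred B q} (f : A → B) →
  (∀ {y} → Q y → ∃[ x ] P x × f x ≡ y) → Finite P → Finite Q
Finite-map f h (xs , cov) = List.map f xs , λ y∈ → let x , x∈ , eq = h y∈ in subst (_∈ List.map f xs) eq (∈-map⁺ f (cov x∈))

Finite-bind : ∀ {a b p q r} {A : Set a} {B : Set b} {P : Pred A p} {Q : A → Pred B q} {R : Pred B r} →
  Finite P → (∀ x → Finite (Q x)) → (∀ {y} → R y → ∃[ x ] P x × Q x y) → Finite R
Finite-bind {Q = Q} (xs , cov) fin h = List.concat (List.map ys xs) , λ y∈ → let x , x∈ , q = h y∈ in
    ∈-concat⁺′ (proj₂ (fin x) q) (∈-map⁺ ys (cov x∈))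
  where
  ys : _ → List _
  ys x = proj₁ (fin x)

module Counting {ℓ : Level} (em : ExcludedMiddle ℓ) {A : Set ℓ} where
  open Classical em

  -- In contrast to `Infinite`, this is a first-order condition for each fixed number, hence
  -- definable in families.
  AtLeast : ℕ → Pred A ℓ → Set ℓ
  AtLeast zero    Y = ⊤
  AtLeast (suc n) Y = ∃[ x ] Y x × AtLeast n (λ z → Y z × z ≢ x)

  opaque
    AtLeast-mono : ∀ {Y Z : Pred A ℓ} n → Y ⊆ₚ Z → AtLeast n Y → AtLeast n Z
    AtLeast-mono zero    Y⊆Z _           = tt
    AtLeast-mono (suc n) Y⊆Z (x , y , h) =
      x , Y⊆Z y , AtLeast-mono n (λ { (y , ne) → Y⊆Z y , ne }) h

    AtLeast-pred : ∀ {Y : Pred A ℓ} n → AtLeast (suc n) Y → AtLeast n Y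
    AtLeast-pred n (x , y , h) = AtLeast-mono n proj₁ h

    AtLeast-≤ : ∀ {Y : Pred A ℓ} {m n} → m ≤ n → AtLeast n Y → AtLeast m Y
    AtLeast-≤ {m = zero}  z≤n     h           = tt
    AtLeast-≤ {m = suc m} (s≤s l) (x , y , h) = x , y , AtLeast-≤ l h

    remove : ∀ {x : A} {xs} → x ∈ xs →
      ∃[ ys ] length xs ≡ suc (length ys) × (∀ {z} → z ∈ xs → z ≢ x → z ∈ ys)
    remove {x} x∈xs with ∈-∃++ x∈xs
    ... | as , bs , refl = as ++ bs , len , mem
      where
      len : length (as ++ x ∷ bs) ≡ suc (length (as ++ bs))
      len = trans (length-++ as) (trans (+-suc _ _) (cong suc (sym (length-++ as))))
      mem : ∀ {z} → z ∈ as ++ x ∷ bs → z ≢ x → z ∈ as ++ bs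
      mem z∈ z≢x with ∈-++⁻ as z∈
      ... | inj₁ z∈as         = ∈-++⁺ˡ z∈as
      ... | inj₂ (here z≡x)   = ⊥-elim (z≢x z≡x)
      ... | inj₂ (there z∈bs) = ∈-++⁺ʳ as z∈bs

    AtLeast⇒≤ : ∀ n {Y : Pred A ℓ} xs → (∀ {x} → Y x → x ∈ xs) → AtLeast n Y → n ≤ length xs
    AtLeast⇒≤ zero    xs cov _ = z≤n
    AtLeast⇒≤ (suc n) xs cov (x , y , h) with remove (cov y)
    ... | ys , eq , rest = subst (suc n ≤_) (sym eq)
            (s≤s (AtLeast⇒≤ n ys (λ { (y , ne) → rest (cov y) ne }) h))

    ¬AtLeast⇒Finite : ∀ n {Y : Pred A ℓ} → ¬ AtLeast n Y → Finite Y
    ¬AtLeast⇒Finite zero    ¬h = ⊥-elim (¬h tt)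
    ¬AtLeast⇒Finite (suc n) {Y} ¬h with em {∃ Y}
    ... | no ¬y = [] , λ y → ⊥-elim (¬y (_ , y))
    ... | yes (x , y) with ¬AtLeast⇒Finite n (λ h → ¬h (x , y , h))
    ... | xs , cov = x ∷ xs , mem
      where
      mem : ∀ {z} → Y z → z ∈ x ∷ xs
      mem {z} y with em {z ≡ x}
      ... | yes z≡x = here z≡x
      ... | no  z≢x = there (cov (y , z≢x))

    Finite⇒¬AtLeast : {Y : Pred A ℓ} → Finite Y → ∃[ n ] ¬ AtLeast n Y
    Finite⇒¬AtLeast (xs , cov) = suc (length xs) , λ h → 1+n≰n (AtLeast⇒≤ _ xs cov h)

    Infinite⇒AtLeast : ∀ n {Y : Pred A ℓ} → Infinite Y → AtLeast n Y
    Infinite⇒AtLeast n inf = dne (inf ∘ ¬AtLeast⇒Finite n)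

    Finite-⊆ : {Y Z : Pred A ℓ} → Y ⊆ₚ Z → Finite Z → Finite Y
    Finite-⊆ Y⊆Z (xs , cov) = xs , cov ∘ Y⊆Z

    Unique⇒AtLeast : ∀ {Y : Pred A ℓ} {xs} → Unique xs → All Y xs → AtLeast (length xs) Y
    Unique⇒AtLeast []       []       = tt
    Unique⇒AtLeast (a ∷ as) (y ∷ ys) =
      _ , y , Unique⇒AtLeast as (All.zipWith (λ { (y , ne) → y , ne ∘ sym }) (ys , a))

    AtLeast⇒Unique : ∀ n {Y : Pred A ℓ} → AtLeast n Y → ∃[ xs ] length xs ≡ n × Unique xs × All Y xs
    AtLeast⇒Unique zero    _           = [] , refl , [] , []
    AtLeast⇒Unique (suc n) (x , y , h) with AtLeast⇒Unique n h
    ... | xs , eq , u , all =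
      x ∷ xs , cong suc eq , All.map (λ { (_ , ne) → ne ∘ sym }) all ∷ u , y ∷ All.map proj₁ all

    Finite-⊎ : {Y Z : Pred A ℓ} → Finite Y → Finite Z → Finite (λ x → Y x ⊎ Z x)
    Finite-⊎ (xs , cx) (ys , cy) = xs ++ ys , λ { (inj₁ y) → ∈-++⁺ˡ (cx y) ; (inj₂ z) → ∈-++⁺ʳ xs (cy z) }

    Finite-⋃ : ∀ {n} {Y : Fin n → Pred A ℓ} → (∀ i → Finite (Y i)) → Finite (λ x → ∃[ i ] Y i x)
    Finite-⋃ {zero}  fin = [] , λ { (() , _) }
    Finite-⋃ {suc n} fin = Finite-⊆ (λ { (zero , y) → inj₁ y ; (suc i , y) → inj₂ (i , y) })
      (Finite-⊎ (fin zero) (Finite-⋃ (fin ∘ suc)))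

-- Sums over lists.

module Sums where
  private variable
    a b : Level
    A : Set a
    B : Set b

  σ : (A → ℕ) → List A → ℕ
  σ f []       = 0
  σ f (x ∷ xs) = f x + σ f xs

  σ-++ : ∀ (f : A → ℕ) xs ys → σ f (xs ++ ys) ≡ σ f xs + σ f ys
  σ-++ f []       ys = refl
  σ-++ f (x ∷ xs) ys = trans (cong (f x +_) (σ-++ f xs ys)) (sym (+-assoc (f x) _ _))

  σ-mono : ∀ {f g : A → ℕ} xs → (∀ x → f x ≤ g x) → σ f xs ≤ σ g xs
  σ-mono []       h = z≤n
  σ-mono (x ∷ xs) h = +-mono-≤ (h x) (σ-mono xs h)

  σ-cong : ∀ {f g : A → ℕ} xs → (∀ x → f x ≡ g x) → σ f xs ≡ σ g xs
  σ-cong []       h = refl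
  σ-cong (x ∷ xs) h = cong₂ _+_ (h x) (σ-cong xs h)

  σ-≤ : ∀ {f : A → ℕ} {K} {xs} → All (λ x → f x ≤ K) xs → σ f xs ≤ length xs * K
  σ-≤ []       = z≤n
  σ-≤ (h ∷ hs) = +-mono-≤ h (σ-≤ hs)

  σ-≥ : ∀ {f : A → ℕ} {K} {xs} → All (λ x → K ≤ f x) xs → length xs * K ≤ σ f xs
  σ-≥ []       = z≤n
  σ-≥ (h ∷ hs) = +-mono-≤ h (σ-≥ hs)

  σ-+ : ∀ (f g : A → ℕ) xs → σ (λ x → f x + g x) xs ≡ σ f xs + σ g xs
  σ-+ f g []       = refl
  σ-+ f g (x ∷ xs) rewrite σ-+ f g xs = lemma (f x) (g x) (σ f xs) (σ g xs)
    where
    lemma : ∀ a b c d → (a + b) + (c + d) ≡ (a + c) + (b + d)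
    lemma = solve-∀

  σ-* : ∀ k (f : A → ℕ) xs → σ (λ x → k * f x) xs ≡ k * σ f xs
  σ-* k f []       = sym (*-zeroʳ k)
  σ-* k f (x ∷ xs) rewrite σ-* k f xs = sym (*-distribˡ-+ k (f x) (σ f xs))

  σ-0 : ∀ (xs : List A) → σ (λ _ → 0) xs ≡ 0
  σ-0 []       = refl
  σ-0 (x ∷ xs) = σ-0 xs

  σ-swap : ∀ (h : A → B → ℕ) xs ys → σ (λ x → σ (h x) ys) xs ≡ σ (λ y → σ (λ x → h x y) xs) ys
  σ-swap h []       ys = sym (σ-0 ys)
  σ-swap h (x ∷ xs) ys rewrite σ-swap h xs ys = sym (σ-+ (h x) _ ys)

  σ-↭ : ∀ (f : A → ℕ) {xs ys} → xs ↭ ys → σ f xs ≡ σ f ys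
  σ-↭ f {xs} {ys} p = trans (lemma xs) (trans (sum-↭ (map⁺ f p)) (sym (lemma ys)))
    where
    lemma : ∀ zs → σ f zs ≡ sum (List.map f zs)
    lemma []       = refl
    lemma (z ∷ zs) = cong (f z +_) (lemma zs)

  σ-tabulate : ∀ {f : A → ℕ} {g : B → ℕ} xs (h : Fin (length xs) → B) →
    (∀ i → f (List.lookup xs i) ≤ g (h i)) → σ f xs ≤ σ g (List.tabulate h)
  σ-tabulate []       h le = z≤n
  σ-tabulate (x ∷ xs) h le = +-mono-≤ (le zero) (σ-tabulate xs (h ∘ suc) (le ∘ suc))

  extract : ∀ {x : A} {xs} → x ∈ xs → ∃[ ys ] xs ↭ x ∷ ys
  extract {x = x} x∈ with ∈-∃++ x∈
  ... | as , bs , refl = as ++ bs , shift x as bs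

  σ-⊆ : ∀ (f : A → ℕ) {xs ys} → Unique xs → All (_∈ ys) xs → σ f xs ≤ σ f ys
  σ-⊆ f []       []         = z≤n
  σ-⊆ f {x ∷ xs} {ys} (x∉ ∷ u) (x∈ ∷ xs⊆) with extract x∈
  ... | zs , p rewrite σ-↭ f p = +-monoʳ-≤ (f x) (σ-⊆ f u (All.zipWith lemma (x∉ , xs⊆)))
    where
    lemma : ∀ {y} → x ≢ y × y ∈ ys → y ∈ zs
    lemma (ne , y∈) with ∈-resp-↭ p y∈
    ... | here eq  = ⊥-elim (ne (sym eq))
    ... | there y∈ = y∈

-- Lists with extremal disagreement for a family of equivalence relations.

module Majority {ℓ : Level} (em : ExcludedMiddle ℓ) {A Y : Set ℓ}
  (E : Pred A ℓ) (_~[_]_ : A → Y → A → Set ℓ)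
  (~-refl  : ∀ {y c} → c ~[ y ] c)
  (~-sym   : ∀ {y c d} → c ~[ y ] d → d ~[ y ] c)
  (~-trans : ∀ {y c d e} → c ~[ y ] d → d ~[ y ] e → c ~[ y ] e)
  (N : ℕ) (close : ∀ {c d} → E c → E d → ¬ Counting.AtLeast em (suc N) (λ y → ¬ c ~[ y ] d))
  {c₀ : A} (c₀∈E : E c₀) where

  open Counting em
  open Sums

  -- The discrete metric on the classes of `~[ y ]`, so that disagreements can be added up.
  δ : Y → A → A → ℕ
  δ y c d with em {c ~[ y ] d}
  ... | yes _ = 0
  ... | no _  = 1

  δ-~ : ∀ {y c d} → c ~[ y ] d → δ y c d ≡ 0
  δ-~ {y} {c} {d} h with em {c ~[ y ] d}
  ... | yes _ = refl
  ... | no ¬h = ⊥-elim (¬h h)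

  δ-≁ : ∀ {y c d} → ¬ c ~[ y ] d → δ y c d ≡ 1
  δ-≁ {y} {c} {d} ¬h with em {c ~[ y ] d}
  ... | yes h = ⊥-elim (¬h h)
  ... | no _  = refl

  δ-01 : ∀ y c d → δ y c d ≡ 0 ⊎ (δ y c d ≡ 1 × ¬ c ~[ y ] d)
  δ-01 y c d with em {c ~[ y ] d}
  ... | yes _ = inj₁ refl
  ... | no ¬h = inj₂ (refl , ¬h)

  δ≤1 : ∀ y c d → δ y c d ≤ 1
  δ≤1 y c d with δ-01 y c d
  ... | inj₁ e       = ≤-trans (≤-reflexive e) z≤n
  ... | inj₂ (e , _) = ≤-reflexive e

  δ-congˡ : ∀ {y c d} e → c ~[ y ] d → δ y c e ≡ δ y d e
  δ-congˡ {y} {c} {d} e h = helper em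
    where
    helper : Dec (d ~[ y ] e) → δ y c e ≡ δ y d e
    helper (yes k) = trans (δ-~ (~-trans h k)) (sym (δ-~ k))
    helper (no ¬k) = trans (δ-≁ (¬k ∘ ~-trans (~-sym h))) (sym (δ-≁ ¬k))

  δ-sym : ∀ y c d → δ y c d ≡ δ y d c
  δ-sym y c d = helper em
    where
    helper : Dec (c ~[ y ] d) → δ y c d ≡ δ y d c
    helper (yes h) = trans (δ-~ h) (sym (δ-~ (~-sym h)))
    helper (no ¬h) = trans (δ-≁ ¬h) (sym (δ-≁ (¬h ∘ ~-sym)))

  D : Y → List A → List A → ℕ
  D y cs ds = σ (λ c → σ (δ y c) ds) cs

  D-sym : ∀ y cs ds → D y cs ds ≡ D y ds cs
  D-sym y cs ds = trans (σ-swap (δ y) cs ds) (σ-cong ds λ d → σ-cong cs λ c → δ-sym y c d)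

  D-∷∷ : ∀ y c cs d ds →
    D y (c ∷ cs) (d ∷ ds) ≡ (δ y c d + σ (δ y c) ds) + (σ (δ y d) cs + D y cs ds)
  D-∷∷ y c cs d ds = cong ((δ y c d + σ (δ y c) ds) +_)
    (trans (σ-+ (λ c → δ y c d) _ cs) (cong (_+ D y cs ds) (σ-cong cs λ c → δ-sym y c d)))

  D-↭ : ∀ y {cs cs′ ds ds′} → cs ↭ cs′ → ds ↭ ds′ → D y cs ds ≡ D y cs′ ds′
  D-↭ y {cs} p q = trans (σ-cong cs λ c → σ-↭ (δ y c) q) (σ-↭ _ p)

  D≤ : ∀ y cs ds → D y cs ds ≤ length cs * length ds
  D≤ y cs ds = ≤-trans (σ-≤ (All.universal (λ c → σ-≤ (All.universal (δ≤1 y c) ds)) cs))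
    (≤-reflexive (cong (length cs *_) (*-identityʳ _)))

  D≡ : ∀ y {cs ds} → (∀ {c d} → c ∈ cs → d ∈ ds → ¬ c ~[ y ] d) → length cs * length ds ≤ D y cs ds
  D≡ y {cs} {ds} h = ≤-trans (≤-reflexive (cong (length cs *_) (sym (*-identityʳ _))))
    (σ-≥ (All.tabulate λ c∈ → σ-≥ (All.tabulate λ d∈ → ≤-reflexive (sym (δ-≁ (h c∈ d∈))))))

  -- The discrete metric is of negative type: cancelling an equivalent pair
  -- from both lists does not change the difference of the two sides.
  D-negative : ∀ y n cs ds → length cs ≡ n → length ds ≡ n →
    D y cs cs + D y ds ds ≤ 2 * D y cs ds
  D-negative y n cs ds lc ld with em {∃[ c ] ∃[ d ] c ∈ cs × d ∈ ds × c ~[ y ] d}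
  D-negative y zero [] [] lc ld | yes (_ , _ , () , _)
  D-negative y (suc n) cs ds lc ld | yes (c , d , c∈ , d∈ , c~d)
    with extract c∈ | extract d∈
  ... | cs′ , p | ds′ , q = begin
    D y cs cs + D y ds ds
      ≡⟨ cong₂ _+_ (trans (D-↭ y p p) (D-∷∷ y c cs′ c cs′)) (trans (D-↭ y q q) (D-∷∷ y d ds′ d ds′)) ⟩
    ((δ y c c + X) + (X + D′)) + ((δ y d d + Z) + (Z + D″))
      ≡⟨ cong₂ (λ u v → ((u + X) + (X + D′)) + ((v + Z) + (Z + D″))) (δ-~ ~-refl) (δ-~ ~-refl) ⟩
    (X + (X + D′)) + (Z + (Z + D″))
      ≡⟨ lemma₁ X Z D′ D″ ⟩
    2 * (Z + X) + (D′ + D″)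
      ≤⟨ +-monoʳ-≤ (2 * (Z + X)) (D-negative y n cs′ ds′
           (suc-injective (trans (sym (↭-length p)) lc)) (suc-injective (trans (sym (↭-length q)) ld))) ⟩
    2 * (Z + X) + 2 * D y cs′ ds′
      ≡⟨ lemma₂ X Z (D y cs′ ds′) ⟩
    2 * ((0 + Z) + (X + D y cs′ ds′))
      ≡⟨ cong₂ (λ u v → 2 * ((u + v) + (X + D y cs′ ds′))) (sym (δ-~ c~d))
           (sym (σ-cong ds′ λ e → δ-congˡ e c~d)) ⟩
    2 * ((δ y c d + σ (δ y c) ds′) + (X + D y cs′ ds′))
      ≡⟨ cong (λ v → 2 * ((δ y c d + σ (δ y c) ds′) + (v + D y cs′ ds′)))
           (σ-cong cs′ λ e → δ-congˡ e c~d) ⟩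
    2 * ((δ y c d + σ (δ y c) ds′) + (σ (δ y d) cs′ + D y cs′ ds′))
      ≡⟨ cong (2 *_) (sym (trans (D-↭ y p q) (D-∷∷ y c cs′ d ds′))) ⟩
    2 * D y cs ds ∎
    where
    open ≤-Reasoning
    X  = σ (δ y c) cs′
    Z  = σ (δ y d) ds′
    D′ = D y cs′ cs′
    D″ = D y ds′ ds′
    lemma₁ : ∀ X Z P Q → (X + (X + P)) + (Z + (Z + Q)) ≡ 2 * (Z + X) + (P + Q)
    lemma₁ = solve-∀
    lemma₂ : ∀ X Z P → 2 * (Z + X) + 2 * P ≡ 2 * ((0 + Z) + (X + P))
    lemma₂ = solve-∀
  D-negative y zero [] (_ ∷ _) lc () | yes _
  -- Without an equivalent pair the mixed sum attains the maximum `n * n`, which bounds the other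
  -- two sums.
  D-negative y n cs ds lc ld | no ¬h = begin
    D y cs cs + D y ds ds                           ≤⟨ +-mono-≤ (D≤ y cs cs) (D≤ y ds ds) ⟩
    length cs * length cs + length ds * length ds   ≡⟨ cong₂ (λ u v → u * u + v * v) lc ld ⟩
    n * n + n * n                                   ≡⟨ cong (n * n +_) (sym (+-identityʳ _)) ⟩
    2 * (n * n)                                     ≡⟨ cong₂ (λ u v → 2 * (u * v)) (sym lc) (sym ld) ⟩
    2 * (length cs * length ds)                     ≤⟨ *-monoʳ-≤ 2 (D≡ y λ c∈ d∈ h → ¬h (_ , _ , c∈ , d∈ , h)) ⟩
    2 * D y cs ds                                   ∎
    where open ≤-Reasoning

  D-++ : ∀ y cs ds → D y (cs ++ ds) (cs ++ ds) ≡ (D y cs cs + D y ds ds) + 2 * D y cs ds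
  D-++ y cs ds = begin
    D y (cs ++ ds) (cs ++ ds)
      ≡⟨ σ-++ _ cs ds ⟩
    D y cs (cs ++ ds) + D y ds (cs ++ ds)
      ≡⟨ cong₂ _+_ (lemma cs) (lemma ds) ⟩
    (D y cs cs + D y cs ds) + (D y ds cs + D y ds ds)
      ≡⟨ cong (λ v → (D y cs cs + D y cs ds) + (v + D y ds ds)) (D-sym y ds cs) ⟩
    (D y cs cs + D y cs ds) + (D y cs ds + D y ds ds)
      ≡⟨ lemma₂ (D y cs cs) (D y cs ds) (D y ds ds) ⟩
    (D y cs cs + D y ds ds) + 2 * D y cs ds ∎
    where
    open ≡-Reasoning
    lemma : ∀ es → D y es (cs ++ ds) ≡ D y es cs + D y es ds
    lemma es = trans (σ-cong es λ e → σ-++ (δ y e) cs ds) (σ-+ _ _ es)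
    lemma₂ : ∀ a b c → (a + b) + (b + c) ≡ (a + c) + 2 * b
    lemma₂ = solve-∀

  energy : List Y → List A → ℕ
  energy L cs = σ (λ y → D y cs cs) L

  -- After exchanging the sums, each pair of entries contributes at most `N` by `close`, however
  -- long `L` is.
  energy-bound : ∀ {L cs} → Unique L → All E cs → energy L cs ≤ length cs * (length cs * N)
  energy-bound {L} {cs} uL Ecs = begin
    energy L cs
      ≡⟨ σ-swap (λ y c → σ (δ y c) cs) L cs ⟩
    σ (λ c → σ (λ y → σ (δ y c) cs) L) cs
      ≤⟨ σ-≤ (All.map (λ {c} c∈E → ≤-trans (≤-reflexive (σ-swap (λ y → δ y c) L cs))
                                           (σ-≤ (All.map (count uL c∈E) Ecs))) Ecs) ⟩
    length cs * (length cs * N) ∎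
    where
    open ≤-Reasoning
    -- The number of disagreements is realised as the length of a list of distinct points, the form
    -- to which `close` applies.
    witnesses : ∀ {L} c d → Unique L →
      ∃[ xs ] Unique xs × All (_∈ L) xs × All (λ y → ¬ c ~[ y ] d) xs × length xs ≡ σ (λ y → δ y c d) L
    witnesses c d [] = [] , [] , [] , [] , refl
    witnesses {y ∷ L} c d (y∉ ∷ u) with witnesses c d u | δ-01 y c d
    ... | xs , uxs , xs⊆ , h , len | inj₁ e =
      xs , uxs , All.map there xs⊆ , h , trans len (cong (_+ σ (λ y → δ y c d) L) (sym e))
    ... | xs , uxs , xs⊆ , h , len | inj₂ (e , ¬h) =
      y ∷ xs , All.map (λ z∈ → All.lookup y∉ z∈) xs⊆ ∷ uxs , here refl ∷ All.map there xs⊆ , ¬h ∷ h ,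
      trans (cong suc len) (cong (_+ σ (λ y → δ y c d) L) (sym e))
    count : ∀ {L} → Unique L → ∀ {c} → E c → ∀ {d} → E d → σ (λ y → δ y c d) L ≤ N
    count u {c} c∈E {d} d∈E with witnesses c d u
    ... | xs , uxs , _ , h , len = ≮⇒≥ λ lt →
      close c∈E d∈E (AtLeast-≤ (≤-trans lt (≤-reflexive (sym len))) (Unique⇒AtLeast uxs h))

  -- Lengths are powers of two so that the concatenation of two lists for `k` competes for `suc k`.
  Attains : ℕ → ℕ → Set ℓ
  Attains k K = ∃[ cs ] ∃[ L ] length cs ≡ 2 ^ k × All E cs × Unique L × K ≤ energy L cs

  Attains-bound : ∀ {k K} → Attains k K → K ≤ 2 ^ k * (2 ^ k * N)
  Attains-bound (cs , L , len , Ecs , uL , le) =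
    ≤-trans le (≤-trans (energy-bound uL Ecs) (≤-reflexive (cong (λ v → v * (v * N)) len)))

  maximum : ∀ {P : ℕ → Set ℓ} B → (∀ K → P K → K ≤ B) → P 0 → ∃[ a ] P a × ¬ P (suc a)
  maximum {P} B bound p₀ = go B 0 p₀ ≤-refl
    where
    -- The distance from `a` to `B` is at most `fuel`, so the search stops.
    go : ∀ fuel a → P a → B ≤ a + fuel → ∃[ a ] P a × ¬ P (suc a)
    go zero a p le = a , p , λ p′ →
      1+n≰n (≤-trans (bound _ p′) (≤-trans le (≤-reflexive (+-identityʳ a))))
    go (suc fuel) a p le with em {P (suc a)}
    ... | no ¬p  = a , p , ¬p
    ... | yes p′ = go fuel (suc a) p′ (≤-trans le (≤-reflexive (+-suc a fuel)))

  attains₀ : ∀ k → Attains k 0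
  attains₀ k = proj₁ (copies (2 ^ k)) , [] , proj₁ (proj₂ (copies (2 ^ k))) , proj₂ (proj₂ (copies (2 ^ k))) , [] , z≤n
    where
    copies : ∀ n → ∃[ cs ] length cs ≡ n × All E cs
    copies zero    = [] , refl , []
    copies (suc n) with copies n
    ... | cs , len , Ecs = c₀ ∷ cs , cong suc len , c₀∈E ∷ Ecs

  best : ∀ k → ∃[ a ] Attains k a × ¬ Attains k (suc a)
  best k = maximum (2 ^ k * (2 ^ k * N)) (λ K → Attains-bound {k}) (attains₀ k)

  a : ℕ → ℕ
  a k = proj₁ (best k)

  -- The normalised maxima a k / 4^k are bounded, so they cannot grow by 1/2 at every step.
  slow : ∃[ k ] ¬ Attains (suc k) (4 * a k + 2 * (2 ^ k * 2 ^ k))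
  slow with em {∃[ k ] ¬ Attains (suc k) (4 * a k + 2 * (2 ^ k * 2 ^ k))}
  ... | yes h = h
  ... | no ¬h = ⊥-elim (1+n≰n (*-cancelʳ-≤ (suc (2 * N)) (2 * N) (q * q) ⦃ q*q≢0 ⦄ (begin
      suc (2 * N) * (q * q)    ≤⟨ growth k ⟩
      2 * a k                  ≤⟨ *-monoʳ-≤ 2 (Attains-bound {k} (proj₁ (proj₂ (best k)))) ⟩
      2 * (q * (q * N))        ≡⟨ lemma q N ⟩
      2 * N * (q * q)          ∎)))
    where
    open ≤-Reasoning
    -- The first `k` at which the lower bound `k * (q * q)` from `growth` exceeds the upper bound
    -- `2 * N * (q * q)` for `2 * a k`.
    k = suc (2 * N)
    q = 2 ^ k
    q*q≢0 : NonZero (q * q)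
    q*q≢0 = m*n≢0 q q ⦃ m^n≢0 2 k ⦄ ⦃ m^n≢0 2 k ⦄
    lemma : ∀ q N → 2 * (q * (q * N)) ≡ 2 * N * (q * q)
    lemma = solve-∀
    step : ∀ k → 4 * a k + 2 * (2 ^ k * 2 ^ k) ≤ a (suc k)
    step k = ≮⇒≥ λ lt → ¬h (k , λ { (cs , L , len , Ecs , uL , le) →
      proj₂ (proj₂ (best (suc k))) (cs , L , len , Ecs , uL , ≤-trans lt le) })
    growth : ∀ k → k * (2 ^ k * 2 ^ k) ≤ 2 * a k
    growth zero    = z≤n
    growth (suc k) = begin
      suc k * (2 * 2 ^ k * (2 * 2 ^ k))          ≡⟨ lemma₁ k (2 ^ k) ⟩
      4 * (k * (2 ^ k * 2 ^ k)) + 4 * (2 ^ k * 2 ^ k) ≤⟨ +-monoˡ-≤ _ (*-monoʳ-≤ 4 (growth k)) ⟩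
      4 * (2 * a k) + 4 * (2 ^ k * 2 ^ k)        ≡⟨ lemma₂ (a k) (2 ^ k * 2 ^ k) ⟩
      2 * (4 * a k + 2 * (2 ^ k * 2 ^ k))        ≤⟨ *-monoʳ-≤ 2 (step k) ⟩
      2 * a (suc k)                              ∎
      where
      lemma₁ : ∀ k q → suc k * (2 * q * (2 * q)) ≡ 4 * (k * (q * q)) + 4 * (q * q)
      lemma₁ = solve-∀
      lemma₂ : ∀ a q → 4 * (2 * a) + 4 * q ≡ 2 * (4 * a + 2 * q)
      lemma₂ = solve-∀

  insert : ∀ (x : Y) {L} → Unique L → ∃[ L′ ] Unique L′ × x ∈ L′ × (∀ {z} → z ∈ L → z ∈ L′)
  insert x {L} u with em {x ∈ L}
  ... | yes x∈ = L , u , x∈ , id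
  ... | no  x∉ = x ∷ L , Allₚ.¬Any⇒All¬ L x∉ ∷ u , here refl , there

  merge : ∀ (K : List Y) {L} → Unique L → ∃[ L′ ] Unique L′ × All (_∈ L′) K × (∀ {z} → z ∈ L → z ∈ L′)
  merge []      {L} u = L , u , [] , id
  merge (x ∷ K) u with merge K u
  ... | L₁ , u₁ , K⊆ , L⊆ with insert x u₁
  ... | L₂ , u₂ , x∈ , L₁⊆ = L₂ , u₂ , x∈ ∷ All.map L₁⊆ K⊆ , L₁⊆ ∘ L⊆

  Unanimous : Y → List A → Set ℓ
  Unanimous y cs = ∀ {c d} → c ∈ cs → d ∈ cs → c ~[ y ] d

  D-unanimous : ∀ {y cs} → Unanimous y cs → D y cs cs ≡ 0
  D-unanimous {y} {cs} h = n≤0⇒n≡0 (≤-trans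
    (σ-≤ (All.tabulate λ c∈ → σ-≤ (All.tabulate λ d∈ → ≤-reflexive (δ-~ (h c∈ d∈)))))
    (≤-reflexive (trans (cong (length cs *_) (*-zeroʳ (length cs))) (*-zeroʳ (length cs)))))

  module _ (k : ℕ) (is-slow : ¬ Attains (suc k) (4 * a k + 2 * (2 ^ k * 2 ^ k))) where

    Optimal : List A → List Y → Set ℓ
    Optimal cs L = length cs ≡ 2 ^ k × All E cs × Unique L × a k ≤ energy L cs

    -- If two optimal lists were unanimous at y with different verdicts, their
    -- concatenation would have too large an energy.
    optimal-agree : ∀ {cs ds L L′ y} → Optimal cs L → Optimal ds L′ →
      Unanimous y cs → Unanimous y ds → ∀ {c d} → c ∈ cs → d ∈ ds → c ~[ y ] d
    optimal-agree {cs} {ds} {L} {L′} {y} (lc , Ec , uL , ec) (ld , Ed , uL′ , ed) uc ud {c} {d} c∈ d∈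
      with em {c ~[ y ] d}
    ... | yes h = h
    ... | no ¬h with merge L uL′
    ... | L₁ , u₁ , L⊆₁ , L′⊆₁ with insert y u₁
    ... | L₂ , u₂ , y∈ , L₁⊆ with extract y∈
    ... | L₃ , p = ⊥-elim (is-slow (cs ++ ds , L₂ , len , Allₚ.++⁺ Ec Ed , u₂ , (begin
        4 * a k + 2 * (2 ^ k * 2 ^ k)
          ≡⟨ lemma₁ (a k) (2 ^ k * 2 ^ k) ⟩
        2 * (2 ^ k * 2 ^ k) + 2 * (a k + a k)
          ≤⟨ +-mono-≤ at-y (*-monoʳ-≤ 2 (+-mono-≤ (off-y lc uL ec uc (All.map L₁⊆ L⊆₁))
                                                   (off-y ld uL′ ed ud (All.tabulate (L₁⊆ ∘ L′⊆₁))))) ⟩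
        D y (cs ++ ds) (cs ++ ds) + 2 * (energy L₃ cs + energy L₃ ds)
          ≤⟨ +-monoʳ-≤ (D y (cs ++ ds) (cs ++ ds)) rest ⟩
        energy (y ∷ L₃) (cs ++ ds)
          ≡⟨ σ-↭ _ p ⟨
        energy L₂ (cs ++ ds) ∎)))
      where
      open ≤-Reasoning
      lemma₁ : ∀ a q → 4 * a + 2 * q ≡ 2 * q + 2 * (a + a)
      lemma₁ = solve-∀
      len : length (cs ++ ds) ≡ 2 ^ suc k
      len = trans (length-++ cs) (trans (cong₂ _+_ lc ld) (cong (2 ^ k +_) (sym (+-identityʳ _))))
      -- Unanimity spreads the inequivalence of `c` and `d` to all mixed pairs, so both mixed blocks
      -- count in full.
      at-y : 2 * (2 ^ k * 2 ^ k) ≤ D y (cs ++ ds) (cs ++ ds)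
      at-y = begin
        2 * (2 ^ k * 2 ^ k)                 ≡⟨ cong₂ (λ u v → 2 * (u * v)) (sym lc) (sym ld) ⟩
        2 * (length cs * length ds)
          ≤⟨ *-monoʳ-≤ 2 (D≡ y λ c′∈ d′∈ h′ → ¬h (~-trans (uc c∈ c′∈) (~-trans h′ (ud d′∈ d∈)))) ⟩
        2 * D y cs ds                       ≤⟨ m≤n+m _ (D y cs cs + D y ds ds) ⟩
        (D y cs cs + D y ds ds) + 2 * D y cs ds ≡⟨ sym (D-++ y cs ds) ⟩
        D y (cs ++ ds) (cs ++ ds)           ∎
      -- A unanimous list has no disagreement at `y`, so its energy survives the removal of that
      -- point.
      off-y : ∀ {es K} → length es ≡ 2 ^ k → Unique K → a k ≤ energy K es → Unanimous y es →
        All (_∈ L₂) K → a k ≤ energy L₃ es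
      off-y {es} {K} _ uK eK ue K⊆ = begin
        a k                       ≤⟨ eK ⟩
        energy K es               ≤⟨ σ-⊆ _ uK K⊆ ⟩
        energy L₂ es              ≡⟨ σ-↭ _ p ⟩
        D y es es + energy L₃ es  ≡⟨ cong (_+ energy L₃ es) (D-unanimous ue) ⟩
        energy L₃ es              ∎
      -- By negative type, the mixed pairs contribute at every point at least as much as the two
      -- lists do separately. Together with `off-y` this accounts for `4 * a k`.
      rest : 2 * (energy L₃ cs + energy L₃ ds) ≤ energy L₃ (cs ++ ds)
      rest = begin
        2 * (energy L₃ cs + energy L₃ ds)            ≡⟨ cong (2 *_) (sym (σ-+ _ _ L₃)) ⟩
        2 * σ (λ z → D z cs cs + D z ds ds) L₃       ≡⟨ sym (σ-* 2 _ L₃) ⟩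
        σ (λ z → 2 * (D z cs cs + D z ds ds)) L₃     ≤⟨ σ-mono L₃ pointwise ⟩
        energy L₃ (cs ++ ds)                         ∎
        where
        pointwise : ∀ z → 2 * (D z cs cs + D z ds ds) ≤ D z (cs ++ ds) (cs ++ ds)
        pointwise z = begin
          2 * (D z cs cs + D z ds ds)
            ≡⟨ cong ((D z cs cs + D z ds ds) +_) (+-identityʳ _) ⟩
          (D z cs cs + D z ds ds) + (D z cs cs + D z ds ds)
            ≤⟨ +-monoʳ-≤ (D z cs cs + D z ds ds) (D-negative z (2 ^ k) cs ds lc ld) ⟩
          (D z cs cs + D z ds ds) + 2 * D z cs ds
            ≡⟨ sym (D-++ z cs ds) ⟩
          D z (cs ++ ds) (cs ++ ds) ∎

  -- A finite pattern of disagreements whose realisations are the optimal lists.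
  record Pattern : Set ℓ where
    field
      m r     : ℕ
      i₀      : Fin m
      conflict : Fin r → Fin m → Fin m → ℕ

    Realises : (Fin m → A) → (Fin r → Y) → Set ℓ
    Realises c y = (∀ i → E (c i)) × (∀ s s′ → y s ≡ y s′ → s ≡ s′) ×
      (∀ s i j → conflict s i j ≡ 1 → ¬ c i ~[ y s ] c j)

    field
      realised : ∃[ c ] ∃[ y ] Realises c y
      agree    : ∀ {c y c′ y′ z} → Realises c y → Realises c′ y′ →
        (∀ i j → c i ~[ z ] c j) → (∀ i j → c′ i ~[ z ] c′ j) → ∀ i j → c i ~[ z ] c′ j

  -- The pattern records the disagreements of one optimal list `cs` at the points of `L`. A
  -- realisation disagrees at least as often, so it is optimal too, and `optimal-agree` compares any
  -- two of them.
  pattern-exists : Pattern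
  pattern-exists with slow
  ... | k , is-slow with proj₁ (proj₂ (best k))
  ... | cs , L , len , Ecs , uL , le = record
    { m = length cs ; r = length L ; i₀ = subst Fin (sym len) (first (2 ^ k) ⦃ m^n≢0 2 k ⦄)
    ; conflict = λ s i j → δ (List.lookup L s) (List.lookup cs i) (List.lookup cs j)
    ; realised = List.lookup cs , List.lookup L , All.lookup Ecs ∘ ∈ₚ.∈-lookup , lookup-injective uL , λ s i j → lemma s i j
    ; agree = λ { {c} {y} {c′} {y′} R R′ un un′ i j →
        optimal-agree k is-slow (optimal R) (optimal R′) (unanimous un) (unanimous un′)
          (∈ₚ.∈-tabulate⁺ i) (∈ₚ.∈-tabulate⁺ j) } }
    where
    lookup-injective : ∀ {L : List Y} → Unique L → ∀ s s′ → List.lookup L s ≡ List.lookup L s′ → s ≡ s′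
    lookup-injective (_ ∷ u)  zero    zero     e = refl
    lookup-injective (y∉ ∷ u) zero    (suc s′) e = ⊥-elim (All.lookup y∉ (∈ₚ.∈-lookup s′) e)
    lookup-injective (y∉ ∷ u) (suc s) zero     e = ⊥-elim (All.lookup y∉ (∈ₚ.∈-lookup s) (sym e))
    lookup-injective (_ ∷ u)  (suc s) (suc s′) e = cong suc (lookup-injective u s s′ e)
    first : ∀ n → ⦃ NonZero n ⦄ → Fin n
    first (suc n) = zero
    lemma : ∀ s i j → δ (List.lookup L s) (List.lookup cs i) (List.lookup cs j) ≡ 1 →
      ¬ List.lookup cs i ~[ List.lookup L s ] List.lookup cs j
    lemma s i j e h = 0≢1+n (trans (sym (δ-~ h)) e)
    optimal : ∀ {c y} →
      (∀ i → E (c i)) × (∀ s s′ → y s ≡ y s′ → s ≡ s′) ×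
      (∀ s i j → δ (List.lookup L s) (List.lookup cs i) (List.lookup cs j) ≡ 1 → ¬ c i ~[ y s ] c j) →
      Optimal k is-slow (List.tabulate c) (List.tabulate y)
    optimal {c} {y} (Ec , inj , dis) =
      trans (length-tabulate c) len , Allₚ.tabulate⁺ Ec , Uniqueₚ.tabulate⁺ (λ {s} {s′} → inj s s′) ,
      ≤-trans le (σ-tabulate L y λ s → σ-tabulate cs c λ i → σ-tabulate cs c λ j → pointwise s i j)
      where
      pointwise : ∀ s i j → δ (List.lookup L s) (List.lookup cs i) (List.lookup cs j) ≤ δ (y s) (c i) (c j)
      pointwise s i j with δ-01 (List.lookup L s) (List.lookup cs i) (List.lookup cs j)
      ... | inj₁ e       = ≤-trans (≤-reflexive e) z≤n
      ... | inj₂ (e , _) = ≤-reflexive (trans e (sym (δ-≁ (dis s i j e))))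
    unanimous : ∀ {n z} {c : Fin n → A} → (∀ i j → c i ~[ z ] c j) → Unanimous z (List.tabulate c)
    unanimous h c∈ d∈ with ∈ₚ.∈-tabulate⁻ c∈ | ∈ₚ.∈-tabulate⁻ d∈
    ... | i , refl | j , refl = h i j

-- Compactness from saturation.

module Compactness {ℓ : Level} (em : ExcludedMiddle ℓ) {L : Language ℓ} (𝓜 : Syntax.Structure L) where
  open Syntax L
  open Structure 𝓜
  open Semantics 𝓜
  open Definability 𝓜

  ran : ∀ {Π} → Tuple Π → Params
  ran {Π} u (s , x) = ∃[ i ] x ≡ lookup {xs = Π} u {s} i

  opaque
    -- A parameter is coded by its position in `u`, and a position by the length of a context of
    -- home variables.
    ran-small : ∀ {Π} (u : Tuple Π) → Small (ran u)
    ran-small {Π} u = (λ x → code (em {ran u x})) , λ {x} {y} → inj {x} {y} em em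
      where
      pos : ∀ {Π : Context} {s} → s ∈ Π → ℕ
      pos (here _)  = zero
      pos (there i) = suc (pos i)
      pos-injective : ∀ {Π s s′} (u : Tuple Π) (i : s ∈ Π) (j : s′ ∈ Π) → pos i ≡ pos j →
        _≡_ {A = Element} (s , lookup u i) (s′ , lookup u j)
      pos-injective (x ∷ u) (here refl) (here refl) e = refl
      pos-injective (x ∷ u) (there i)   (there j)   e = pos-injective u i j (suc-injective e)
      formula : ℕ → LFormula
      formula n = replicate n home , ⊥′
      code : ∀ {x} → Dec (ran u x) → LFormula
      code (yes (i , _)) = formula (pos i)
      code (no _)        = formula 0
      inj : ∀ {x y} (p : Dec (ran u x)) (q : Dec (ran u y)) → ran u x → ran u y → code p ≡ code q → x ≡ y
      inj (no ¬p) _       p q e = ⊥-elim (¬p p)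
      inj (yes _) (no ¬q) p q e = ⊥-elim (¬q q)
      inj (yes (i , refl)) (yes (j , refl)) p q e = pos-injective u i j
        (trans (sym (length-replicate (pos i))) (trans (cong (length ∘ proj₁) e) (length-replicate (pos j))))

  module _ (sat : Saturated) {C : Params} (small : Small C) {Γ : Context} {I : Set ℓ}
    (P : I → Tuple Γ → Set ℓ) (d : ∀ i → DefinableOver C (P i)) where

    opaque
      -- The defining formulas of the `P i` form a type over `C`, and each finite part of it
      -- involves finitely many indices.
      compactness : (∀ is → ∃[ t ] ∀ {i} → i ∈ is → P i t) → ∃[ t ] ∀ i → P i t
      compactness fin-sat with sat C small Γ q locally
        where
        q : Pred (FormulaOver C Γ) ℓ
        q ψ = ∃[ i ] ψ ≡ proj₁ (d i)
        indices : ∀ {ψs} → All q ψs → List I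
        indices []             = []
        indices ((i , _) ∷ qs) = i ∷ indices qs
        solve : ∀ {ψs t} (qs : All q ψs) → (∀ {i} → i ∈ indices qs → P i t) → All (λ ψ → solutions ψ t) ψs
        solve []                h = []
        solve ((i , refl) ∷ qs) h = to (proj₂ (d i) _) (h (here refl)) ∷ solve qs (h ∘ there)
        locally : ∀ ψs → All q ψs → ∃[ t ] All (λ ψ → solutions ψ t) ψs
        locally ψs qs = let t , h = fin-sat (indices qs) in t , solve qs h
      ... | t , h = t , λ i → from (proj₂ (d i) t) (h _ (i , refl))

-- Balls, neighbourhoods and interior in `M`.

module Topology {ℓ : Level} (em : ExcludedMiddle ℓ) {L : Language ℓ} (𝓜 : Syntax.Structure L)
  (sat : Semantics.Saturated 𝓜) (dp-minimal : Semantics.DpMinimal 𝓜)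
  (𝓑 : Semantics.DefinableUniformity 𝓜)
  (no-isolated : Semantics.DefinableUniformity.NoIsolatedPoints 𝓑)
  (infinite-interior : Semantics.DefinableUniformity.InfiniteDefinableHasInterior 𝓑) where
  open Syntax L
  open Structure 𝓜
  open Semantics 𝓜
  open Definability 𝓜
  open Compactness em 𝓜
  open DefinableUniformity 𝓑
  open Classical em
  open Counting em

  private variable
    C : Params
    Γ Θ : Context

  Π : Context
  Π = FormulaOver.Δ (proj₁ D-definable)

  -- D is 𝒟 c₀; the parameters are allowed to vary.
  c₀ : Tuple Π
  c₀ = FormulaOver.params (proj₁ D-definable)

  𝒟 : Tuple Π → Tuple Δ → Set ℓ
  𝒟 c V = ⟦ FormulaOver.formula (proj₁ D-definable) ⟧ (++⁺ V c)

  D⇒𝒟 : ∀ {V} → D V → 𝒟 c₀ V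
  D⇒𝒟 = to (proj₂ D-definable _)

  𝒟⇒D : ∀ {V} → 𝒟 c₀ V → D V
  𝒟⇒D = from (proj₂ D-definable _)

  opaque
    def-𝒟 : Def₂ C 𝒟
    def-𝒟 c V = def-⟦ FormulaOver.formula (proj₁ D-definable) ⟧ (V ++ᵐ c)

    def-ball : ∀ {V : Tuple Γ → Tuple Δ} {x y} → IsMap C Γ Δ V → IsPt C Γ home x → IsPt C Γ home y →
      DefinableOver C (λ t → ⟪ V t ⟫ (x t) (y t))
    def-ball V x y = def-⟦ φ ⟧ (x ∷ᵐ y ∷ᵐ V)

    def-AtLeast : ∀ n {Y : Tuple Γ → M → Set ℓ} →
      DefinableOver C {home ∷ Γ} (λ t → Y (tl t) (hd t)) → DefinableOver C (λ t → AtLeast n (Y t))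
    def-AtLeast zero    d = def-true λ _ → tt
    def-AtLeast (suc n) d = def-∃ (def-× d (def-AtLeast n
      (def-× (def-pre d (v₀ ∷ᵐ wkᵐ (tlᵐ idᵐ))) (def-¬ (def-≡ v₀ (wkᵖ v₀))))))

  Nbhd : Tuple Π → M → Pred M ℓ → Set ℓ
  Nbhd c x Y = ∃[ V ] 𝒟 c V × ∀ y → ⟪ V ⟫ x y → Y y

  opaque
    Nbhd-mono : ∀ {c x Y Z} → Y ⊆ₚ Z → Nbhd c x Y → Nbhd c x Z
    Nbhd-mono Y⊆Z (V , d , h) = V , d , λ y b → Y⊆Z (h y b)

    def-Nbhd : ∀ {c : Tuple Γ → Tuple Π} {x} {Y : Tuple Γ → M → Set ℓ} →
      IsMap C Γ Π c → IsPt C Γ home x → DefinableOver C {home ∷ Γ} (λ t → Y (tl t) (hd t)) →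
      DefinableOver C (λ t → Nbhd (c t) (x t) (Y t))
    def-Nbhd c x d = def-∃* Δ (def-× (def-𝒟 (wk*ᵐ Δ c) (fst* Δ))
      (def-∀ (def-→ (def-ball (wkᵐ (fst* Δ)) (wkᵖ (wk*ᵖ Δ x)) v₀)
                    (def-pre d (v₀ ∷ᵐ wkᵐ (wk*ᵐ Δ idᵐ))))))

    ball-refl : ∀ {V} → 𝒟 c₀ V → ∀ x → ⟪ V ⟫ x x
    ball-refl V∈ x = from (diagonal x x) refl _ (𝒟⇒D V∈)

    -- Positive dp-rank gives infinitely many `b`, each selected by some `x`. As every `x` selects
    -- at most one `b`, a finite `M` would leave only finitely many.
    M-infinite : Infinite {A = M} (λ _ → ⊤ {ℓ})
    M-infinite (xs , cov) with proj₁ (proj₂ dp-minimal) 0 (s≤s z≤n)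
    ... | Δ′ , φ′ , B , B-infinite , pattern-at = B-infinite zero (Bs xs , λ b∈ → mem b∈)
      where
      Selects : M → Tuple (Δ′ zero) → Set ℓ
      Selects x b = B zero b × ∀ y → B zero y → solutions (φ′ zero) (++⁺ (x ∷ []) y) ⇔ y ≡ b
      Bs : List M → List (Tuple (Δ′ zero))
      Bs []       = []
      Bs (x ∷ xs) with em {∃ (Selects x)}
      ... | yes (b , _) = b ∷ Bs xs
      ... | no _        = Bs xs
      selected : ∀ {x b xs} → x ∈ xs → Selects x b → b ∈ Bs xs
      selected {x} {b} (here {xs = xs} refl) (b∈ , h) with em {∃ (Selects x)}
      ... | yes (b′ , _ , h′) = here (to (h′ b b∈) (from (h b b∈) refl))
      ... | no ¬s             = ⊥-elim (¬s (b , b∈ , h))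
      selected {xs = x′ ∷ xs} (there x∈) s with em {∃ (Selects x′)}
      ... | yes _ = there (selected x∈ s)
      ... | no _  = selected x∈ s
      mem : ∀ {b} → B zero b → b ∈ Bs xs
      mem {b} b∈ with pattern-at (λ { zero → b }) (λ { zero → b∈ })
      ... | x ∷ [] , _ , h = selected (cov tt) (b∈ , h zero)

    -- The infinite definable set `M` has interior, and openness at a point of it supplies an
    -- entourage.
    𝒟-nonempty : ∃[ V ] 𝒟 c₀ V
    𝒟-nonempty with infinite-interior (λ _ → ⊤) (def-true λ _ → tt) M-infinite
    ... | O , O-open , (x , x∈O) , _ = Prod.map₂ (D⇒𝒟 ∘ proj₁) (O-open x∈O)

    separate : ∀ x (ys : List M) → ∃[ W ] 𝒟 c₀ W × ∀ {y} → y ∈ ys → ⟪ W ⟫ x y → y ≡ x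
    separate x []       = Prod.map₂ (λ d → d , λ ()) 𝒟-nonempty
    separate x (y ∷ ys) with separate x ys | em {x ≡ y}
    ... | W , dW , h | yes x≡y = W , dW , λ { (here refl) _ → sym x≡y ; (there y∈) → h y∈ }
    ... | W , dW , h | no  x≢y with dne {P = ∃[ c ] D c × ¬ ⟪ c ⟫ x y}
        (λ ¬e → x≢y (to (diagonal x y) λ c dc → dne λ ¬b → ¬e (c , dc , ¬b)))
    ... | c , dc , ¬b with directed W c (𝒟⇒D dW) dc
    ... | V , dV , V⊆ = V , D⇒𝒟 dV , λ
      { (here refl) b → ⊥-elim (¬b (proj₂ (V⊆ b)))
      ; (there y∈)  b → h y∈ (proj₁ (V⊆ b)) }

    -- Otherwise an entourage separating `x` from the finitely many points of its ball would make
    -- `x` isolated.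
    ball-infinite : ∀ {V} → 𝒟 c₀ V → ∀ x → Infinite (⟪ V ⟫ x)
    ball-infinite {V} dV x (ys , cov) with separate x ys
    ... | W , dW , h with directed V W (𝒟⇒D dV) (𝒟⇒D dW)
    ... | V′ , dV′ , V′⊆ = no-isolated x λ { refl → V′ , dV′ , λ b → sym (h (cov (proj₁ (V′⊆ b))) (proj₂ (V′⊆ b))) }

  Interior : Pred M ℓ → Set ℓ
  Interior Y = ∃[ x ] Nbhd c₀ x Y

  opaque
    infinite⇒interior : ∀ {Y} → Definable {Γ = [ home ]} (λ t → Y (hd t)) → Infinite Y → Interior Y
    infinite⇒interior {Y} d inf with infinite-interior Y (def-⇔ (λ { (x ∷ []) → mk⇔ id id }) d) inf
    ... | O , O-open , (x , x∈O) , O⊆Y with O-open x∈O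
    ... | V , dV , h = x , V , D⇒𝒟 dV , λ y b → O⊆Y (h b)

    interior⇒infinite : ∀ {Y} → Interior Y → Infinite Y
    interior⇒infinite (x , V , dV , h) fin = ball-infinite dV x (Finite-⊆ (λ {y} → h y) fin)

    -- If this definable set were infinite, it would have an interior point. A ball around that
    -- point would lie in `Y`, although the point is not interior to `Y`.
    exterior-finite : ∀ {Y} → Definable {Γ = [ home ]} (λ t → Y (hd t)) → Finite (λ y → Y y × ¬ Nbhd c₀ y Y)
    exterior-finite {Y} d = dne λ inf → contra (infinite⇒interior
        (def-× d (def-¬ (def-Nbhd paramᵐ v₀ (def-pre d (v₀ ∷ᵐ []ᵐ))))) inf)
      where
      contra : ¬ Interior (λ y → Y y × ¬ Nbhd c₀ y Y)
      contra (x , V , dV , h) = proj₂ (h x (ball-refl dV x)) (V , dV , λ y b → proj₁ (h y b))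

    -- If no bound existed, compactness over the parameters of the family and `c₀` would give an
    -- infinite definable fibre without interior. Hence having interior is the same, in a definable
    -- family, as having at least `n` elements for one fixed `n`.
    uniform-bound : (Y : Tuple Θ → M → Set ℓ) → DefFam U Y → ∃[ n ] ∀ θ → AtLeast n (Y θ) → Interior (Y θ)
    uniform-bound {Θ} Y d = dne λ ¬bound → contra (compactness sat (ran-small u) P (over-u ∘ lower)
        λ is → locally (proj₁ (bound-of is)) (proj₂ (bound-of is)) ¬bound)
      where
      lower : Lift ℓ ℕ → ℕ
      lower (lift n) = n
      ψ : Definable {Γ = home ∷ Θ} (λ t → Y (tl t) (hd t))
      ψ = d (wkᵐ idᵐ) v₀
      u : Tuple (FormulaOver.Δ (proj₁ ψ) ++ Π)
      u = ++⁺ (FormulaOver.params (proj₁ ψ)) c₀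
      P : Lift ℓ ℕ → Tuple Θ → Set ℓ
      P (lift n) θ = AtLeast n (Y θ) × ¬ Interior (Y θ)
      Y-over-u : DefinableOver (ran u) {home ∷ Θ} (λ t → Y (tl t) (hd t))
      Y-over-u = def-mono {C = ran (FormulaOver.params (proj₁ ψ))}
        (λ { (i , refl) → ∈-++⁺ˡ i , sym (lookup-++⁺ˡ (FormulaOver.params (proj₁ ψ)) i) })
        (record { FormulaOver (proj₁ ψ) ; over = λ i → i , refl } , proj₂ ψ)
      c₀-over-u : ∀ {Γ} → IsMap (ran u) Γ Π (λ _ → c₀)
      c₀-over-u = constᵐ c₀ λ i → ∈-++⁺ʳ _ i , sym (lookup-++⁺ʳ (FormulaOver.params (proj₁ ψ)) i)
      over-u : ∀ n → DefinableOver (ran u) (P (lift n))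
      over-u n = def-× (def-AtLeast n Y-over-u)
        (def-¬ (def-∃ (def-Nbhd c₀-over-u v₀ (def-pre Y-over-u (v₀ ∷ᵐ wkᵐ (wkᵐ idᵐ))))))
      bound-of : ∀ is → ∃[ n ] ∀ {i} → i ∈ is → lower i ≤ n
      bound-of []            = 0 , λ ()
      bound-of (lift n ∷ is) with bound-of is
      ... | m , h = n ⊔ m , λ { (here refl) → m≤m⊔n n m ; (there i∈) → ≤-trans (h i∈) (m≤n⊔m n m) }
      locally : ∀ n {is} → (∀ {i} → i ∈ is → lower i ≤ n) →
        ¬ (∃[ n ] ∀ θ → AtLeast n (Y θ) → Interior (Y θ)) → ∃[ θ ] ∀ {i} → i ∈ is → P i θ
      locally n ≤n ¬bound with dne {P = ∃[ θ ] AtLeast n (Y θ) × ¬ Interior (Y θ)}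
          (λ ¬e → ¬bound (n , λ θ h → dne λ ¬i → ¬e (θ , h , ¬i)))
      ... | θ , h , ¬i = θ , λ i∈ → AtLeast-≤ (≤n i∈) h , ¬i
      contra : ¬ (∃[ θ ] ∀ i → P i θ)
      contra (θ , h) = proj₂ (h (lift 0)) (infinite⇒interior (d paramᵐ v₀)
        λ fin → proj₂ (Finite⇒¬AtLeast fin) (proj₁ (h (lift (proj₁ (Finite⇒¬AtLeast fin))))))

  -- Boxes and sets with interior in `M^ m`.

  -- A box is coded by the tuple of its centres and radii.
  BoxCtx : ℕ → Context
  BoxCtx zero    = []
  BoxCtx (suc m) = home ∷ Δ ++ BoxCtx m

  Valid : ∀ m → Tuple (BoxCtx m) → Set ℓ
  Valid zero    β = ⊤
  Valid (suc m) β = 𝒟 c₀ (++⁻ˡ Δ (tl β)) × Valid m (++⁻ʳ Δ (tl β))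

  InBox : ∀ m → Tuple (BoxCtx m) → M^ m → Set ℓ
  InBox zero    β v = ⊤
  InBox (suc m) β v = ⟪ ++⁻ˡ Δ (tl β) ⟫ (hd β) (hd v) × InBox m (++⁻ʳ Δ (tl β)) (tl v)

  opaque
    def-InBox : ∀ m → Def₂ C (InBox m)
    def-InBox zero    β v = def-true λ _ → tt
    def-InBox (suc m) β v = def-× (def-ball (takeᵐ (tlᵐ β)) (hdᵖ β) (hdᵖ v)) (def-InBox m (dropᵐ (tlᵐ β)) (tlᵐ v))

    def-Valid : ∀ m → Def₁ U (Valid m)
    def-Valid zero    β = def-true λ _ → tt
    def-Valid (suc m) β = def-× (def-𝒟 paramᵐ (takeᵐ (tlᵐ β))) (def-Valid m (dropᵐ (tlᵐ β)))

    box-uncons : ∀ m x V β {y v} → InBox (suc m) (x ∷ ++⁺ V β) (y ∷ v) → ⟪ V ⟫ x y × InBox m β v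
    box-uncons m x V β {y} {v} = subst id (cong₂ (λ V β → ⟪ V ⟫ x y × InBox m β v) (++⁻ˡ∘++⁺ V) (++⁻ʳ∘++⁺ V))

  HasInt : ∀ m → Pred (M^ m) ℓ → Set ℓ
  HasInt m X = ∃[ β ] Valid m β × ∀ v → InBox m β v → X v

  opaque
    def-HasInt : ∀ m {X : Tuple Γ → M^ m → Set ℓ} → Def₂ U X → Definable (λ t → HasInt m (X t))
    def-HasInt m d = def-∃* (BoxCtx m) (def-× (def-Valid m (fst* (BoxCtx m)))
      (def-∀* (replicate m home) (def-→
        (def-InBox m (wk*ᵐ (replicate m home) (fst* (BoxCtx m))) (fst* (replicate m home)))
        (d (wk*ᵐ (replicate m home) (wk*ᵐ (BoxCtx m) idᵐ)) (fst* (replicate m home))))))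

    HasInt-mono : ∀ m {X X′ : Pred (M^ m) ℓ} → X ⊆ₚ X′ → HasInt m X → HasInt m X′
    HasInt-mono m X⊆X′ (β , val , h) = β , val , λ v b → X⊆X′ (h v b)

    HasInt-∷ : ∀ m {X : Pred (M^ suc m) ℓ} β → Valid m β →
      Interior (λ y → ∀ v → InBox m β v → X (y ∷ v)) → HasInt (suc m) X
    HasInt-∷ m β val (x , V , dV , h) = x ∷ ++⁺ V β ,
      (subst (𝒟 c₀) (sym (++⁻ˡ∘++⁺ V)) dV , subst (Valid m) (sym (++⁻ʳ∘++⁺ V)) val) ,
      λ { (y ∷ v) b → let b₁ , b₂ = box-uncons m x V β b in h y b₁ v b₂ }

    HasInt-uncons : ∀ m {X : Pred (M^ suc m) ℓ} → HasInt (suc m) X →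
      ∃[ x ] ∃[ V ] 𝒟 c₀ V × ∃[ β ] Valid m β × ∀ {y v} → ⟪ V ⟫ x y → InBox m β v → X (y ∷ v)
    HasInt-uncons m (x ∷ β , (dV , val) , h) = x , _ , dV , _ , val , λ b₁ b₂ → h _ (b₁ , b₂)

    box-nonempty : ∀ m β → Valid m β → ∃ (InBox m β)
    box-nonempty zero    β val        = [] , tt
    box-nonempty (suc m) (x ∷ β) (dV , val) with box-nonempty m _ val
    ... | v , b = x ∷ v , ball-refl dV x , b

    HasInt⇒∃ : ∀ m {X : Pred (M^ m) ℓ} → HasInt m X → ∃ X
    HasInt⇒∃ m (β , val , h) = Prod.map₂ (h _) (box-nonempty m β val)

  opaque
    directed-all : ∀ {n} (𝒱 : Pred (Tuple Θ) ℓ) → ∃ 𝒱 → {F : Tuple Θ → Fin n → Set ℓ} →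
      (∀ V W → 𝒱 V → 𝒱 W → ∃[ V′ ] 𝒱 V′ × ∀ i → F V i ⊎ F W i → F V′ i) →
      (∀ i → ∃[ V ] 𝒱 V × F V i) → ∃[ V ] 𝒱 V × ∀ i → F V i
    directed-all {n = zero}  𝒱 (V , V∈) dir h = V , V∈ , λ ()
    directed-all {n = suc n} 𝒱 𝒱≠∅ {F} dir h =
      let V , V∈ , all = directed-all 𝒱 𝒱≠∅ {λ V i → F V (suc i)}
            (λ V W V∈ W∈ → let V′ , V′∈ , s = dir V W V∈ W∈ in V′ , V′∈ , s ∘ suc) (h ∘ suc)
          W , W∈ , one = h zero
          V′ , V′∈ , s = dir V W V∈ W∈
      in V′ , V′∈ , λ { zero → s zero (inj₂ one) ; (suc i) → s (suc i) (inj₁ (all i)) }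

  Slab : ∀ m → Pred (M^ suc m) ℓ → Tuple (BoxCtx m) → Pred M ℓ
  Slab m X β y = ∀ v → InBox m β v → X (y ∷ v)

  opaque
    -- Boxes form a definable family as well, so one bound serves all of them: enough points over a
    -- common box yield a box in one dimension more.
    slab-bound : ∀ m (F : Tuple Θ → M^ suc m → Set ℓ) → Def₂ U F →
      ∃[ n ] ∀ V β → AtLeast n (Slab m (F V) β) → Interior (Slab m (F V) β)
    slab-bound {Θ} m F dF = proj₁ bounded , λ V β h →
      subst Interior (eq V β) (proj₂ bounded (++⁺ β V) (subst (AtLeast (proj₁ bounded)) (sym (eq V β)) h))
      where
      Y : Tuple (BoxCtx m ++ Θ) → M → Set ℓ
      Y θ = Slab m (F (++⁻ʳ (BoxCtx m) θ)) (++⁻ˡ (BoxCtx m) θ)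
      eq : ∀ V (β : Tuple (BoxCtx m)) → Y (++⁺ β V) ≡ Slab m (F V) β
      eq V β = cong₂ (λ V β → Slab m (F V) β) (++⁻ʳ∘++⁺ β) (++⁻ˡ∘++⁺ β)
      dY : DefFam U Y
      dY θ y = def-∀* (replicate m home) (def-→
        (def-InBox m (wk*ᵐ (replicate m home) (takeᵐ θ)) (fst* (replicate m home)))
        (dF (wk*ᵐ (replicate m home) (dropᵐ θ)) (wk*ᵖ (replicate m home) y ∷ᵐ fst* (replicate m home))))
      bounded : ∃[ n ] ∀ θ → AtLeast n (Y θ) → Interior (Y θ)
      bounded = uniform-bound Y dY

    All-lookup⁻ : ∀ {P : Pred M ℓ} {ys} → (∀ i → P (List.lookup ys i)) → All P ys
    All-lookup⁻ {ys = []}     h = []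
    All-lookup⁻ {ys = y ∷ ys} h = h zero ∷ All-lookup⁻ (h ∘ suc)

    -- The number `n` from `slab-bound` does not depend on `V`. For `n` points of the first side,
    -- `directed-all` gives one `V` for each `v`, and the induction hypothesis makes this `V`
    -- constant on a smaller box. The slab over that box then has `n` points, hence interior.
    directed-int : ∀ m (𝒱 : Pred (Tuple Θ) ℓ) → ∃ 𝒱 → (F : Tuple Θ → M^ m → Set ℓ) → Def₂ U F →
      (∀ V W → 𝒱 V → 𝒱 W → ∃[ V′ ] 𝒱 V′ × ∀ v → F V v ⊎ F W v → F V′ v) →
      HasInt m (λ v → ∃[ V ] 𝒱 V × F V v) → ∃[ V ] 𝒱 V × HasInt m (F V)
    directed-int zero 𝒱 V∈ F dF dir (β , val , h) =
      let V , V∈ , f = h [] tt in V , V∈ , β , val , λ { [] _ → f }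
    directed-int {Θ} (suc m) 𝒱 𝒱≠∅ F dF dir int =
      let x₀ , V₀ , dV₀ , β₀ , val₀ , h = HasInt-uncons m int
          n , bound = slab-bound m F dF
          ys , len , unique , in-ball = AtLeast⇒Unique n {Y = ⟪ V₀ ⟫ x₀} (Infinite⇒AtLeast n (ball-infinite dV₀ x₀))
          V , V∈ , β , val , f = directed-int m 𝒱 𝒱≠∅ (F′ ys) (λ V v → def-∀Fin λ i → dF V (paramᵖ ∷ᵐ v))
            (λ V W V∈ W∈ → let V′ , V′∈ , s = dir V W V∈ W∈ in
               V′ , V′∈ , λ v f i → s _ (Sum.map (λ g → g i) (λ g → g i) f))
            (β₀ , val₀ , λ v b → directed-all 𝒱 𝒱≠∅
               (λ V W V∈ W∈ → let V′ , V′∈ , s = dir V W V∈ W∈ in V′ , V′∈ , λ i → s _)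
               λ i → h (All.lookup in-ball (∈-lookup i)) b)
      in V , V∈ , HasInt-∷ m β val (bound V β (subst (λ n → AtLeast n (Slab m (F V) β)) len
           (Unique⇒AtLeast {Y = Slab m (F V) β} unique (All-lookup⁻ λ i v b → f v b i))))
      where
      F′ : List M → Tuple Θ → M^ m → Set ℓ
      F′ ys V v = ∀ i → F V (List.lookup ys i ∷ v)

  opaque
    -- Induction on `m`: over each new point of the first side, the induction hypothesis shrinks the
    -- remaining box into the slice of `X` or of `X′`. After at most `n + n′` points one of the two
    -- sets has enough of them for its slab bound.
    HasInt-⊎ : ∀ m {X X′ : Pred (M^ m) ℓ} → Def₁ U X → Def₁ U X′ →
      HasInt m (λ v → X v ⊎ X′ v) → HasInt m X ⊎ HasInt m X′
    HasInt-⊎ zero dX dX′ (β , val , h) =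
      Sum.map (λ x → β , val , λ { [] _ → x }) (λ x → β , val , λ { [] _ → x }) (h [] tt)
    HasInt-⊎ (suc m) {X} {X′} dX dX′ int = start (HasInt-uncons m int)
      (slab-bound {Θ = []} m (λ _ → X) (λ _ → dX)) (slab-bound {Θ = []} m (λ _ → X′) (λ _ → dX′))
      where
      start : (∃[ x ] ∃[ V ] 𝒟 c₀ V × ∃[ β ] Valid m β ×
                 ∀ {y v} → ⟪ V ⟫ x y → InBox m β v → X (y ∷ v) ⊎ X′ (y ∷ v)) →
        (∃[ n ] ∀ (_ : Tuple []) β → AtLeast n (Slab m X β) → Interior (Slab m X β)) →
        (∃[ n ] ∀ (_ : Tuple []) β → AtLeast n (Slab m X′ β) → Interior (Slab m X′ β)) →
        HasInt (suc m) X ⊎ HasInt (suc m) X′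
      start (x₀ , V₀ , dV₀ , β₀ , val₀ , h) (n , bound) (n′ , bound′) =
        loop n n′ β₀ val₀ id [] [] [] [] [] [] refl refl
        where
        fresh : ∀ (ys : List M) → ∃[ y ] ⟪ V₀ ⟫ x₀ y × y ∉ ys
        fresh ys = dne λ ¬e → ball-infinite dV₀ x₀ (ys , λ {y} b → dne λ y∉ → ¬e (y , b , y∉))
        -- The points ys and zs lie in the slabs of X and X′ over the shrinking box β,
        -- a and b being the numbers of points still missing.
        loop : ∀ a b β → Valid m β → (∀ {v} → InBox m β v → InBox m β₀ v) →
          ∀ ys zs → Unique ys → Unique zs → All (Slab m X β) ys → All (Slab m X′ β) zs →
          length ys + a ≡ n → length zs + b ≡ n′ → HasInt (suc m) X ⊎ HasInt (suc m) X′
        loop zero b β val sub ys zs uy uz in-X in-X′ ly lz =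
          inj₁ (HasInt-∷ m β val (bound [] β (subst (λ n → AtLeast n (Slab m X β))
            (trans (sym (+-identityʳ _)) ly) (Unique⇒AtLeast uy in-X))))
        loop (suc a) zero β val sub ys zs uy uz in-X in-X′ ly lz =
          inj₂ (HasInt-∷ m β val (bound′ [] β (subst (λ n → AtLeast n (Slab m X′ β))
            (trans (sym (+-identityʳ _)) lz) (Unique⇒AtLeast uz in-X′))))
        loop (suc a) (suc b) β val sub ys zs uy uz in-X in-X′ ly lz = step (fresh (ys ++ zs))
          where
          step : ∃[ y ] ⟪ V₀ ⟫ x₀ y × y ∉ ys ++ zs → HasInt (suc m) X ⊎ HasInt (suc m) X′
          step (y , y∈ , y∉) = [ left , right ]′
            (HasInt-⊎ m {λ v → InBox m β v × X (y ∷ v)} {λ v → InBox m β v × X′ (y ∷ v)}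
              (λ v → def-× (def-InBox m paramᵐ v) (dX (paramᵖ ∷ᵐ v)))
              (λ v → def-× (def-InBox m paramᵐ v) (dX′ (paramᵖ ∷ᵐ v)))
              (β , val , λ v b → Sum.map (b ,_) (b ,_) (h y∈ (sub b))))
            where
            left : HasInt m (λ v → InBox m β v × X (y ∷ v)) → HasInt (suc m) X ⊎ HasInt (suc m) X′
            left (β′ , val′ , g) = loop a (suc b) β′ val′ (λ b → sub (proj₁ (g _ b))) (y ∷ ys) zs
              (All.map (λ z∈ eq → y∉ (∈-++⁺ˡ (subst (_∈ ys) (sym eq) z∈))) (All.tabulate id) ∷ uy) uz
              ((λ v b → proj₂ (g v b)) ∷ All.map (λ f v b → f v (proj₁ (g v b))) in-X)
              (All.map (λ f v b → f v (proj₁ (g v b))) in-X′)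
              (trans (sym (+-suc (length ys) a)) ly) lz
            right : HasInt m (λ v → InBox m β v × X′ (y ∷ v)) → HasInt (suc m) X ⊎ HasInt (suc m) X′
            right (β′ , val′ , g) = loop (suc a) b β′ val′ (λ b → sub (proj₁ (g _ b))) ys (y ∷ zs)
              uy (All.map (λ z∈ eq → y∉ (∈-++⁺ʳ ys (subst (_∈ zs) (sym eq) z∈))) (All.tabulate id) ∷ uz)
              (All.map (λ f v b → f v (proj₁ (g v b))) in-X)
              ((λ v b → proj₂ (g v b)) ∷ All.map (λ f v b → f v (proj₁ (g v b))) in-X′)
              ly (trans (sym (+-suc (length zs) b)) lz)

    HasInt-⋃ : ∀ m {r} {X : Fin r → Pred (M^ m) ℓ} → (∀ i → Def₁ U (X i)) →
      HasInt m (λ v → ∃[ i ] X i v) → ∃[ i ] HasInt m (X i)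
    HasInt-⋃ m {zero} dX int with HasInt⇒∃ m int
    ... | v , () , _
    HasInt-⋃ m {suc r} {X} dX int = [ zero ,_ , Prod.map suc id ∘ HasInt-⋃ m (dX ∘ suc) ]′
      (HasInt-⊎ m (dX zero) (λ v → def-∃Fin λ i → dX (suc i) v)
        (HasInt-mono m (λ { (zero , x) → inj₁ x ; (suc i , x) → inj₂ (i , x) }) int))

  -- Comparison of the germs of the uniformities `𝒟 c`.

  Far : Tuple Π → Tuple Δ → Pred M ℓ
  Far d V x = ¬ Nbhd d x (⟪ V ⟫ x)

  Boundary : Tuple Π → Tuple Δ → M → Pred M ℓ
  Boundary c W x y = ⟪ W ⟫ x y × ¬ Nbhd c y (⟪ W ⟫ x)

  opaque
    def-Far : ∀ {d : Tuple Γ → Tuple Π} {V x} → IsMap C Γ Π d → IsMap C Γ Δ V → IsPt C Γ home x →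
      DefinableOver C (λ t → Far (d t) (V t) (x t))
    def-Far d V x = def-¬ (def-Nbhd d x (def-ball (wkᵐ V) (wkᵖ x) v₀))

    def-Boundary : ∀ {c : Tuple Γ → Tuple Π} {W x y} →
      IsMap C Γ Π c → IsMap C Γ Δ W → IsPt C Γ home x → IsPt C Γ home y →
      DefinableOver C (λ t → Boundary (c t) (W t) (x t) (y t))
    def-Boundary c W x y = def-× (def-ball W x y) (def-¬ (def-Nbhd c y (def-ball (wkᵐ W) (wkᵖ x) v₀)))

    ball-bound : ∃[ n ] ∀ θ → AtLeast n (⟪ tl θ ⟫ (hd θ)) → Interior (⟪ tl θ ⟫ (hd θ))
    ball-bound = uniform-bound {Θ = home ∷ Δ} (λ θ → ⟪ tl θ ⟫ (hd θ)) λ θ y → def-ball (tlᵐ θ) (hdᵖ θ) y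

    Far-bound : ∃[ n ] ∀ θ → AtLeast n (Far (++⁻ʳ Δ θ) (++⁻ˡ Δ θ)) → Interior (Far (++⁻ʳ Δ θ) (++⁻ˡ Δ θ))
    Far-bound = uniform-bound {Θ = Δ ++ Π} (λ θ → Far (++⁻ʳ Δ θ) (++⁻ˡ Δ θ)) λ θ y → def-Far (dropᵐ θ) (takeᵐ θ) y

    Boundary-bound : ∃[ n ] ∀ θ → AtLeast n (Boundary c₀ (tl θ) (hd θ)) → Interior (Boundary c₀ (tl θ) (hd θ))
    Boundary-bound = uniform-bound {Θ = home ∷ Δ} (λ θ → Boundary c₀ (tl θ) (hd θ))
      λ θ y → def-Boundary paramᵐ (tlᵐ θ) (hdᵖ θ) y

  -- The first-order properties of c₀ over ∅ that are needed of the uniformity 𝒟 c.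
  Reflexive Symmetric Directed Halving Large Open-test Boundary-test : Tuple Π → Set ℓ
  Reflexive c     = ∀ V → 𝒟 c V → ∀ x → ⟪ V ⟫ x x
  Symmetric c     = ∀ V → 𝒟 c V → ∀ x y → ⟪ V ⟫ x y → ⟪ V ⟫ y x
  Directed c      = ∀ V W → 𝒟 c V → 𝒟 c W → ∃[ V′ ] 𝒟 c V′ × ∀ x y → ⟪ V′ ⟫ x y → ⟪ V ⟫ x y × ⟪ W ⟫ x y
  Halving c       = ∀ V → 𝒟 c V → ∃[ W ] 𝒟 c W × ∀ x y z → ⟪ W ⟫ x y → ⟪ W ⟫ y z → ⟪ V ⟫ x z
  Large c         = ∀ V → 𝒟 c V → ∀ x → AtLeast (proj₁ ball-bound) (⟪ V ⟫ x)
  Open-test c     = ∀ d V → AtLeast (proj₁ Far-bound) (Far d V) → ∃[ x ] Nbhd c x (Far d V)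
  Boundary-test c = ∀ W x → ¬ AtLeast (proj₁ Boundary-bound) (Boundary c W x)

  -- Infinity and interior enter only through the numbers supplied by `uniform-bound`, which makes
  -- `Good` first-order without parameters.
  record Good (c : Tuple Π) : Set ℓ where
    constructor good
    field
      refl-c  : Reflexive c
      sym-c   : Symmetric c
      dir-c   : Directed c
      half-c  : Halving c
      large-c : Large c
      open-c  : Open-test c
      bdry-c  : Boundary-test c

  open Good

  -- 𝒟 c and 𝒟 d have the same germ at y.
  record _~[_]_ (c : Tuple Π) (y : M) (d : Tuple Π) : Set ℓ where
    constructor germs
    field
      coarser : ∀ V → 𝒟 c V → Nbhd d y (⟪ V ⟫ y)
      finer   : ∀ V → 𝒟 d V → Nbhd c y (⟪ V ⟫ y)

  open _~[_]_

  opaque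
    def-Reflexive : Def₁ C Reflexive
    def-Reflexive c = def-∀* Δ (def-→ (def-𝒟 (wk*ᵐ Δ c) (fst* Δ)) (def-∀ (def-ball (wkᵐ (fst* Δ)) v₀ v₀)))

    def-Symmetric : Def₁ C Symmetric
    def-Symmetric c = def-∀* Δ (def-→ (def-𝒟 (wk*ᵐ Δ c) (fst* Δ)) (def-∀ (def-∀
      (def-→ (def-ball (wkᵐ (wkᵐ (fst* Δ))) (wkᵖ v₀) v₀) (def-ball (wkᵐ (wkᵐ (fst* Δ))) v₀ (wkᵖ v₀))))))

    def-Directed : Def₁ C Directed
    def-Directed c = def-∀* Δ (def-∀* Δ
      (def-→ (def-𝒟 (wk*ᵐ Δ (wk*ᵐ Δ c)) (wk*ᵐ Δ (fst* Δ)))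
      (def-→ (def-𝒟 (wk*ᵐ Δ (wk*ᵐ Δ c)) (fst* Δ))
      (def-∃* Δ (def-× (def-𝒟 (wk*ᵐ Δ (wk*ᵐ Δ (wk*ᵐ Δ c))) (fst* Δ)) (def-∀ (def-∀
        (def-→ (def-ball (wkᵐ (wkᵐ (fst* Δ))) (wkᵖ v₀) v₀)
        (def-× (def-ball (wkᵐ (wkᵐ (wk*ᵐ Δ (wk*ᵐ Δ (fst* Δ))))) (wkᵖ v₀) v₀)
               (def-ball (wkᵐ (wkᵐ (wk*ᵐ Δ (fst* Δ)))) (wkᵖ v₀) v₀))))))))))

    def-Halving : Def₁ C Halving
    def-Halving c = def-∀* Δ (def-→ (def-𝒟 (wk*ᵐ Δ c) (fst* Δ))
      (def-∃* Δ (def-× (def-𝒟 (wk*ᵐ Δ (wk*ᵐ Δ c)) (fst* Δ)) (def-∀ (def-∀ (def-∀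
        (def-→ (def-ball (wkᵐ (wkᵐ (wkᵐ (fst* Δ)))) (wkᵖ (wkᵖ v₀)) (wkᵖ v₀))
        (def-→ (def-ball (wkᵐ (wkᵐ (wkᵐ (fst* Δ)))) (wkᵖ v₀) v₀)
               (def-ball (wkᵐ (wkᵐ (wkᵐ (wk*ᵐ Δ (fst* Δ))))) (wkᵖ (wkᵖ v₀)) v₀)))))))))

    def-Large : Def₁ C Large
    def-Large c = def-∀* Δ (def-→ (def-𝒟 (wk*ᵐ Δ c) (fst* Δ)) (def-∀
      (def-AtLeast (proj₁ ball-bound) (def-ball (wkᵐ (wkᵐ (fst* Δ))) (wkᵖ v₀) v₀))))

    def-Open-test : Def₁ C Open-test
    def-Open-test c = def-∀* Π (def-∀* Δ (def-→
      (def-AtLeast (proj₁ Far-bound) (def-Far (wkᵐ (wk*ᵐ Δ (fst* Π))) (wkᵐ (fst* Δ)) v₀))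
      (def-∃ (def-Nbhd (wkᵐ (wk*ᵐ Δ (wk*ᵐ Π c))) v₀
        (def-Far (wkᵐ (wkᵐ (wk*ᵐ Δ (fst* Π)))) (wkᵐ (wkᵐ (fst* Δ))) v₀)))))

    def-Boundary-test : Def₁ C Boundary-test
    def-Boundary-test c = def-∀* Δ (def-∀ (def-¬ (def-AtLeast (proj₁ Boundary-bound)
      (def-Boundary (wkᵐ (wkᵐ (wk*ᵐ Δ c))) (wkᵐ (wkᵐ (fst* Δ))) (wkᵖ v₀) v₀))))

    def-Good : Def₁ C Good
    def-Good c = def-⇔
      (λ t → mk⇔ (λ g → refl-c g , sym-c g , dir-c g , half-c g , large-c g , open-c g , bdry-c g)
                 (λ { (a , b , c , d , e , f , g) → good a b c d e f g }))
      (def-× (def-Reflexive c) (def-× (def-Symmetric c) (def-× (def-Directed c)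
      (def-× (def-Halving c) (def-× (def-Large c) (def-× (def-Open-test c) (def-Boundary-test c)))))))

    def-~ : ∀ {c d : Tuple Γ → Tuple Π} {y} → IsMap C Γ Π c → IsPt C Γ home y → IsMap C Γ Π d →
      DefinableOver C (λ t → c t ~[ y t ] d t)
    def-~ {Γ} {C} {y = y} c yᵖ d = def-⇔ (λ t → mk⇔ (λ g → coarser g , finer g) (λ { (f , g) → germs f g }))
      (def-× (half c d) (half d c))
      where
      half : ∀ {c d : Tuple Γ → Tuple Π} → IsMap C Γ Π c → IsMap C Γ Π d →
        DefinableOver C (λ t → ∀ V → 𝒟 (c t) V → Nbhd (d t) (y t) (⟪ V ⟫ (y t)))
      half c d = def-∀* Δ (def-→ (def-𝒟 (wk*ᵐ Δ c) (fst* Δ))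
        (def-Nbhd (wk*ᵐ Δ d) (wk*ᵖ Δ yᵖ) (def-ball (wkᵐ (fst* Δ)) (wkᵖ (wk*ᵖ Δ yᵖ)) v₀)))

  opaque
    good-c₀ : Good c₀
    good-c₀ = good
      (λ V → ball-refl)
      (λ V dV x y → symmetric V (𝒟⇒D dV))
      (λ V W dV dW → let V′ , dV′ , h = directed V W (𝒟⇒D dV) (𝒟⇒D dW) in V′ , D⇒𝒟 dV′ , λ x y → h)
      (λ V dV → let W , dW , h = halving V (𝒟⇒D dV) in W , D⇒𝒟 dW , λ x y z → h)
      (λ V dV x → Infinite⇒AtLeast _ (ball-infinite dV x))
      (λ d V al → subst₂-Interior d V (proj₂ Far-bound (++⁺ V d) (subst (AtLeast _) (sym (eq d V)) al)))
      (λ W x al → interior⇒infinite (proj₂ Boundary-bound (x ∷ W) al)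
        (exterior-finite (def-ball paramᵐ paramᵖ v₀)))
      where
      eq : ∀ d V → Far (++⁻ʳ Δ (++⁺ V d)) (++⁻ˡ Δ (++⁺ V d)) ≡ Far d V
      eq d V = cong₂ Far (++⁻ʳ∘++⁺ V) (++⁻ˡ∘++⁺ V)
      subst₂-Interior : ∀ d V → Interior (Far (++⁻ʳ Δ (++⁺ V d)) (++⁻ˡ Δ (++⁺ V d))) → Interior (Far d V)
      subst₂-Interior d V = subst Interior (eq d V)

  opaque
    -- `Large` gives enough points for interior in the topology of `c₀`, where sets with interior
    -- are infinite.
    good-ball-infinite : ∀ {c V} → Good c → 𝒟 c V → ∀ x → Infinite (⟪ V ⟫ x)
    good-ball-infinite {V = V} good-c dV x =
      interior⇒infinite (proj₂ ball-bound (x ∷ V) (large-c good-c V dV x))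

  opaque
    -- Otherwise `Open-test` puts a ball of `𝒟 c` around some `x` inside `Far d V`. A smaller ball
    -- around `x` lies in the `V`-ball of each of its points, so none of its points is interior to
    -- it for `𝒟 d`. All of this infinite ball is then boundary, against `Boundary-test` for `d`.
    Far-few : ∀ {c d V} → Good c → Good d → 𝒟 c V → ¬ AtLeast (proj₁ Far-bound) (Far d V)
    Far-few {c} {d} {V} good-c good-d dV al with open-c good-c d V al | half-c good-c V dV
    ... | x , V′ , dV′ , V′⊆Far | W , dW , W∘W⊆V = contra (dir-c good-c V′ W dV′ dW)
      where
      contra : ¬ (∃[ V″ ] 𝒟 c V″ × ∀ x y → ⟪ V″ ⟫ x y → ⟪ V′ ⟫ x y × ⟪ W ⟫ x y)
      contra (V″ , dV″ , V″⊆) = good-ball-infinite good-c dV″ x (Finite-⊆ in-boundary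
        (¬AtLeast⇒Finite (proj₁ Boundary-bound) (bdry-c good-d V″ x)))
        where
        in-boundary : ∀ {y} → ⟪ V″ ⟫ x y → Boundary d V″ x y
        in-boundary {y} b = b , λ nb → V′⊆Far y (proj₁ (V″⊆ x y b))
          (Nbhd-mono (λ {z} b′ → W∘W⊆V y x z (sym-c good-c W dW x y (proj₂ (V″⊆ x y b))) (proj₂ (V″⊆ x z b′))) nb)

  opaque
    -- Being far persists when `V` shrinks, so finitely many conflicts share one `V`, to which
    -- `Far-few` applies.
    Conflict-finite : ∀ {c d} → Good c → Good d → Finite (λ y → ∃[ V ] 𝒟 c V × Far d V y)
    Conflict-finite {c} {d} good-c good-d =
      -- The additional point makes the list nonempty, so that `common` has an entourage to start
      -- from.
      ¬AtLeast⇒Finite (suc (proj₁ Far-bound)) λ al → few (AtLeast⇒Unique (suc (proj₁ Far-bound)) al)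
      where
      common : ∀ y ys → All (λ y → ∃[ V ] 𝒟 c V × Far d V y) (y ∷ ys) → ∃[ V ] 𝒟 c V × All (Far d V) (y ∷ ys)
      common y []        ((V , dV , f) ∷ []) = V , dV , f ∷ []
      common y (y′ ∷ ys) ((V , dV , f) ∷ hs) =
        let W , dW , gs = common y′ ys hs
            V′ , dV′ , s = dir-c good-c V W dV dW
        in V′ , dV′ , (λ nb → f (Nbhd-mono (λ b → proj₁ (s _ _ b)) nb)) ∷
                      All.map (λ g nb → g (Nbhd-mono (λ b → proj₂ (s _ _ b)) nb)) gs
      few : ¬ (∃[ ys ] length ys ≡ suc (proj₁ Far-bound) × Unique ys × All (λ y → ∃[ V ] 𝒟 c V × Far d V y) ys)
      few (y ∷ ys , len , u , hs) = let V , dV , fs = common y ys hs in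
        Far-few good-c good-d dV (AtLeast-pred _ (subst (λ n → AtLeast n (Far d V)) len (Unique⇒AtLeast u fs)))

  opaque
    ≁-finite : ∀ {c d} → Good c → Good d → Finite (λ y → ¬ c ~[ y ] d)
    ≁-finite {c} {d} good-c good-d = Finite-⊆ split (Finite-⊎ (Conflict-finite good-c good-d) (Conflict-finite good-d good-c))
      where
      split : ∀ {y} → ¬ c ~[ y ] d → (∃[ V ] 𝒟 c V × Far d V y) ⊎ (∃[ V ] 𝒟 d V × Far c V y)
      split {y} ¬~ = dne λ ¬s → ¬~ (germs
          (λ V dV → dne λ ¬nb → ¬s (inj₁ (V , dV , ¬nb)))
          (λ V dV → dne λ ¬nb → ¬s (inj₂ (V , dV , ¬nb))))

  opaque
    -- The finite sets of disagreement form a definable family; one exceeding its bound would have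
    -- interior and be infinite.
    ≁-bound : ∃[ n ] ∀ {c d} → Good c → Good d → ¬ AtLeast (suc n) (λ y → ¬ c ~[ y ] d)
    ≁-bound = proj₁ bounded , λ {c} {d} good-c good-d al →
      interior⇒infinite (proj₂ bounded (++⁺ c d)
        (subst (AtLeast (proj₁ bounded)) (sym (eq c d)) (AtLeast-pred (proj₁ bounded) al)))
        (subst Finite (sym (eq c d)) (≁-finite good-c good-d))
      where
      Y : Tuple (Π ++ Π) → M → Set ℓ
      Y θ y = ¬ ++⁻ˡ Π θ ~[ y ] ++⁻ʳ Π θ
      bounded : ∃[ n ] ∀ θ → AtLeast n (Y θ) → Interior (Y θ)
      bounded = uniform-bound Y λ θ y → def-¬ (def-~ (takeᵐ θ) y (dropᵐ θ))
      eq : ∀ c d → Y (++⁺ c d) ≡ (λ y → ¬ c ~[ y ] d)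
      eq c d = cong₂ (λ c d y → ¬ c ~[ y ] d) (++⁻ˡ∘++⁺ c) (++⁻ʳ∘++⁺ c)

  opaque
    ~-refl : ∀ {y c} → c ~[ y ] c
    ~-refl = germs (λ V dV → V , dV , λ y b → b) (λ V dV → V , dV , λ y b → b)

    ~-sym : ∀ {y c d} → c ~[ y ] d → d ~[ y ] c
    ~-sym (germs f g) = germs g f

    ~-transport : ∀ {y c d Y} → c ~[ y ] d → Nbhd c y Y → Nbhd d y Y
    ~-transport (germs f _) (V , dV , h) = Nbhd-mono (λ {z} → h z) (f V dV)

    ~-trans : ∀ {y c d e} → c ~[ y ] d → d ~[ y ] e → c ~[ y ] e
    ~-trans cd de = germs (λ V dV → ~-transport de (coarser cd V dV))
                          (λ V dV → ~-transport (~-sym cd) (finer de V dV))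

  opaque
    pattern-of-conflicts : Majority.Pattern em Good _~[_]_ ~-refl ~-sym ~-trans (proj₁ ≁-bound) (proj₂ ≁-bound) good-c₀
    pattern-of-conflicts = Majority.pattern-exists em Good _~[_]_ ~-refl ~-sym ~-trans (proj₁ ≁-bound) (proj₂ ≁-bound) good-c₀

  open Majority.Pattern pattern-of-conflicts

  -- A notion of interior without parameters.

  copies : ℕ → Context
  copies zero    = []
  copies (suc n) = Π ++ copies n

  nth′ : ∀ n → Fin n → Tuple (copies n) → Tuple Π
  nth′ (suc n) zero    cs = ++⁻ˡ Π cs
  nth′ (suc n) (suc i) cs = nth′ n i (++⁻ʳ Π cs)

  nth : Fin m → Tuple (copies m) → Tuple Π
  nth = nth′ m

  collect : ∀ n → (Fin n → Tuple Π) → Tuple (copies n)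
  collect zero    c = []
  collect (suc n) c = ++⁺ (c zero) (collect n (c ∘ suc))

  nth-collect : ∀ n (c : Fin n → Tuple Π) i → nth′ n i (collect n c) ≡ c i
  nth-collect (suc n) c zero    = ++⁻ˡ∘++⁺ (c zero)
  nth-collect (suc n) c (suc i) = trans (cong (nth′ n i) (++⁻ʳ∘++⁺ (c zero))) (nth-collect n (c ∘ suc) i)

  points : ∀ {n} → (Fin n → M) → M^ n
  points {zero}  y = []
  points {suc n} y = y zero ∷ points (y ∘ suc)

  points-! : ∀ {n} (y : Fin n → M) i → _!_ {n} (points y) i ≡ y i
  points-! y zero    = refl
  points-! y (suc i) = points-! (y ∘ suc) i

  nthᵐ : ∀ n {cs : Tuple Γ → Tuple (copies n)} (i : Fin n) → IsMap C Γ (copies n) cs →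
    IsMap C Γ Π (λ t → nth′ n i (cs t))
  nthᵐ (suc n) zero    cs = takeᵐ cs
  nthᵐ (suc n) (suc i) cs = nthᵐ n i (dropᵐ cs)

  Realisation : Tuple (copies m) → M^ r → Set ℓ
  Realisation cs ys = Realises (λ i → nth i cs) (_!_ {r} ys)

  Optimum : Tuple Π → M → Set ℓ
  Optimum c y = ∃[ cs ] ∃[ ys ] Realisation cs ys ×
    (∀ i j → nth i cs ~[ y ] nth j cs) × nth i₀ cs ~[ y ] c

  -- The germ of 𝒟 c at y is the one on which optimal lists of uniformities agree;
  -- unlike 𝒟 c₀, this is defined without parameters.
  record Main (c : Tuple Π) (y : M) : Set ℓ where
    constructor main
    field
      good-c  : Good c
      optimum : Optimum c y

  -- Interior for the preferred germ at `y`. By `Main-agree` all witnesses `c` give the same answer,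
  -- so `c` can be quantified away instead of being a parameter.
  Int* : Pred M ℓ → Pred M ℓ
  Int* Y y = ∃[ c ] Main c y × Nbhd c y Y

  opaque
    def-Realisation : Def₂ C Realisation
    def-Realisation {C} {Γ} {f} {g} cs ys = def-×
      (def-∀Fin λ i → def-Good (nthᵐ m i cs))
      (def-× (def-∀Fin λ s → def-∀Fin λ s′ → def-→ (def-≡ (at! {k = r} ys) (at! {k = r} ys)) (def-dec (s Fin.≟ s′)))
             (def-∀Fin λ s → def-∀Fin λ i → def-∀Fin λ j →
               def-→ (def-dec (conflict s i j Nat.≟ 1)) (def-¬ (def-~ (nthᵐ m i cs) (at! {k = r} ys) (nthᵐ m j cs)))))

  opaque
    def-Optimum : ∀ {c : Tuple Γ → Tuple Π} {y} → IsMap C Γ Π c → IsPt C Γ home y →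
      DefinableOver C (λ t → Optimum (c t) (y t))
    def-Optimum {Γ} {C} {c} {y} cᵐ yᵖ = def-∃* (copies m) (def-∃* (replicate r home)
      (def-× (def-Realisation cs (fst* (replicate r home)))
      (def-× (def-∀Fin λ i → def-∀Fin λ j → def-~ (nthᵐ m i cs) y′ (nthᵐ m j cs))
             (def-~ (nthᵐ m i₀ cs) y′ (wk*ᵐ (replicate r home) (wk*ᵐ (copies m) cᵐ))))))
      where
      Γ′ : Context
      Γ′ = replicate r home ++ (copies m ++ Γ)
      cs : IsMap C Γ′ (copies m) (λ t → ++⁻ˡ (copies m) (++⁻ʳ (replicate r home) t))
      cs = wk*ᵐ (replicate r home) (fst* (copies m))
      y′ : IsPt C Γ′ home (λ t → y (++⁻ʳ (copies m) (++⁻ʳ (replicate r home) t)))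
      y′ = wk*ᵖ (replicate r home) (wk*ᵖ (copies m) yᵖ)

  opaque
    def-Main : ∀ {c : Tuple Γ → Tuple Π} {y} → IsMap C Γ Π c → IsPt C Γ home y →
      DefinableOver C (λ t → Main (c t) (y t))
    def-Main c y = def-⇔
      (λ t → mk⇔ (λ h → Main.good-c h , Main.optimum h) (λ h → main (proj₁ h) (proj₂ h)))
      (def-× (def-Good c) (def-Optimum c y))

  opaque
    def-Int* : ∀ {Y : Tuple Γ → M → Set ℓ} {y} → DefinableOver C {home ∷ Γ} (λ t → Y (tl t) (hd t)) →
      IsPt C Γ home y → DefinableOver C (λ t → Int* (Y t) (y t))
    def-Int* d y = def-∃* Π (def-× (def-Main (fst* Π) (wk*ᵖ Π y))
      (def-Nbhd (fst* Π) (wk*ᵖ Π y) (def-pre d (v₀ ∷ᵐ wkᵐ (wk*ᵐ Π idᵐ)))))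

  opaque
    -- Each germ equals that of a realisation of the pattern unanimous at `y`, and `agree`
    -- identifies the germs of two such realisations.
    Main-agree : ∀ {c d y} → Main c y → Main d y → c ~[ y ] d
    Main-agree (main _ (cs , ys , R , un , c~)) (main _ (ds , zs , R′ , un′ , d~)) =
      ~-trans (~-sym c~) (~-trans (agree {λ i → nth i cs} {_!_ {r} ys} {λ i → nth i ds} {_!_ {r} zs} R R′ un un′ i₀ i₀) d~)

  opaque
    -- For a fixed realisation of the pattern, `c₀` can fail only where two of its members disagree,
    -- or where its member at `i₀` disagrees with `c₀`. There are finitely many such points by
    -- `≁-finite`.
    Main-c₀ : Finite (λ y → ¬ Main c₀ y)
    Main-c₀ with realised
    ... | c , y , goods , inj , dis = Finite-⊆ bad (Finite-⊎
        (Finite-⋃ λ i → Finite-⋃ λ j → ≁-finite (good′ i) (good′ j)) (≁-finite (good′ i₀) good-c₀))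
      where
      cs : Tuple (copies m)
      cs = collect m c
      ys : M^ r
      ys = points y
      good′ : ∀ i → Good (nth i cs)
      good′ i = subst Good (sym (nth-collect m c i)) (goods i)
      R : Realisation cs ys
      R = good′ , (λ s s′ e → inj s s′ (trans (sym (points-! y s)) (trans e (points-! y s′)))) ,
        λ s i j e h → dis s i j e (subst (λ z → c i ~[ z ] c j) (points-! y s)
          (subst (λ d → c i ~[ ys′ s ] d) (nth-collect m c j) (subst (λ d → d ~[ ys′ s ] nth j cs) (nth-collect m c i) h)))
        where
        ys′ : Fin r → M
        ys′ = _!_ {r} ys
      bad : ∀ {z} → ¬ Main c₀ z →
        (∃[ i ] ∃[ j ] ¬ nth i cs ~[ z ] nth j cs) ⊎ ¬ nth i₀ cs ~[ z ] c₀
      bad {z} ¬main = dne λ ¬bad → ¬main (main good-c₀ (cs , ys , R ,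
        (λ i j → dne λ ¬~ → ¬bad (inj₁ (i , j , ¬~))) , dne λ ¬~ → ¬bad (inj₂ ¬~)))

  opaque
    -- Wherever `c₀` is `Main`, its own neighbourhoods witness `Int*`, so `exterior-finite` accounts
    -- for all but the finitely many other points.
    Int*-exterior-finite : ∀ {Y} → Definable {Γ = [ home ]} (λ t → Y (hd t)) → Finite (λ y → Y y × ¬ Int* Y y)
    Int*-exterior-finite {Y} d = Finite-⊆ split (Finite-⊎ (exterior-finite d) Main-c₀)
      where
      split : ∀ {y} → Y y × ¬ Int* Y y → (Y y × ¬ Nbhd c₀ y Y) ⊎ ¬ Main c₀ y
      split {y} (y∈ , ¬int) with em {Main c₀ y}
      ... | yes main₀ = inj₁ (y∈ , λ nb → ¬int (c₀ , main₀ , nb))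
      ... | no ¬main = inj₂ ¬main

  opaque
    -- One uniformity `𝒟 c` can be used for all `v` of the box. The set of `v` whose fibre contains
    -- the `V`-ball of `b` grows as `V` shrinks, so `directed-int` gives one `V` over a smaller box.
    -- Its ball is infinite, and the slab bound turns it into interior.
    HasInt-Int* : ∀ n (X : M^ suc n → Set ℓ) → Def₁ U X → ∀ b →
      HasInt n (λ v → Int* (λ y → X (y ∷ v)) b) → HasInt (suc n) X
    -- Any point of the box serves to obtain some `c` with `Main c b`.
    HasInt-Int* n X dX b int@(β , val , h) with h _ (proj₂ (box-nonempty n β val))
    ... | c , main-c@(main good-c _) , V₀ , dV₀ , _ =
      conclude (directed-int n (𝒟 c) (V₀ , dV₀) F dF dir (β , val , λ v v∈ → germ (h v v∈)))
      where
      F : Tuple Δ → M^ n → Set ℓ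
      F V v = ∀ y → ⟪ V ⟫ b y → X (y ∷ v)
      dF : Def₂ U F
      dF V v = def-∀ (def-→ (def-ball (wkᵐ V) paramᵖ v₀) (dX (v₀ ∷ᵐ wkᵐ v)))
      dir : ∀ V W → 𝒟 c V → 𝒟 c W → ∃[ V′ ] 𝒟 c V′ × ∀ v → F V v ⊎ F W v → F V′ v
      dir V W dV dW = let V′ , dV′ , s = Good.dir-c good-c V W dV dW in
        V′ , dV′ , λ v → [ (λ f y y∈ → f y (proj₁ (s b y y∈))) , (λ f y y∈ → f y (proj₂ (s b y y∈))) ]′
      germ : ∀ {v} → Int* (λ y → X (y ∷ v)) b → ∃[ V ] 𝒟 c V × F V v
      germ (c′ , main′ , nb) = ~-transport (Main-agree main′ main-c) nb
      conclude : ∃[ V ] 𝒟 c V × HasInt n (F V) → HasInt (suc n) X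
      conclude (V , dV , β′ , val′ , f) = HasInt-∷ n β′ val′ (proj₂ bound [] β′
          (Infinite⇒AtLeast (proj₁ bound) λ fin →
            good-ball-infinite good-c dV b (Finite-⊆ (λ {y} y∈ v v∈ → f v v∈ y y∈) fin)))
        where
        bound : ∃[ k ] ∀ (_ : Tuple []) β → AtLeast k (Slab n X β) → Interior (Slab n X β)
        bound = slab-bound {Θ = []} n (λ _ → X) (λ _ → dX)

  opaque
    Def₂-U : ∀ {C} (P : Tuple Θ → Tuple Γ → Set ℓ) → Def₂ C P → Def₂ U P
    Def₂-U {C = C} P d = Def₂-mono {C = C} {C′ = U} {P = P} (λ {x} _ → tt) d

  -- Covers with finite fibres.

  upd : ∀ n → M^ n → Fin n → M → M^ n
  upd (suc n) v zero    y = y ∷ tl v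
  upd (suc n) v (suc i) y = hd v ∷ upd n (tl v) i y

  updᵐ : ∀ n {v : Tuple Γ → M^ n} {y} (i : Fin n) → IsMap C Γ (replicate n home) v → IsPt C Γ home y →
    IsMap C Γ (replicate n home) (λ t → upd n (v t) i (y t))
  updᵐ (suc n) zero    v y = y ∷ᵐ tlᵐ v
  updᵐ (suc n) (suc i) v y = hdᵖ v ∷ᵐ updᵐ n i (tlᵐ v) y

  record FibreCover (C : Params) (n : ℕ) (X : M^ n → Tuple Θ → Set ℓ) : Set (lsuc ℓ) where
    field
      piece     : Fin n → M^ n → Tuple Θ → Set ℓ
      def-piece : ∀ i → Def₂ C (piece i)
      cover     : ∀ v θ → X v θ → ∃[ i ] piece i v θ
      finite    : ∀ i v θ → Finite (λ y → piece i (upd n v i y) θ)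

  opaque
    -- In the recursive call the first coordinate joins the parameters `Θ`, so the pieces stay
    -- definable uniformly in it. Since `Int*` introduces no parameters, they stay definable over
    -- `C`, as needed for algebraicity over `C`.
    fibre-cover : ∀ n (X : M^ n → Tuple Θ → Set ℓ) → Def₂ C X → (∀ θ → ¬ HasInt n (λ v → X v θ)) →
      FibreCover C n X
    fibre-cover zero X dX ¬int = record
      { piece = λ () ; def-piece = λ () ; finite = λ ()
      ; cover = λ { [] θ x → ⊥-elim (¬int θ ([] , tt , λ { [] _ → x })) } }
    fibre-cover {Θ} {C} (suc n) X dX ¬int = record
      { piece     = piece
      ; def-piece = def-piece
      ; cover     = cover
      ; finite    = finite }
      where
      X′ : M^ n → Tuple (home ∷ Θ) → Set ℓ
      X′ v θ = Int* (λ y → X (y ∷ v) (tl θ)) (hd θ)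
      ¬int′ : ∀ θ → ¬ HasInt n (λ v → X′ v θ)
      ¬int′ (b ∷ θ) int = ¬int θ (HasInt-Int* n (λ v → X v θ)
        (λ v → Def₂-U X dX v paramᵐ) b int)
      IH : FibreCover C n X′
      IH = fibre-cover n X′
        (λ v θ → def-Int* (dX (v₀ ∷ᵐ wkᵐ v) (wkᵐ (tlᵐ θ))) (hdᵖ θ)) ¬int′
      piece : Fin (suc n) → M^ suc n → Tuple Θ → Set ℓ
      piece zero    w θ = X w θ × ¬ Int* (λ y → X (y ∷ tl w) θ) (hd w)
      piece (suc i) w θ = FibreCover.piece IH i (tl w) (hd w ∷ θ)
      def-piece : ∀ i → Def₂ C (piece i)
      def-piece zero    w θ = def-× (dX w θ)
        (def-¬ (def-Int* (dX (v₀ ∷ᵐ wkᵐ (tlᵐ w)) (wkᵐ θ)) (hdᵖ w)))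
      def-piece (suc i) w θ = FibreCover.def-piece IH i (tlᵐ w) (hdᵖ w ∷ᵐ θ)
      cover : ∀ w θ → X w θ → ∃[ i ] piece i w θ
      cover (y ∷ v) θ x with em {Int* (λ y → X (y ∷ v) θ) y}
      ... | yes int = Prod.map suc id (FibreCover.cover IH v (y ∷ θ) int)
      ... | no ¬int = zero , x , ¬int
      finite : ∀ i v θ → Finite (λ y → piece i (upd (suc n) v i y) θ)
      finite zero    v θ = Int*-exterior-finite
        (Def₂-U X dX (v₀ ∷ᵐ paramᵐ) paramᵐ)
      finite (suc i) v θ = FibreCover.finite IH i (tl v) (hd v ∷ θ)

  -- Families of finite sets in the plane.

  module Plane (R : M → M → M → Set ℓ)
    (def-R : ∀ {Γ e b c} → IsPt U Γ home e → IsPt U Γ home b → IsPt U Γ home c →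
      Definable (λ t → R (e t) (b t) (c t)))
    (fin₁ : ∀ e → Finite (λ b → ∃[ c ] R e b c))
    (fin₂ : ∀ e → Finite (λ c → ∃[ b ] R e b c)) where

    -- Finiteness of both projections of `R e` gives such a `V` at every covered point, and the
    -- condition persists when `V` shrinks; `directed-int` thus finds one `V` for a whole box.
    Isolated : Tuple Δ → M^ 2 → Set ℓ
    Isolated V v = ∃[ e ] R e (hd v) (hd (tl v)) ×
      (∀ b → ⟪ V ⟫ (hd v) b → (∃[ c ] R e b c) → b ≡ hd v) ×
      (∀ c → ⟪ V ⟫ (hd (tl v)) c → (∃[ b ] R e b c) → c ≡ hd (tl v))

    opaque
      def-Isolated : Def₂ U Isolated
      def-Isolated V v = def-∃ (def-× (def-R v₀ (wkᵖ (hdᵖ v)) (wkᵖ (hdᵖ (tlᵐ v))))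
        (def-× (def-∀ (def-→ (def-ball (wkᵐ (wkᵐ V)) (wkᵖ (wkᵖ (hdᵖ v))) v₀)
                 (def-→ (def-∃ (def-R (wkᵖ (wkᵖ v₀)) (wkᵖ v₀) v₀)) (def-≡ v₀ (wkᵖ (wkᵖ (hdᵖ v)))))))
               (def-∀ (def-→ (def-ball (wkᵐ (wkᵐ V)) (wkᵖ (wkᵖ (hdᵖ (tlᵐ v)))) v₀)
                 (def-→ (def-∃ (def-R (wkᵖ (wkᵖ v₀)) v₀ (wkᵖ v₀))) (def-≡ v₀ (wkᵖ (wkᵖ (hdᵖ (tlᵐ v))))))))))

      covered : ∀ {v} → (∃[ e ] R e (hd v) (hd (tl v))) → ∃[ V ] 𝒟 c₀ V × Isolated V v
      covered {v} (e , Rebc) =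
        let W₁ , dW₁ , s₁ = separate (hd v) (proj₁ (fin₁ e))
            W₂ , dW₂ , s₂ = separate (hd (tl v)) (proj₁ (fin₂ e))
            V , dV , V⊆   = Good.dir-c good-c₀ W₁ W₂ dW₁ dW₂
        in V , dV , e , Rebc ,
           (λ b b∈ Rb → s₁ (proj₂ (fin₁ e) Rb) (proj₁ (V⊆ _ _ b∈))) ,
           (λ c c∈ Rc → s₂ (proj₂ (fin₂ e) Rc) (proj₂ (V⊆ _ _ c∈)))

      directed-Isolated : ∀ V W → 𝒟 c₀ V → 𝒟 c₀ W →
        ∃[ V′ ] 𝒟 c₀ V′ × ∀ v → Isolated V v ⊎ Isolated W v → Isolated V′ v
      directed-Isolated V W dV dW =
        let V′ , dV′ , V′⊆ = Good.dir-c good-c₀ V W dV dW in V′ , dV′ , λ v →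
          [ (λ { (e , r , f , g) → e , r , (λ b b∈ → f b (proj₁ (V′⊆ _ _ b∈))) , (λ c c∈ → g c (proj₁ (V′⊆ _ _ c∈))) })
          , (λ { (e , r , f , g) → e , r , (λ b b∈ → f b (proj₂ (V′⊆ _ _ b∈))) , (λ c c∈ → g c (proj₂ (V′⊆ _ _ c∈))) }) ]′

      -- On a small box, first and second coordinates form two independent families.
      rank>1 : (x₁ x₂ : M) (W₁ W₂ V : Tuple Δ) → 𝒟 c₀ W₁ → 𝒟 c₀ W₂ →
        (∀ {b b′} → ⟪ W₁ ⟫ x₁ b → ⟪ W₁ ⟫ x₁ b′ → ⟪ V ⟫ b b′) →
        (∀ {c c′} → ⟪ W₂ ⟫ x₂ c → ⟪ W₂ ⟫ x₂ c′ → ⟪ V ⟫ c c′) →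
        (∀ {b c} → ⟪ W₁ ⟫ x₁ b → ⟪ W₂ ⟫ x₂ c → Isolated V (b ∷ c ∷ [])) →
        (dpRank> 1) {Γ = [ home ]} (U {ℓ = ℓ})
      rank>1 x₁ x₂ W₁ W₂ V dW₁ dW₂ small₁ small₂ isolated =
        (λ _ → [ home ]) , (λ i → proj₁ (dφ i)) , B , B-infinite , pattern-at
        where
        Φ : Fin 2 → Tuple (home ∷ home ∷ []) → Set ℓ
        Φ zero    t = ∃[ c ] R (hd t) (hd (tl t)) c
        Φ (suc _) t = ∃[ b ] R (hd t) b (hd (tl t))
        dφ : ∀ i → Definable {Γ = home ∷ home ∷ []} (Φ i)
        dφ zero    = def-∃ (def-R (wkᵖ v₀) (wkᵖ (hdᵖ (tlᵐ idᵐ))) v₀)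
        dφ (suc _) = def-∃ (def-R (wkᵖ v₀) v₀ (wkᵖ (hdᵖ (tlᵐ idᵐ))))
        B : Fin 2 → Tuple [ home ] → Set ℓ
        B zero    t = ⟪ W₁ ⟫ x₁ (hd t)
        B (suc _) t = ⟪ W₂ ⟫ x₂ (hd t)
        B-infinite : ∀ i → Infinite (B i)
        B-infinite zero    fin = ball-infinite dW₁ x₁ (Finite-map hd (λ {y} y∈ → (y ∷ []) , y∈ , refl) fin)
        B-infinite (suc _) fin = ball-infinite dW₂ x₂ (Finite-map hd (λ {y} y∈ → (y ∷ []) , y∈ , refl) fin)
        singleton : ∀ {t u : Tuple [ home ]} → hd t ≡ hd u → t ≡ u
        singleton {x ∷ []} {.x ∷ []} refl = refl
        pattern-at : (b : ∀ i → Tuple [ home ]) → (∀ i → B i (b i)) →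
          Σ (Tuple [ home ]) λ a → U {ℓ = ℓ} a × ∀ i y → B i y → solutions (proj₁ (dφ i)) (++⁺ a y) ⇔ y ≡ b i
        pattern-at b b∈ with isolated (b∈ zero) (b∈ (suc zero))
        ... | e , r , f , g = (e ∷ []) , tt , single
          where
          single : ∀ i y → B i y → solutions (proj₁ (dφ i)) (++⁺ (e ∷ []) y) ⇔ y ≡ b i
          single zero (y ∷ []) y∈ = mk⇔
            (λ s → singleton (f y (small₁ (b∈ zero) y∈) (from (proj₂ (dφ zero) _) s)))
            (λ eq → to (proj₂ (dφ zero) _) (hd (b (suc zero)) , subst (λ t → R e (hd t) (hd (b (suc zero)))) (sym eq) r))
          single (suc zero) (y ∷ []) y∈ = mk⇔
            (λ s → singleton (g y (small₂ (b∈ (suc zero)) y∈) (from (proj₂ (dφ (suc zero)) _) s)))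
            (λ eq → to (proj₂ (dφ (suc zero)) _) (hd (b zero) , subst (λ t → R e (hd (b zero)) (hd t)) (sym eq) r))

    opaque
      no-plane : ¬ HasInt 2 (λ v → ∃[ e ] R e (hd v) (hd (tl v)))
      no-plane int with directed-int 2 (𝒟 c₀) 𝒟-nonempty Isolated def-Isolated directed-Isolated
          (HasInt-mono 2 {X′ = λ v → ∃[ V ] 𝒟 c₀ V × Isolated V v} (λ {v} → covered {v}) int)
      ... | V , dV , int′ with HasInt-uncons 1 int′
      -- Sides of radius inside `W` have any two of their points `V`-close, so isolation by `V`
      -- distinguishes all points of a side.
      ... | x₁ , V₁ , dV₁ , (x₂ ∷ β) , (dV₂ , _) , h with halving V (𝒟⇒D dV)
      ... | W , dW , W∘W⊆V = contra (Good.dir-c good-c₀ W V₁ (D⇒𝒟 dW) dV₁)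
                                    (Good.dir-c good-c₀ W (++⁻ˡ Δ β) (D⇒𝒟 dW) dV₂)
        where
        small : ∀ {W₁ x} {V₁ : M → M → Set ℓ} → (∀ x y → ⟪ W₁ ⟫ x y → ⟪ W ⟫ x y × V₁ x y) →
          ∀ {b b′} → ⟪ W₁ ⟫ x b → ⟪ W₁ ⟫ x b′ → ⟪ V ⟫ b b′
        small {x = x} s b∈ b′∈ = W∘W⊆V (symmetric W dW (proj₁ (s x _ b∈))) (proj₁ (s x _ b′∈))
        contra : (∃[ W₁ ] 𝒟 c₀ W₁ × ∀ x y → ⟪ W₁ ⟫ x y → ⟪ W ⟫ x y × ⟪ V₁ ⟫ x y) →
          ¬ (∃[ W₂ ] 𝒟 c₀ W₂ × ∀ x y → ⟪ W₂ ⟫ x y → ⟪ W ⟫ x y × ⟪ ++⁻ˡ Δ β ⟫ x y)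
        contra (W₁ , dW₁ , s₁) (W₂ , dW₂ , s₂) = proj₂ (proj₂ dp-minimal)
          (rank>1 x₁ x₂ W₁ W₂ V dW₁ dW₂ (small {W₁} {x₁} {⟪ V₁ ⟫} s₁) (small {W₂} {x₂} {⟪ ++⁻ˡ Δ β ⟫} s₂)
            λ {b} {c} b∈ c∈ → h {b} {c ∷ []} (proj₂ (s₁ x₁ b b∈)) (proj₂ (s₂ x₂ c c∈) , tt))

  -- Families of finite sets in higher dimensions.

  omit : ∀ n → Fin (suc n) → M^ suc n → M^ n
  omit n       zero    v = tl v
  omit (suc n) (suc j) v = hd v ∷ omit n j (tl v)

  insert : ∀ n → Fin (suc n) → M → M^ n → M^ suc n
  insert n       zero    y w = y ∷ w
  insert (suc n) (suc j) y w = hd w ∷ insert n j y (tl w)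

  omitᵐ : ∀ n {v : Tuple Γ → M^ suc n} j → IsMap C Γ (replicate (suc n) home) v →
    IsMap C Γ (replicate n home) (λ t → omit n j (v t))
  omitᵐ n       zero    v = tlᵐ v
  omitᵐ (suc n) (suc j) v = hdᵖ v ∷ᵐ omitᵐ n j (tlᵐ v)

  insertᵐ : ∀ n {y : Tuple Γ → M} {w : Tuple Γ → M^ n} j → IsPt C Γ home y →
    IsMap C Γ (replicate n home) w → IsMap C Γ (replicate (suc n) home) (λ t → insert n j (y t) (w t))
  insertᵐ n       zero    y w = y ∷ᵐ w
  insertᵐ (suc n) (suc j) y w = hdᵖ w ∷ᵐ insertᵐ n j y (tlᵐ w)

  omit-insert : ∀ n j y w → omit n j (insert n j y w) ≡ w
  omit-insert n       zero    y w       = refl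
  omit-insert (suc n) (suc j) y (x ∷ w) = cong (x ∷_) (omit-insert n j y w)

  insert-omit : ∀ n j v → ∃[ y ] insert n j y (omit n j v) ≡ v
  insert-omit n       zero    (x ∷ v) = x , refl
  insert-omit (suc n) (suc j) (x ∷ v) = Prod.map₂ (cong (x ∷_)) (insert-omit n j v)

  omit-upd : ∀ n j v y → omit n j (upd (suc n) v j y) ≡ omit n j v
  omit-upd n       zero    v y = refl
  omit-upd (suc n) (suc j) v y = cong (hd v ∷_) (omit-upd n j (tl v) y)

  omit-upd-punchIn : ∀ n j i v y → omit n j (upd (suc n) v (Fin.punchIn j i) y) ≡ upd n (omit n j v) i y
  omit-upd-punchIn (suc n) zero    i       v y = refl
  omit-upd-punchIn (suc n) (suc j) zero    v y = refl
  omit-upd-punchIn (suc n) (suc j) (suc i) v y = cong (hd v ∷_) (omit-upd-punchIn n j i (tl v) y)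

  upd-comm : ∀ n v {i j} y z → i ≢ j → upd n (upd n v i y) j z ≡ upd n (upd n v j z) i y
  upd-comm (suc n) v {zero}  {zero}  y z i≢j = ⊥-elim (i≢j refl)
  upd-comm (suc n) v {zero}  {suc j} y z i≢j = refl
  upd-comm (suc n) v {suc i} {zero}  y z i≢j = refl
  upd-comm (suc n) v {suc i} {suc j} y z i≢j = cong (hd v ∷_) (upd-comm n (tl v) y z (i≢j ∘ cong suc))

  opaque
    box-side : ∀ n β → Valid n β → ∀ i → ∃[ x ] ∃[ V ] 𝒟 c₀ V ×
      ∀ v y → InBox n β v → ⟪ V ⟫ x y → InBox n β (upd n v i y)
    box-side (suc n) (x ∷ β) (dV , val) zero    = x , _ , dV , λ v y v∈ y∈ → y∈ , proj₂ v∈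
    box-side (suc n) (x ∷ β) (dV , val) (suc i) =
      let x′ , V , dV , h = box-side n _ val i in
      x′ , V , dV , λ v y v∈ y∈ → proj₁ v∈ , h (tl v) y (proj₂ v∈) y∈

    -- All coordinates other than `i` and `j` are frozen at a point of the box, while these two
    -- range over the corresponding sides.
    HasInt-slice : ∀ n (X : Pred (M^ n) ℓ) i j → HasInt n X →
      ∃[ v ] HasInt 2 (λ u → X (upd n (upd n v i (hd u)) j (hd (tl u))))
    HasInt-slice n X i j (β , val , h) =
      let v , v∈ = box-nonempty n β val
          x , V , dV , p = box-side n β val i
          y , W , dW , q = box-side n β val j
      in v , x ∷ ++⁺ V (y ∷ ++⁺ W []) ,
         (subst (𝒟 c₀) (sym (++⁻ˡ∘++⁺ V)) dV ,
          subst (Valid 1) (sym (++⁻ʳ∘++⁺ V)) (subst (𝒟 c₀) (sym (++⁻ˡ∘++⁺ W)) dW , tt)) ,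
         λ { (b ∷ c ∷ []) u∈ →
           let b∈ , u∈′ = box-uncons 1 x V (y ∷ ++⁺ W []) {b} {c ∷ []} u∈
               c∈ , _   = box-uncons 0 y W [] {c} {[]} u∈′
           in h _ (q _ c (p v b v∈ b∈) c∈) }

  NoCover : ℕ → Set (lsuc ℓ)
  NoCover n = ∀ (R : M^ n → M^ suc n → Set ℓ) → Def₂ U R → (∀ e → Finite (R e)) →
    ¬ HasInt (suc n) (λ v → ∃[ e ] R e v)

  module CoverStep (n : ℕ) (IH : NoCover n) (R : M^ suc n → M^ suc (suc n) → Set ℓ)
    (dR : Def₂ U R) (fin : ∀ e → Finite (R e)) where

    X : M^ suc (suc n) → M → Set ℓ
    X v c = ∃[ e ] R (c ∷ e) v

    Y : Fin (suc (suc n)) → M^ suc n → Tuple [ home ] → Set ℓ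
    Y j w c = ∃[ y ] X (insert (suc n) j y w) (hd c)

    opaque
      dX : ∀ {Γ} {v : Tuple Γ → M^ suc (suc n)} {c} →
        IsMap U Γ (replicate (suc (suc n)) home) v → IsPt U Γ home c → Definable (λ t → X (v t) (c t))
      dX v c = def-∃* (replicate n home)
        (dR (wk*ᵖ (replicate n home) c ∷ᵐ fst* (replicate n home)) (wk*ᵐ (replicate n home) v))

      dY : ∀ j → Def₂ U (Y j)
      dY j w c = def-∃ (dX (insertᵐ (suc n) j v₀ (wkᵐ w)) (wkᵖ (hdᵖ c)))

      -- Fixing the first index and omitting one coordinate of `v` lowers both dimensions by one,
      -- which is the situation of `IH`.
      ¬int-Y : ∀ j c → ¬ HasInt (suc n) (λ w → Y j w c)
      ¬int-Y j c int = IH (λ e w → ∃[ y ] R (hd c ∷ e) (insert (suc n) j y w))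
        (λ e w → def-∃ (dR (paramᵖ ∷ᵐ wkᵐ e) (insertᵐ (suc n) j v₀ (wkᵐ w))))
        (λ e → Finite-map (omit (suc n) j) (λ { (y , r) → _ , r , omit-insert (suc n) j y _ }) (fin (hd c ∷ e)))
        (HasInt-mono (suc n) (λ { (y , e , r) → e , y , r }) int)

      covers : ∀ j → FibreCover U (suc n) (Y j)
      covers j = fibre-cover (suc n) (Y j) (dY j) (¬int-Y j)

    Z : ∀ j → Fin (suc n) → M^ suc n → Tuple [ home ] → Set ℓ
    Z j = FibreCover.piece (covers j)

    -- Two coordinates of v are algebraic over c and the others.
    T : (i i′ : Fin (suc n)) → M^ suc (suc n) → M → Set ℓ
    T i i′ v c = X v c × Z zero i (omit (suc n) zero v) (c ∷ []) ×
      Z (suc i) i′ (omit (suc n) (suc i) v) (c ∷ [])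

    opaque
      dT : ∀ i i′ {Γ} {v : Tuple Γ → M^ suc (suc n)} {c} →
        IsMap U Γ (replicate (suc (suc n)) home) v → IsPt U Γ home c → Definable (λ t → T i i′ (v t) (c t))
      dT i i′ v c = def-× (dX v c)
        (def-× (FibreCover.def-piece (covers zero) i (omitᵐ (suc n) zero v) (c ∷ᵐ []ᵐ))
               (FibreCover.def-piece (covers (suc i)) i′ (omitᵐ (suc n) (suc i) v) (c ∷ᵐ []ᵐ)))

    opaque
      locate : ∀ j v c → X v c → ∃[ i ] Z j i (omit (suc n) j v) (c ∷ [])
      locate j v c x = FibreCover.cover (covers j) _ (c ∷ [])
        (proj₁ (insert-omit (suc n) j v) , subst (λ v → X v c) (sym (proj₂ (insert-omit (suc n) j v))) x)

    opaque
      found : ∀ {v} → (∃[ e ] R e v) → ∃[ i ] ∃[ i′ ] ∃[ c ] T i i′ v c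
      found {v} (c ∷ e , r) =
        -- Omitting the first coordinate shows that coordinate `suc i` of `v` is algebraic. That one
        -- is omitted next, so the second algebraic coordinate is a different one; `Fin.punchIn`
        -- recovers its position in `v`.
        let i  , z  = locate zero v c (e , r)
            i′ , z′ = locate (suc i) v c (e , r)
        in i , i′ , c , (e , r) , z , z′

    module _ (i i′ : Fin (suc n)) (v : M^ suc (suc n)) where

      j₁ j₂ : Fin (suc (suc n))
      j₁ = suc i
      j₂ = Fin.punchIn (suc i) i′

      R₂ : M → M → M → Set ℓ
      R₂ c b b′ = T i i′ (upd _ (upd _ v j₁ b) j₂ b′) c

      opaque
        dR₂ : ∀ {Γ e b c} → IsPt U Γ home e → IsPt U Γ home b → IsPt U Γ home c →
          Definable (λ t → R₂ (e t) (b t) (c t))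
        dR₂ c b b′ = dT i i′ (updᵐ _ j₂ (updᵐ _ j₁ (paramᵐ {u = v}) b) b′) c

        -- The second piece ignores coordinate `j₁`, so one finite set contains `b′` for all `b`.
        fin₂ : ∀ c → Finite (λ b′ → ∃[ b ] R₂ c b b′)
        fin₂ c = Finite-⊆ (λ { {b′} (b , _ , _ , z) → subst (λ w → Z (suc i) i′ w (c ∷ []))
            (trans (omit-upd-punchIn (suc n) j₁ i′ _ b′)
                   (cong (λ w → upd (suc n) w i′ b′) (omit-upd (suc n) j₁ v b))) z })
          (FibreCover.finite (covers (suc i)) i′ (omit (suc n) j₁ v) (c ∷ []))

        -- The first piece may depend on `b′`, but only finitely many `b′` occur by `fin₂`, and each
        -- of them admits finitely many `b`.
        fin₁ : ∀ c → Finite (λ b → ∃[ b′ ] R₂ c b b′)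
        fin₁ c = Finite-bind (fin₂ c)
          (λ b′ → FibreCover.finite (covers zero) i (omit (suc n) zero (upd _ v j₂ b′)) (c ∷ []))
          (λ { {b} (b′ , r@(_ , z , _)) → b′ , (b , r) , subst (λ w → Z zero i (omit (suc n) zero w) (c ∷ []))
            (upd-comm (suc (suc n)) v b b′ (Finₚ.punchInᵢ≢i (suc i) i′ ∘ sym)) z })

        not-two : ¬ HasInt 2 (λ u → ∃[ c ] R₂ c (hd u) (hd (tl u)))
        not-two = Plane.no-plane R₂ dR₂ fin₁ fin₂

    opaque
      step : ¬ HasInt (suc (suc n)) (λ v → ∃[ e ] R e v)
      step int =
        let i  , int₁ = HasInt-⋃ (suc (suc n)) {X = λ i v → ∃[ i′ ] ∃[ c ] T i i′ v c}
              (λ i v → def-∃Fin λ i′ → def-∃ (dT i i′ (wkᵐ v) v₀)) (HasInt-mono (suc (suc n)) (λ {v} → found {v}) int)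
            i′ , int₂ = HasInt-⋃ (suc (suc n)) {X = λ i′ v → ∃[ c ] T i i′ v c}
              (λ i′ v → def-∃ (dT i i′ (wkᵐ v) v₀)) int₁
            v  , int₃ = HasInt-slice (suc (suc n)) (λ v → ∃[ c ] T i i′ v c) (suc i) (Fin.punchIn (suc i) i′) int₂
        in not-two i i′ v int₃

  opaque
    no-cover : ∀ n → NoCover n
    -- The index set `M^ 0` has one point, so a single finite set would contain an infinite ball.
    no-cover zero R dR fin int =
      let x , V , dV , β , val , h = HasInt-uncons 0 int in
      ball-infinite dV x (Finite-map hd (λ {y} y∈ → (y ∷ []) , unit (h y∈ tt) , refl) (fin []))
      where
      unit : ∀ {v} → ∃[ e ] R e v → R [] v
      unit ([] , r) = r
    no-cover (suc n) R dR fin = CoverStep.step n (no-cover n) R dR fin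

  -- Coordinate subsets and algebraicity.

  upd-same : ∀ k v i y → _!_ {k} (upd k v i y) i ≡ y
  upd-same (suc k) v zero    y = refl
  upd-same (suc k) v (suc i) y = upd-same k (tl v) i y

  upd-other : ∀ k v {i j} y → i ≢ j → _!_ {k} (upd k v i y) j ≡ _!_ {k} v j
  upd-other (suc k) (x ∷ v) {zero}  {zero}  y i≢j = ⊥-elim (i≢j refl)
  upd-other (suc k) (x ∷ v) {zero}  {suc j} y i≢j = refl
  upd-other (suc k) (x ∷ v) {suc i} {zero}  y i≢j = refl
  upd-other (suc k) (x ∷ v) {suc i} {suc j} y i≢j = upd-other k v y (i≢j ∘ cong suc)

  upd-id : ∀ k v i → upd k v i (_!_ {k} v i) ≡ v
  upd-id (suc k) (x ∷ v) zero    = refl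
  upd-id (suc k) (x ∷ v) (suc i) = cong (x ∷_) (upd-id k v i)

  !-ext : ∀ k {v w} → (∀ i → _!_ {k} v i ≡ _!_ {k} w i) → v ≡ w
  !-ext zero    {[]}    {[]}    h = refl
  !-ext (suc k) {x ∷ v} {y ∷ w} h = cong₂ _∷_ (h zero) (!-ext k (h ∘ suc))

  proj : ∀ k (S : Subset k) → M^ k → M^ ∣ S ∣
  proj zero    []            v = []
  proj (suc k) (inside ∷ S)  v = hd v ∷ proj k S (tl v)
  proj (suc k) (outside ∷ S) v = proj k S (tl v)

  projᵐ : ∀ k (S : Subset k) {v : Tuple Γ → M^ k} → IsMap C Γ (replicate k home) v →
    IsMap C Γ (replicate ∣ S ∣ home) (λ t → proj k S (v t))
  projᵐ zero    []            v = []ᵐ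
  projᵐ (suc k) (inside ∷ S)  v = hdᵖ v ∷ᵐ projᵐ k S (tlᵐ v)
  projᵐ (suc k) (outside ∷ S) v = projᵐ k S (tlᵐ v)

  AgreeOn : ∀ k → Subset k → M^ k → M^ k → Set ℓ
  AgreeOn k S v w = ∀ j → j ∈ₛ S → _!_ {k} v j ≡ _!_ {k} w j

  AgreeOn⇒proj≡ : ∀ k S {v w} → AgreeOn k S v w → proj k S v ≡ proj k S w
  AgreeOn⇒proj≡ zero    []            h = refl
  AgreeOn⇒proj≡ (suc k) (inside ∷ S)  {x ∷ v} {y ∷ w} h =
    cong₂ _∷_ (h zero here) (AgreeOn⇒proj≡ k S λ j j∈ → h (suc j) (there j∈))
  AgreeOn⇒proj≡ (suc k) (outside ∷ S) {x ∷ v} {y ∷ w} h = AgreeOn⇒proj≡ k S λ j j∈ → h (suc j) (there j∈)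

  proj≡⇒AgreeOn : ∀ k S {v w} → proj k S v ≡ proj k S w → AgreeOn k S v w
  proj≡⇒AgreeOn (suc k) (inside ∷ S)  {x ∷ v} {y ∷ w} e zero    here       = cong hd e
  proj≡⇒AgreeOn (suc k) (inside ∷ S)  {x ∷ v} {y ∷ w} e (suc j) (there j∈) = proj≡⇒AgreeOn k S (cong tl e) j j∈
  proj≡⇒AgreeOn (suc k) (outside ∷ S) {x ∷ v} {y ∷ w} e (suc j) (there j∈) = proj≡⇒AgreeOn k S e j j∈

  element : ∀ k (S : Subset k) → Fin ∣ S ∣ → Fin k
  element (suc k) (inside ∷ S)  zero    = zero
  element (suc k) (inside ∷ S)  (suc i) = suc (element k S i)
  element (suc k) (outside ∷ S) i       = suc (element k S i)

  element∈ : ∀ k S i → element k S i ∈ₛ S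
  element∈ (suc k) (inside ∷ S)  zero    = here
  element∈ (suc k) (inside ∷ S)  (suc i) = there (element∈ k S i)
  element∈ (suc k) (outside ∷ S) i       = there (element∈ k S i)

  upd-proj : ∀ k S v i y → upd ∣ S ∣ (proj k S v) i y ≡ proj k S (upd k v (element k S i) y)
  upd-proj (suc k) (inside ∷ S)  v zero    y = refl
  upd-proj (suc k) (inside ∷ S)  v (suc i) y = cong (hd v ∷_) (upd-proj k S (tl v) i y)
  upd-proj (suc k) (outside ∷ S) v i       y = upd-proj k S (tl v) i y

  AgreeOn-upd : ∀ k S j {v w} y → AgreeOn k (S - j) v w → AgreeOn k S (upd k v j y) (upd k w j y)
  AgreeOn-upd k S j {v} {w} y h i i∈ with j Fin.≟ i
  ... | yes refl = trans (upd-same k v j y) (sym (upd-same k w j y))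
  ... | no j≢i   = trans (upd-other k v y j≢i)
    (trans (h i (x∈p∧x≢y⇒x∈p-y i∈ (j≢i ∘ sym))) (sym (upd-other k w y j≢i)))

  opaque
    def-tuple≡ : ∀ n {f g : Tuple Γ → M^ n} → IsMap C Γ (replicate n home) f → IsMap C Γ (replicate n home) g →
      DefinableOver C (λ t → f t ≡ g t)
    def-tuple≡ n f g = def-⇔ (λ t → mk⇔ (λ e i → cong (λ u → _!_ {n} u i) e) (!-ext n))
      (def-∀Fin λ i → def-≡ (at! {k = n} f) (at! {k = n} g))

    Finite-product : ∀ k {Q : Fin k → Pred M ℓ} → (∀ i → Finite (Q i)) → Finite (λ v → ∀ i → Q i (_!_ {k} v i))
    Finite-product zero    fin = [] ∷ [] , λ { {[]} _ → here refl }
    Finite-product (suc k) {Q} fin = Finite-bind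
      {Q = λ x w → ∃[ v ] (∀ i → Q (suc i) (_!_ {k} v i)) × x ∷ v ≡ w} (fin zero)
      (λ x → Finite-map (x ∷_) (λ { (v , h , e) → v , h , e }) (Finite-product k (fin ∘ suc)))
      λ { {x ∷ v} h → x , h zero , v , h ∘ suc , refl }

  -- Algebraicity of y over C and the coordinates in S of a, witnessed uniformly in a.
  record Acl (C : Params) (k : ℕ) (S : Subset k) (a : M^ k) (y : M) : Set ℓ where
    field
      ψ      : FormulaOver C (home ∷ replicate k home)
      local  : ∀ {v w z} → AgreeOn k S v w → solutions ψ (z ∷ v) → solutions ψ (z ∷ w)
      finite : ∀ v → Finite (λ z → solutions ψ (z ∷ v))
      holds  : solutions ψ (y ∷ a)

  opaque
    mkAcl : ∀ k {S a y} (P : M → M^ k → Set ℓ) →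
      DefinableOver C {home ∷ replicate k home} (λ t → P (hd t) (tl t)) →
      (∀ {v w z} → AgreeOn k S v w → P z v → P z w) → (∀ v → Finite (λ z → P z v)) → P y a → Acl C k S a y
    mkAcl k P (ψ , h) local finite p = record
      { ψ      = ψ
      ; local  = λ ag s → to (h _) (local ag (from (h _) s))
      ; finite = λ v → Finite-⊆ (from (h _)) (finite v)
      ; holds  = to (h _) p }

  -- The parameters `u` as a function of the tuple: those that are coordinates of `a` in `S` become
  -- variables, and those from `C` stay constant.
  record Entries (C : Params) (k : ℕ) (S : Subset k) (a : M^ k) {Λ : Context} (u : Tuple Λ) : Set ℓ where
    field
      params   : M^ k → Tuple Λ
      isMap    : IsMap C (replicate k home) Λ params
      local    : ∀ {v w} → AgreeOn k S v w → params v ≡ params w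
      at-a     : params a ≡ u

  opaque
    entries-map : ∀ k S a {Λ} (u : Tuple Λ) → (∀ {s} (i : s ∈ Λ) → (C ∪ entries {k} a S) (s , lookup u i)) →
      Entries C k S a u
    entries-map k S a []      over = record { params = λ _ → [] ; isMap = []ᵐ ; local = λ _ → refl ; at-a = refl }
    entries-map {C} k S a {s ∷ Λ} (x ∷ u) over = extend x (over (here refl))
      where
      rest : Entries C k S a u
      rest = entries-map k S a u (over ∘ there)
      extend : ∀ {s} (x : Carrier s) → (C ∪ entries {k} a S) (s , x) → Entries C k S a (x ∷ u)
      extend x (inj₁ c) = record
        { params = λ v → x ∷ Entries.params rest v
        ; isMap  = constᵖ c ∷ᵐ Entries.isMap rest
        ; local  = λ ag → cong (x ∷_) (Entries.local rest ag)
        ; at-a   = cong (x ∷_) (Entries.at-a rest) }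
      extend .(_!_ {k} a j) (inj₂ (j , j∈ , refl)) = record
        { params = λ v → _!_ {k} v j ∷ Entries.params rest v
        ; isMap  = at! {k = k} idᵐ ∷ᵐ Entries.isMap rest
        ; local  = λ ag → cong₂ _∷_ (ag j j∈) (Entries.local rest ag)
        ; at-a   = cong (_ ∷_) (Entries.at-a rest) }

  opaque
    -- The coordinates of `a` among the parameters become variables. The added clause that there are
    -- fewer than `n` solutions forces finiteness for every `v`, not only for `a`.
    acl⇒Acl : ∀ k S a y → acl (C ∪ entries {k} a S) (home , y) → Acl C k S a y
    acl⇒Acl {C} k S a y (χ , sol , fin) = mkAcl k P
      (def-× (def-⟦ formula ⟧ (v₀ ∷ᵐ wkᵐ isMap)) (def-¬ (def-AtLeast n (def-⟦ formula ⟧ (v₀ ∷ᵐ wkᵐ (wkᵐ isMap))))))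
      (λ {v} {w} {z} ag → subst (λ u → ⟦ formula ⟧ (z ∷ u) × ¬ AtLeast n (λ z → ⟦ formula ⟧ (z ∷ u))) (local ag))
      (λ v → em-finite v)
      (subst (λ u → ⟦ formula ⟧ (y ∷ u) × ¬ AtLeast n (λ z → ⟦ formula ⟧ (z ∷ u))) (sym at-a) (sol , proj₂ bound))
      where
      open FormulaOver χ using (formula)
      open Entries (entries-map {C} k S a (FormulaOver.params χ) (FormulaOver.over χ))
      bound : ∃[ n ] ¬ AtLeast n (λ z → ⟦ formula ⟧ (z ∷ FormulaOver.params χ))
      bound = Finite⇒¬AtLeast (Finite-map hd (λ {z} s → (z ∷ []) , s , refl) fin)
      n : ℕ
      n = proj₁ bound
      P : M → M^ k → Set ℓ
      P z v = ⟦ formula ⟧ (z ∷ params v) × ¬ AtLeast n (λ z → ⟦ formula ⟧ (z ∷ params v))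
      em-finite : ∀ v → Finite (λ z → P z v)
      em-finite v with em {AtLeast n (λ z → ⟦ formula ⟧ (z ∷ params v))}
      ... | yes al = [] , λ p → ⊥-elim (proj₂ p al)
      ... | no ¬al = Finite-⊆ proj₁ (¬AtLeast⇒Finite n ¬al)

  opaque
    -- The coordinates in `S` are fixed as parameters and the others are quantified existentially,
    -- which adds no solutions because `ψ` is local.
    Acl⇒acl : ∀ k S a y → Acl C k S a y → acl (C ∪ entries {k} a S) (home , y)
    Acl⇒acl {C} k S a y α = proj₁ dQ , to (proj₂ dQ (y ∷ [])) (a , (λ j j∈ → refl) , Acl.holds α) ,
      Finite-map (_∷ []) (λ { {z ∷ []} s → z , fibre (from (proj₂ dQ (z ∷ [])) s) , refl }) (Acl.finite α a)
      where
      Q : M → Set ℓ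
      Q z = ∃[ u ] AgreeOn k S u a × solutions (Acl.ψ α) (z ∷ u)
      C′ : Params
      C′ = C ∪ entries {k} a S
      dψ : DefinableOver C (solutions (Acl.ψ α))
      dψ = Acl.ψ α , λ t → mk⇔ id id
      fixed : ∀ {Γ} (u : Tuple Γ → M^ k) → IsMap C′ Γ (replicate k home) u → ∀ j → Dec (j ∈ₛ S) →
        DefinableOver C′ (λ t → j ∈ₛ S → _!_ {k} (u t) j ≡ _!_ {k} a j)
      fixed u uᵐ j (yes j∈) = def-⇔ (λ t → mk⇔ (λ f → f j∈) (λ e _ → e))
        (def-≡ (at! {k = k} uᵐ) (constᵖ (inj₂ (j , j∈ , refl))))
      fixed u uᵐ j (no j∉)  = def-true λ t j∈ → ⊥-elim (j∉ j∈)
      dQ : DefinableOver C′ {[ home ]} (λ t → Q (hd t))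
      dQ = def-∃* (replicate k home) (def-×
        (def-∀Fin λ j → fixed _ (fst* (replicate k home)) j (j ∈? S))
        (def-pre (def-mono {C = C} inj₁ dψ) (wk*ᵖ (replicate k home) v₀ ∷ᵐ fst* (replicate k home))))
      fibre : ∀ {z} → Q z → solutions (Acl.ψ α) (z ∷ a)
      fibre (u , ag , s) = Acl.local α ag s

  opaque
    Acl-self : ∀ k a i → Acl C k full a (_!_ {k} a i)
    Acl-self k a i = mkAcl k (λ z v → z ≡ _!_ {k} v i) (def-≡ v₀ (at! {k = k} (tlᵐ idᵐ)))
      (λ ag e → trans e (ag i ∈⊤)) (λ v → _!_ {k} v i ∷ [] , λ { refl → here refl }) refl

  opaque
    -- The coordinate `j` is replaced by a quantified solution `x` of the first formula; finitely
    -- many `x` with finitely many solutions each leave a finite set.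
    Acl-trans : ∀ k S j a y → Acl C k (S - j) a (_!_ {k} a j) → Acl C k S a y → Acl C k (S - j) a y
    Acl-trans {C} k S j a y α β = mkAcl k P
      (def-∃ (def-× (def-pre dα (v₀ ∷ᵐ wkᵐ (tlᵐ idᵐ)))
                    (def-pre dβ (wkᵖ v₀ ∷ᵐ updᵐ k j (wkᵐ (tlᵐ idᵐ)) v₀))))
      (λ { {v} {w} ag (x , sα , sβ) → x , Acl.local α ag sα , Acl.local β (AgreeOn-upd k S j {v} {w} x ag) sβ })
      (λ v → Finite-bind (Acl.finite α v) (λ x → Acl.finite β (upd k v j x)) id)
      (_!_ {k} a j , Acl.holds α , subst (λ v → solutions (Acl.ψ β) (y ∷ v)) (sym (upd-id k a j)) (Acl.holds β))
      where
      P : M → M^ k → Set ℓ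
      P z v = ∃[ x ] solutions (Acl.ψ α) (x ∷ v) × solutions (Acl.ψ β) (z ∷ upd k v j x)
      dα : DefinableOver C (solutions (Acl.ψ α))
      dα = Acl.ψ α , λ t → mk⇔ id id
      dβ : DefinableOver C (solutions (Acl.ψ β))
      dβ = Acl.ψ β , λ t → mk⇔ id id

  -- Agreement of algebraic and topological dimension.

  opaque
    -- Surplus dimensions are removed by dropping the first coordinate: the images of the finite
    -- sets still cover a box, as the slice at the centre `x` shows.
    no-cover-≤ : ∀ {t d} → t Nat.≤′ d → (R : M^ t → M^ suc d → Set ℓ) → Def₂ U R → (∀ e → Finite (R e)) →
      ¬ HasInt (suc d) (λ v → ∃[ e ] R e v)
    no-cover-≤ {t} {.t} (Nat.≤′-reflexive refl) R dR fin = no-cover t R dR fin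
    no-cover-≤ {t} {suc d} (Nat.≤′-step t≤d) R dR fin int =
      let x , V , dV , β , val , h = HasInt-uncons (suc d) int in
      no-cover-≤ t≤d (λ e w → ∃[ y ] R e (y ∷ w)) (λ e w → def-∃ (dR (wkᵐ e) (v₀ ∷ᵐ wkᵐ w)))
        (λ e → Finite-map tl (λ { {w} (y , r) → y ∷ w , r , refl }) (fin e))
        (β , val , λ w w∈ → let e , r = h (ball-refl dV x) w∈ in e , x , r)

  Image : ∀ k (S : Subset k) → Pred (M^ k) ℓ → Pred (M^ ∣ S ∣) ℓ
  Image k S A w = ∃[ v ] A v × proj k S v ≡ w

  opaque
    def-Image : ∀ k S {A : Tuple Θ → M^ k → Set ℓ} → Def₂ C A → Def₂ C (λ θ → Image k S (A θ))
    def-Image k S dA θ w = def-∃* (replicate k home)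
      (def-× (dA (wk*ᵐ (replicate k home) θ) (fst* (replicate k home)))
             (def-tuple≡ ∣ S ∣ (projᵐ k S (fst* (replicate k home))) (wk*ᵐ (replicate k home) w)))

  -- The topological dimension of A is at least d.
  Dim≥ : ∀ k → ℕ → Pred (M^ k) ℓ → Set ℓ
  Dim≥ k d A = Σ (Subset k) λ S → d ≤ ∣ S ∣ × HasInt ∣ S ∣ (Image k S A)

  Generates : Params → ∀ k → M^ k → Subset k → Set ℓ
  Generates C k a S = ∀ i → Acl C k S a (_!_ {k} a i)

  opaque
    -- The projection of `a` lies in a piece of a fibre cover over `C`, so one of its coordinates is
    -- algebraic over `C` and the other ones in `S`. By `Acl-trans` these others still generate `a`.
    discard : ∀ k S {A : Pred (M^ k) ℓ} {a} → DefinableOver C A → A a → Generates C k a S →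
      ¬ HasInt ∣ S ∣ (Image k S A) → ∃[ j ] j ∈ₛ S × Generates C k a (S - j)
    discard {C} k S {A} {a} dA a∈ gen ¬int =
      j , element∈ k S i , λ l → Acl-trans k S j a (_!_ {k} a l) alg (gen l)
      where
      X : M^ ∣ S ∣ → Tuple [] → Set ℓ
      X w _ = Image k S A w
      fc : FibreCover C ∣ S ∣ X
      fc = fibre-cover ∣ S ∣ X (λ w θ → def-Image {Θ = []} k S {λ _ → A} (λ _ v → def-pre dA v) []ᵐ w) λ _ → ¬int
      located : ∃[ i ] FibreCover.piece fc i (proj k S a) []
      located = FibreCover.cover fc (proj k S a) [] (a , a∈ , refl)
      i : Fin ∣ S ∣
      i = proj₁ located
      j : Fin k
      j = element k S i
      P : M → M^ k → Set ℓ
      P z v = FibreCover.piece fc i (proj k S (upd k v j z)) []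
      alg : Acl C k (S - j) a (_!_ {k} a j)
      alg = mkAcl k P (FibreCover.def-piece fc i (projᵐ k S (updᵐ k j (tlᵐ idᵐ) v₀)) []ᵐ)
        (λ {v} {w} {z} ag → subst (λ u → FibreCover.piece fc i u [])
          (AgreeOn⇒proj≡ k S (AgreeOn-upd k S j {v} {w} z ag)))
        (λ v → Finite-⊆ (λ {z} → subst (λ u → FibreCover.piece fc i u []) (sym (upd-proj k S v i z)))
          (FibreCover.finite fc i (proj k S v) []))
        (subst (λ v → FibreCover.piece fc i (proj k S v) []) (sym (upd-id k a j)) (proj₂ located))

  opaque
    independent⇒Dim≥ : ∀ k {d} {A : Pred (M^ k) ℓ} {a} → DefinableOver C A → A a →
      (∀ S → Generates C k a S → d ≤ ∣ S ∣) → Dim≥ k d A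
    independent⇒Dim≥ {C} k {d} {A} {a} dA a∈ min = search ∣ full {k} ∣ full ≤-refl (Acl-self k a)
      where
      -- The size of `S` is at most `n`; for `n = 0` there is no coordinate left to discard.
      search : ∀ n S → ∣ S ∣ ≤ n → Generates C k a S → Dim≥ k d A
      search n S S≤n gen with em {HasInt ∣ S ∣ (Image k S A)}
      ... | yes int = S , min S gen , int
      ... | no ¬int with discard k S dA a∈ gen ¬int
      search zero S S≤n gen | no ¬int | j , j∈ , gen′ with <-≤-trans (x∈p⇒∣p-x∣<∣p∣ j∈) S≤n
      ... | ()
      search (suc n) S S≤n gen | no ¬int | j , j∈ , gen′ =
        search n (S - j) (≤-pred (<-≤-trans (x∈p⇒∣p-x∣<∣p∣ j∈) S≤n)) gen′

  -- These formulas over `C` witness generation by fewer than `d` coordinates, so a point avoiding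
  -- all of them needs at least `d`.
  record Thin (C : Params) (k d : ℕ) : Set ℓ where
    field
      T      : Subset k
      small  : ∣ T ∣ < d
      ψ      : FormulaOver C (replicate k home)
      finite : ∀ v → Finite (λ w → solutions ψ w × AgreeOn k T v w)

  opaque
    generated⇒Thin : ∀ k {d a} T → ∣ T ∣ < d → Generates C k a T → Σ (Thin C k d) λ i → solutions (Thin.ψ i) a
    generated⇒Thin {C} k {d} {a} T small gen = record
      { T = T ; small = small ; ψ = proj₁ dP
      ; finite = λ v → Finite-⊆ (λ { {w} (s , ag) l → Acl.local (gen l) (λ j j∈ → sym (ag j j∈)) (from (proj₂ dP w) s l) })
          (Finite-product k (λ l → Acl.finite (gen l) v)) } , to (proj₂ dP a) (λ l → Acl.holds (gen l))
      where
      dP : DefinableOver C (λ v → ∀ l → solutions (Acl.ψ (gen l)) (_!_ {k} v l ∷ v))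
      dP = def-∀Fin λ l → def-pre {P = solutions (Acl.ψ (gen l))} (Acl.ψ (gen l) , λ t → mk⇔ id id) (at! {k = k} idᵐ ∷ᵐ idᵐ)

  opaque
    -- Sorted by the coordinates in `T`, a thin set is a family of finite sets with too few indices
    -- to cover a box.
    Thin-no-interior : ∀ k S (i : Thin C k ∣ S ∣) → ¬ HasInt ∣ S ∣ (Image k S (solutions (Thin.ψ i)))
    Thin-no-interior {C} k S i = go ∣ S ∣ (proj k S) (projᵐ k S) small
      where
      open Thin i
      -- The size of `S` is generalised to a variable `d`, so that matching can expose the successor
      -- required by `no-cover-≤`.
      go : ∀ d (π : M^ k → M^ d) → (∀ {Γ} {v : Tuple Γ → M^ k} → IsMap U Γ (replicate k home) v →
        IsMap U Γ (replicate d home) (λ t → π (v t))) → ∣ T ∣ < d → ¬ HasInt d (λ w → ∃[ v ] solutions ψ v × π v ≡ w)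
      go (suc d) π πᵐ (s≤s T≤d) int = no-cover-≤ (≤⇒≤′ T≤d) R dR fin-R
          (HasInt-mono (suc d) (λ { (v , s , e) → proj k T v , v , s , refl , e }) int)
        where
        R : M^ ∣ T ∣ → M^ suc d → Set ℓ
        R e w = ∃[ v ] solutions ψ v × proj k T v ≡ e × π v ≡ w
        dψ : Definable (solutions ψ)
        dψ = def-mono {C = C} (λ _ → tt) (ψ , λ t → mk⇔ id id)
        dR : Def₂ U R
        dR e w = def-∃* (replicate k home) (def-× (def-pre dψ (fst* (replicate k home)))
          (def-× (def-tuple≡ ∣ T ∣ (projᵐ k T (fst* (replicate k home))) (wk*ᵐ (replicate k home) e))
                 (def-tuple≡ (suc d) (πᵐ (fst* (replicate k home))) (wk*ᵐ (replicate k home) w))))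
        fin-R : ∀ e → Finite (R e)
        fin-R e with em {∃[ v ] proj k T v ≡ e}
        ... | no ¬v = [] , λ { (v , _ , eq , _) → ⊥-elim (¬v (v , eq)) }
        ... | yes (v , eq) = Finite-map π
          (λ { (w , s , eq′ , e′) → w , (s , proj≡⇒AgreeOn k T (trans eq (sym eq′))) , e′ }) (finite v)

  opaque
    -- If no such point exists, compactness covers `A` by finitely many thin sets. By `HasInt-⋃` the
    -- image of one of them has interior, which `Thin-no-interior` excludes.
    Dim≥⇒independent : ∀ k S {A : Pred (M^ k) ℓ} → Small C → DefinableOver C A → HasInt ∣ S ∣ (Image k S A) →
      ∃[ a ] A a × ∀ T → Generates C k a T → ∣ S ∣ ≤ ∣ T ∣
    Dim≥⇒independent {C} k S {A} C-small dA int = dne λ ¬a → no-list ¬a (compact-cover ¬a)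
      where
      -- The index `nothing` stands for lying in `A`, and `just i` for avoiding the thin set `i`.
      P : Maybe (Thin C k ∣ S ∣) → M^ k → Set ℓ
      P nothing  v = A v
      P (just i) v = ¬ solutions (Thin.ψ i) v
      dP : ∀ i → DefinableOver C (P i)
      dP nothing  = dA
      dP (just i) = def-¬ {P = solutions (Thin.ψ i)} (Thin.ψ i , λ t → mk⇔ id id)
      Independent : M^ k → Set ℓ
      Independent a = A a × ∀ T → Generates C k a T → ∣ S ∣ ≤ ∣ T ∣
      compact-cover : ¬ (∃ Independent) → ∃[ is ] ¬ (∃[ v ] ∀ {i} → i ∈ is → P i v)
      compact-cover ¬a = dne λ ¬is → contra (compactness sat C-small P dP λ is → dne λ ¬v → ¬is (is , ¬v))
        where
        contra : ¬ (∃[ v ] ∀ i → P i v)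
        contra (a , h) = ¬a (a , h nothing , λ T gen → ≮⇒≥ λ small →
          let i , s = generated⇒Thin k T small gen in h (just i) s)
      no-list : ¬ (∃ Independent) → ¬ (∃[ is ] ¬ (∃[ v ] ∀ {i} → i ∈ is → P i v))
      no-list ¬a (is , ¬v) = Thin-no-interior k S (proj₁ thin) (proj₂ thin)
        where
        Piece : Maybe (Thin C k ∣ S ∣) → Pred (M^ ∣ S ∣) ℓ
        Piece nothing  w = Empty.⊥
        Piece (just i) w = Image k S (solutions (Thin.ψ i)) w
        dPiece : ∀ i → Def₁ U (Piece i)
        dPiece nothing  w = def-false λ t ()
        dPiece (just i) w = def-Image {Θ = []} k S {λ _ → solutions (Thin.ψ i)}
          (λ _ v → def-pre (def-mono {C = C} (λ _ → tt) (Thin.ψ i , λ t → mk⇔ id id)) v) []ᵐ w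
        covered : ∀ {w} → Image k S A w → ∃[ n ] Piece (List.lookup is n) w
        covered {w} (v , v∈ , e) with dne {P = ∃[ i ] i ∈ is × ¬ P i v} (λ ¬i →
            ¬v (v , λ {i} i∈ → dne λ ¬p → ¬i (i , i∈ , ¬p)))
        ... | nothing , i∈ , ¬p = ⊥-elim (¬p v∈)
        ... | just i  , i∈ , ¬p = Any.index i∈ ,
          subst (λ i → Piece i w) (lookup-index i∈) (v , dne ¬p , e)
        extract : ∃[ i ] HasInt ∣ S ∣ (Piece i) → Σ (Thin C k ∣ S ∣) λ i → HasInt ∣ S ∣ (Image k S (solutions (Thin.ψ i)))
        extract (just i  , int) = i , int
        extract (nothing , int) with HasInt⇒∃ ∣ S ∣ int
        ... | _ , ()
        thin : Σ (Thin C k ∣ S ∣) λ i → HasInt ∣ S ∣ (Image k S (solutions (Thin.ψ i)))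
        thin = let n , int′ = HasInt-⋃ ∣ S ∣ {X = λ n → Piece (List.lookup is n)}
                     (λ n → dPiece (List.lookup is n)) (HasInt-mono ∣ S ∣ (λ {w} → covered {w}) int)
               in extract (List.lookup is n , int′)

  opaque
    least : ∀ (P : ℕ → Set ℓ) n → P n → ∃[ m ] P m × ∀ j → P j → m ≤ j
    least P zero    p = 0 , p , λ _ _ → z≤n
    least P (suc n) p with em {P 0} | least (P ∘ suc) n p
    ... | yes p₀ | _           = 0 , p₀ , λ _ _ → z≤n
    ... | no ¬p₀ | m , q , min = suc m , q , λ { zero p₀ → ⊥-elim (¬p₀ p₀) ; (suc j) pⱼ → s≤s (min j pⱼ) }

  opaque
    Generates⇒GeneratedBy : ∀ k {a S} → Generates C k a S → GeneratedBy {k} C a ∣ S ∣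
    Generates⇒GeneratedBy k {a} {S} gen = S , refl , λ i → Acl⇒acl k S a _ (gen i)

    GeneratedBy⇒Generates : ∀ k {a m} → GeneratedBy {k} C a m → Σ (Subset k) λ S → ∣ S ∣ ≡ m × Generates C k a S
    GeneratedBy⇒Generates k {a} (S , eq , gen) = S , eq , λ i → acl⇒Acl k S a _ (gen i)

    TupleDim-exists : ∀ C k a → ∃[ e ] TupleDim k C a e
    TupleDim-exists C k a = least (GeneratedBy {k} C a) _ (Generates⇒GeneratedBy k (Acl-self k a))

    TupleDim⇒Dim≥ : ∀ k {A : Pred (M^ k) ℓ} {a e} → DefinableOver C A → A a → TupleDim k C a e → Dim≥ k e A
    TupleDim⇒Dim≥ k dA a∈ (_ , min) =
      independent⇒Dim≥ k dA a∈ λ S gen → min ∣ S ∣ (Generates⇒GeneratedBy k gen)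

    Dim≥⇒TupleDim : ∀ k {d} {A : Pred (M^ k) ℓ} → Small C → DefinableOver C A → Dim≥ k d A →
      ∃[ a ] A a × ∃[ e ] TupleDim k C a e × d ≤ e
    Dim≥⇒TupleDim {C} k C-small dA (S , d≤S , int) =
      let a , a∈ , ind = Dim≥⇒independent k S C-small dA int
          e , dim      = TupleDim-exists C k a
          T , eq , gen = GeneratedBy⇒Generates k (proj₁ dim)
      in a , a∈ , e , dim , ≤-trans d≤S (≤-trans (ind T gen) (≤-reflexive eq))

  opaque
    -- `Dim≥` mentions no parameter set, so it can be compared with the tuple dimension over any
    -- small `C` defining `A`; in the backward direction the parameters of the given definition
    -- serve as `C`.
    Dim⇔Dim≥ : ∀ k d {A : Pred (M^ k) ℓ} → Definable A →
      Dim k A Infimum.[ d ] ⇔ (Dim≥ k d A × ¬ Dim≥ k (suc d) A)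
    Dim⇔Dim≥ k d {A} (χ , h) = mk⇔ forth back
      where
      forth : Dim k A Infimum.[ d ] → Dim≥ k d A × ¬ Dim≥ k (suc d) A
      forth (C , C-small , dA , (a , a∈ , dim) , max) = TupleDim⇒Dim≥ k dA a∈ dim , λ dim≥ →
        let a′ , a′∈ , e , dim′ , d<e = Dim≥⇒TupleDim k C-small dA dim≥
        in 1+n≰n (≤-trans d<e (max a′ a′∈ e dim′))
      Cᵪ : Params
      Cᵪ = ran (FormulaOver.params χ)
      dA : DefinableOver Cᵪ A
      dA = record { FormulaOver χ ; over = λ i → i , refl } , h
      back : Dim≥ k d A × ¬ Dim≥ k (suc d) A → Dim k A Infimum.[ d ]
      back (dim≥ , ¬dim≥) = Cᵪ , C-small , dA , (a , a∈ , subst (TupleDim k Cᵪ a) (≤-antisym (max a a∈ e dim) d≤e) dim) , max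
        where
        C-small : Small Cᵪ
        C-small = ran-small (FormulaOver.params χ)
        max : ∀ a → A a → ∀ e → TupleDim k Cᵪ a e → e ≤ d
        max a a∈ e dim = ≮⇒≥ λ d<e → let S , e≤S , int = TupleDim⇒Dim≥ k dA a∈ dim in
          ¬dim≥ (S , ≤-trans d<e e≤S , int)
        point : ∃[ a ] A a × ∃[ e ] TupleDim k Cᵪ a e × d ≤ e
        point = Dim≥⇒TupleDim k C-small dA dim≥
        a : M^ k
        a = proj₁ point
        a∈ : A a
        a∈ = proj₁ (proj₂ point)
        e : ℕ
        e = proj₁ (proj₂ (proj₂ point))
        dim : TupleDim k Cᵪ a e
        dim = proj₁ (proj₂ (proj₂ (proj₂ point)))
        d≤e : d ≤ e
        d≤e = proj₂ (proj₂ (proj₂ (proj₂ point)))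

  -- Definability of dimension in families.

  module _ (l k : ℕ) (A : M^ l → Pred (M^ k) ℓ) (family : DefinableFamily l k A) where

    opaque
      def-A : Def₂ U A
      def-A {f = f} {g} x y = def-⇔ (λ t → proj₂ family (f t) (g t))
        (def-pre {P = solutions (proj₁ family)} (proj₁ family , λ t → mk⇔ id id) (x ++ᵐ y))

      def-Dim≥ : ∀ d → Definable (λ x → Dim≥ k d (A x))
      def-Dim≥ d = def-∃Subset λ S → def-× (def-dec (d Nat.≤? ∣ S ∣)) (def-HasInt ∣ S ∣ (def-Image k S {A} def-A))

      -- `Dim` quantifies over parameter sets and is not visibly first-order; `Dim⇔Dim≥` replaces it
      -- by the existence of boxes in coordinate images, and value minus infinity is emptiness.
      def-Dim : (d : ℕ ₋) → Definable (λ x → Dim k (A x) d)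
      def-Dim ⊥₋         = def-⇔ (λ x → mk⇔ (λ { (lift empty) (y , y∈) → empty y y∈ }) (λ ¬e → lift λ y y∈ → ¬e (y , y∈)))
        (def-¬ (def-∃* (replicate k home) (def-A (wk*ᵐ (replicate k home) idᵐ) (fst* (replicate k home)))))
      def-Dim Infimum.[ d ] = def-⇔ (λ x → Dim⇔Dim≥ k d (def-A paramᵐ idᵐ))
        (def-× (def-Dim≥ d) (def-¬ (def-Dim≥ (suc d))))

open Infimum using () renaming ([_] to fin)

corollary2p5 : (∀ {a} → ExcludedMiddle a) →
    ∀ {ℓ} (L : Language ℓ) → let open Syntax L in
    (T : Theory) → Complete T → NIP T →
    (𝓜 : Structure) → 𝓜 ⊨ᵀ T → let open Semantics 𝓜 in
    Saturated → DpMinimal →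
    (𝓑 : DefinableUniformity) → let open DefinableUniformity 𝓑 in
    NoIsolatedPoints → InfiniteDefinableHasInterior →
    (l k : ℕ) (D : M^ l → Pred (M^ k) ℓ) → DefinableFamily l k D →
    (d : ℕ ₋) → d ≤₋ fin k →
    Definable {Γ = replicate l home} (λ x → Dim k (D x) d)
corollary2p5 em L T _ _ 𝓜 _ sat dp-minimal 𝓑 no-isolated infinite-interior l k D family d _ =
  Topology.def-Dim em 𝓜 sat dp-minimal 𝓑 no-isolated infinite-interior l k D family d
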